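{- Let $\eta>0$. There is no non-adaptive contention resolution algorithm, with no knowledge of the contention size $k$, that achieves latency $o\!\left(k\frac{\log k}{(\log\log k)^2}\right)$ with high probability, even against oblivious adversaries. That is, there do not exist a non-adaptive algorithm $\mathcal{A}$ (not depending on $k$) and a function $f$ with $f(k)=o\!\left(k\frac{\log k}{(\log\log k)^2}\right)$ as $k\to\infty$ such that, for every $k$ and every instance fixed in advance that activates exactly $k$ stations, with probability at least $1-1/k^{\eta}$ every station executing $\mathcal{A}$ transmits successfully within $f(k)$ rounds after its own activation.
   Context: Model. $k$ anonymous identical stations share a channel. Time is divided into discrete synchronous rounds; there is no global clock available to the stations and no collision detection. Initially all stations are asleep. Each station holds one packet. The activation round of a station is round $0$ of its local clock, and the station may transmit from its local round $1$ on. In each round every active station either transmits or listens. A transmission is successful if and only if exactly one active station transmits in that round; the transmitter then receives an acknowledgement and switches off permanently. In all other cases nothing is received. An instance is a schedule assigning to each station its activation time. An oblivious adversary knows only the algorithm's code and fixes the instance before the execution starts, without knowing the random choices of the stations. Non-adaptive algorithm without knowledge of $k$: a single probability distribution over sets of local rounds (subsets of $\{1,2,3,\ldots\}$), the same for all stations and for all values of $k$. Each station independently of the other stations draws a set from this distribution, and while it is active it transmits its packet exactly in the local rounds belonging to that set. The decisions of a station in different rounds need not be independent. -}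

module Defs where

open import Data.Bool.Base using (Bool; true; false)
import Data.Bool.Properties as Bool
open import Data.Empty using (⊥)
open import Data.Fin.Base using (Fin; toℕ)
import Data.Fin.Properties as Fin
open import Data.Integer.Base as ℤ using (+_; -[1+_])
import Data.Integer.Properties as ℤ
open import Data.List.Base as List using (List; []; _∷_)
open import Data.Nat.Base as ℕ using (ℕ; zero; suc; NonZero; _^_)
import Data.Nat.Properties as ℕ
open import Data.Product.Base using (∃; ∃-syntax; _×_; _,_; proj₁; proj₂)
open import Data.Rational.Base as ℚ using (ℚ; 0ℚ; 1ℚ; _/_; mkℚ)
import Data.Rational.Properties as ℚ
open import Data.Rational.Unnormalised.Base using (mkℚᵘ; *≤*)
import Data.Rational.Unnormalised.Properties as ℚᵘ
open import Data.Sum.Base using (_⊎_)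
open import Data.Vec.Base as Vec using (Vec; []; _∷_; _∷ʳ_; lookup)
import Data.Vec.Functional as Vector
open import Relation.Binary.PropositionalEquality using (_≡_; refl; sym; cong; subst; subst₂)
open import Relation.Nullary using (¬_; Dec; yes; no; contradiction)
open import Relation.Nullary.Decidable using (¬?; _×-dec_; _⊎-dec_; _→-dec_)

------------------------------------------------------------------------
-- Real numbers

-- Dedekind cuts presented by their lower halves: proper nonempty lower sets
-- of rationals without a greatest element.  Locatedness is not required, so
-- these are the real numbers of classical mathematics, which is how they are
-- used below.

infix 4 _∈_

record ℝ : Set₁ where
  field
    below     : ℚ → Set
    inhabited : ∃ below
    bounded   : ∃[ b ] ¬ below b
    lower     : ∀ {p q} → p ℚ.< q → below q → below p
    rounded   : ∀ {p} → below p → ∃[ q ] p ℚ.< q × below q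

_∈_ : ℚ → ℝ → Set
q ∈ x = ℝ.below x q

infix 4 _≤_ _<_ _≈_

_≤_ : ℝ → ℝ → Set
x ≤ y = ∀ q → q ∈ x → q ∈ y

_<_ : ℝ → ℝ → Set
x < y = ∃[ q ] q ∈ y × ¬ q ∈ x

_≈_ : ℝ → ℝ → Set
x ≈ y = x ≤ y × y ≤ x

sup : (P : ℚ → Set) → ∃ P → ∃[ b ] (∀ {p} → P p → p ℚ.≤ b) → ℝ
sup P (p₀ , Pp₀) (b , P≤b) = record
  { below     = λ q → ∃[ p ] P p × q ℚ.< p
  ; inhabited = p₀ ℚ.- 1ℚ , p₀ , Pp₀ ,
                subst (p₀ ℚ.- 1ℚ ℚ.<_) (ℚ.+-identityʳ p₀)
                  (ℚ.+-monoʳ-< p₀ (ℚ.negative⁻¹ (ℚ.- 1ℚ)))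
  ; bounded   = b , λ (p , Pp , b<p) → ℚ.<-irrefl refl (ℚ.<-≤-trans b<p (P≤b Pp))
  ; lower     = λ p<q (r , Pr , q<r) → r , Pr , ℚ.<-trans p<q q<r
  ; rounded   = λ (r , Pr , p<r) →
                let (q , p<q , q<r) = ℚ.<-dense p<r in q , p<q , r , Pr , q<r
  }

∈-≤ : ∀ x {p b} → p ∈ x → ¬ b ∈ x → p ℚ.≤ b
∈-≤ x {p} {b} p∈x b∉x with b ℚ.<? p
... | yes b<p = contradiction (ℝ.lower x b<p p∈x) b∉x
... | no  b≮p = ℚ.≮⇒≥ b≮p

frac-≤ : ∀ a b c d → a ℕ.* suc d ℕ.≤ c ℕ.* suc b → + a / suc b ℚ.≤ + c / suc d
frac-≤ a b c d h = ℚ.toℚᵘ-cancel-≤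
  (ℚᵘ.≤-respˡ-≃ (ℚᵘ.≃-sym (ℚ.toℚᵘ-fromℚᵘ (mkℚᵘ (+ a) b)))
  (ℚᵘ.≤-respʳ-≃ (ℚᵘ.≃-sym (ℚ.toℚᵘ-fromℚᵘ (mkℚᵘ (+ c) d)))
  (*≤* (subst₂ ℤ._≤_ (ℤ.pos-* a (suc d)) (ℤ.pos-* c (suc b)) (ℤ.+≤+ h)))))

frac-≤⁻¹ : ∀ a b c d → + a / suc b ℚ.≤ + c / suc d → a ℕ.* suc d ℕ.≤ c ℕ.* suc b
frac-≤⁻¹ a b c d h
  with ℚᵘ.≤-respˡ-≃ (ℚ.toℚᵘ-fromℚᵘ (mkℚᵘ (+ a) b))
       (ℚᵘ.≤-respʳ-≃ (ℚ.toℚᵘ-fromℚᵘ (mkℚᵘ (+ c) d)) (ℚ.toℚᵘ-mono-≤ h))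
... | *≤* h′ = ℤ.drop‿+≤+
  (subst₂ ℤ._≤_ (sym (ℤ.pos-* a (suc d))) (sym (ℤ.pos-* c (suc b))) h′)

ceil : ℚ → ℕ
ceil q = ℤ.∣ ℚ.↥ q ∣

≤-ceil : ∀ q → q ℚ.≤ + ceil q / 1
≤-ceil q@(mkℚ n d _) = ℚ.toℚᵘ-cancel-≤
  (ℚᵘ.≤-respʳ-≃ (ℚᵘ.≃-sym (ℚ.toℚᵘ-fromℚᵘ (mkℚᵘ (+ ceil q) 0))) (*≤* (aux n)))
  where
  aux : ∀ n → n ℤ.* + 1 ℤ.≤ + ℤ.∣ n ∣ ℤ.* + suc d
  aux (+ a)    = subst₂ ℤ._≤_ (ℤ.pos-* a 1) (ℤ.pos-* a (suc d))
                   (ℤ.+≤+ (ℕ.*-monoʳ-≤ a (ℕ.s≤s ℕ.z≤n)))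
  aux -[1+ a ] = ℤ.-≤+

n≤2^n : ∀ n → n ℕ.≤ 2 ^ n
n≤2^n zero    = ℕ.z≤n
n≤2^n (suc n) = ℕ.≤-trans (ℕ.s≤s (n≤2^n n))
  (ℕ.+-mono-≤ (ℕ.m^n>0 2 n) (ℕ.m≤m+n (2 ^ n) 0))

^-cancel-≤ : ∀ a b n → a ^ suc n ℕ.≤ b ^ suc n → a ℕ.≤ b
^-cancel-≤ a b n h with a ℕ.≤? b
... | yes a≤b = a≤b
... | no  a≰b = contradiction (ℕ.^-monoˡ-< (suc n) (ℕ.≰⇒> a≰b)) (ℕ.≤⇒≯ h)

2^-cancel-≤ : ∀ a b → 2 ^ a ℕ.≤ 2 ^ b → a ℕ.≤ b
2^-cancel-≤ a b h with a ℕ.≤? b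
... | yes a≤b = a≤b
... | no  a≰b =
  contradiction (ℕ.^-monoʳ-< 2 (ℕ.s≤s (ℕ.s≤s ℕ.z≤n)) (ℕ.≰⇒> a≰b)) (ℕ.≤⇒≯ h)

^-distribʳ-* : ∀ n a b → (a ℕ.* b) ^ n ≡ a ^ n ℕ.* b ^ n
^-distribʳ-* zero    a b = refl
^-distribʳ-* (suc n) a b rewrite ^-distribʳ-* n a b =
  ℕ.[m*n]*[o*p]≡[m*o]*[n*p] a b (a ^ n) (b ^ n)

fromℚ : ℚ → ℝ
fromℚ q = sup (_≡ q) (q , refl) (q , λ { refl → ℚ.≤-refl })

fromℕ : ℕ → ℝ
fromℕ n = fromℚ (+ n / 1)

0ℝ 1ℝ : ℝ
0ℝ = fromℕ 0
1ℝ = fromℕ 1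

infixl 6 _+_ _-_
infixl 7 _*_

_+_ : ℝ → ℝ → ℝ
x + y = sup (λ p → ∃[ r ] ∃[ s ] r ∈ x × s ∈ y × p ≡ r ℚ.+ s)
  (let (r , r∈x) = ℝ.inhabited x ; (s , s∈y) = ℝ.inhabited y in
    r ℚ.+ s , r , s , r∈x , s∈y , refl)
  (let (a , a∉x) = ℝ.bounded x ; (b , b∉y) = ℝ.bounded y in
    a ℚ.+ b , λ { (r , s , r∈x , s∈y , refl) → ℚ.+-mono-≤ (∈-≤ x r∈x a∉x) (∈-≤ y s∈y b∉y) })

_-_ : ℝ → ℝ → ℝ
x - y = sup (λ p → ∃[ r ] ∃[ s ] r ∈ x × ¬ s ∈ y × p ≡ r ℚ.- s)
  (let (r , r∈x) = ℝ.inhabited x ; (s , s∉y) = ℝ.bounded y in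
    r ℚ.- s , r , s , r∈x , s∉y , refl)
  (let (a , a∉x) = ℝ.bounded x ; (b , b∈y) = ℝ.inhabited y in
    a ℚ.- b , λ { (r , s , r∈x , s∉y , refl) →
      ℚ.+-mono-≤ (∈-≤ x r∈x a∉x) (ℚ.neg-antimono-≤ (∈-≤ y b∈y s∉y)) })

-- The product of nonnegative reals; negative arguments are read as 0.
_*_ : ℝ → ℝ → ℝ
x * y = sup (λ p → ∃[ r ] ∃[ s ] r ∈ x × s ∈ y × p ≡ (0ℚ ℚ.⊔ r) ℚ.* (0ℚ ℚ.⊔ s))
  (let (r , r∈x) = ℝ.inhabited x ; (s , s∈y) = ℝ.inhabited y in
    (0ℚ ℚ.⊔ r) ℚ.* (0ℚ ℚ.⊔ s) , r , s , r∈x , s∈y , refl)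
  (let (a , a∉x) = ℝ.bounded x ; (b , b∉y) = ℝ.bounded y in
    (0ℚ ℚ.⊔ a) ℚ.* (0ℚ ℚ.⊔ b) , λ { (r , s , r∈x , s∈y , refl) →
      *-mono (ℚ.p≤p⊔q 0ℚ r) (ℚ.⊔-monoʳ-≤ 0ℚ (∈-≤ x r∈x a∉x))
             (ℚ.p≤p⊔q 0ℚ b) (ℚ.⊔-monoʳ-≤ 0ℚ (∈-≤ y s∈y b∉y)) })
  where
  *-mono : ∀ {p q r s} → 0ℚ ℚ.≤ p → p ℚ.≤ q → 0ℚ ℚ.≤ s → r ℚ.≤ s → p ℚ.* r ℚ.≤ q ℚ.* s
  *-mono {p} {q} {r} {s} 0≤p p≤q 0≤s r≤s = ℚ.≤-trans
    (ℚ.*-monoˡ-≤-nonNeg p {{ℚ.nonNegative 0≤p}} r≤s)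
    (ℚ.*-monoʳ-≤-nonNeg s {{ℚ.nonNegative 0≤s}} p≤q)

sumℝ productℝ : List ℝ → ℝ
sumℝ     = List.foldr _+_ 0ℝ
productℝ = List.foldr _*_ 1ℝ

-- `root` says that 2^(m/n) ≤ c/d for some rational c/d below x, where
-- n and d are the successors of the indices.
data Log₂Approx (x : ℝ) : ℚ → Set where
  zero : Log₂Approx x 0ℚ
  root : ∀ m n c d → (+ c / suc d) ∈ x → 2 ^ m ℕ.* suc d ^ suc n ℕ.≤ c ^ suc n →
         Log₂Approx x (+ m / suc n)

-- The base-2 logarithm of x when x ≥ 1, and 0 otherwise.
log₂ : ℝ → ℝ
log₂ x = sup (Log₂Approx x) (0ℚ , zero) (+ N / 1 , bound)
  where
  N : ℕ
  N = ceil (proj₁ (ℝ.bounded x))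

  bound : ∀ {p} → Log₂Approx x p → p ℚ.≤ + N / 1
  bound zero = frac-≤ 0 0 N 0 ℕ.z≤n
  bound (root m n c d c/d∈x h) =
    frac-≤ m n N 0 (subst (ℕ._≤ N ℕ.* suc n) (sym (ℕ.*-identityʳ m))
      (2^-cancel-≤ m (N ℕ.* suc n)
        (ℕ.*-cancelʳ-≤ (2 ^ m) (2 ^ (N ℕ.* suc n)) (suc d ^ suc n)
          {{ℕ.m^n≢0 (suc d) (suc n)}} chain)))
    where
    open ℕ.≤-Reasoning
    c≤ : c ℕ.≤ N ℕ.* suc d
    c≤ = subst (ℕ._≤ N ℕ.* suc d) (ℕ.*-identityʳ c)
      (frac-≤⁻¹ c d N 0
        (ℚ.≤-trans (∈-≤ x c/d∈x (proj₂ (ℝ.bounded x))) (≤-ceil _)))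
    chain : 2 ^ m ℕ.* suc d ^ suc n ℕ.≤ 2 ^ (N ℕ.* suc n) ℕ.* suc d ^ suc n
    chain = begin
      2 ^ m ℕ.* suc d ^ suc n               ≤⟨ h ⟩
      c ^ suc n                             ≤⟨ ℕ.^-monoˡ-≤ (suc n) c≤ ⟩
      (N ℕ.* suc d) ^ suc n                 ≤⟨ ℕ.^-monoˡ-≤ (suc n) (ℕ.*-monoˡ-≤ (suc d) (n≤2^n N)) ⟩
      (2 ^ N ℕ.* suc d) ^ suc n             ≡⟨ ^-distribʳ-* (suc n) (2 ^ N) (suc d) ⟩
      (2 ^ N) ^ suc n ℕ.* suc d ^ suc n     ≡⟨ cong (ℕ._* suc d ^ suc n)
                                                    (ℕ.^-*-assoc 2 N (suc n)) ⟩
      2 ^ (N ℕ.* suc n) ℕ.* suc d ^ suc n   ∎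

-- `root` says that c/d ≤ k^(-m/n) for some rational m/n ≥ η, where n and d
-- are the successors of the indices.
data InvPowApprox (k : ℕ) (η : ℝ) : ℚ → Set where
  root : ∀ m n c d → ¬ (+ m / suc n) ∈ η → c ^ suc n ℕ.* k ^ m ℕ.≤ suc d ^ suc n →
         InvPowApprox k η (+ c / suc d)

-- The real number 1 / k^η, for η ≥ 0.
1/_^_ : (k : ℕ) .{{_ : NonZero k}} → ℝ → ℝ
1/_^_ k η = sup (InvPowApprox k η)
  (_ , root N 0 0 0 N∉η ℕ.z≤n)
  (+ 1 / 1 , λ { (root m n c d _ h) → frac-≤ c d 1 0 (subst₂ ℕ._≤_ (sym (ℕ.*-identityʳ c))
    (sym (ℕ.*-identityˡ (suc d)))
    (^-cancel-≤ c (suc d) n (ℕ.≤-trans (ℕ.m≤m*n (c ^ suc n) (k ^ m) {{ℕ.m^n≢0 k m}}) h))) })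
  where
  b : ℚ
  b = proj₁ (ℝ.bounded η)
  N : ℕ
  N = ceil b
  N∉η : ¬ (+ N / 1) ∈ η
  N∉η N∈η = let (q , N<q , q∈η) = ℝ.rounded η N∈η in
    proj₂ (ℝ.bounded η) (ℝ.lower η (ℚ.≤-<-trans (≤-ceil b) N<q) q∈η)

-- f(k) = o(g(k)/h(k)) as k → ∞, with the denominator cleared; meant for
-- functions g and h that are positive for all large k.
_≪_/_ : (f : ℕ → ℕ) (g h : ℕ → ℝ) → Set₁
f ≪ g / h = (ε : ℝ) → 0ℝ < ε →
  ∃[ K ] (∀ k → K ℕ.≤ k → fromℕ (f k) * h k ≤ ε * g k)

------------------------------------------------------------------------
-- Execution of the stations on given sets of local rounds

-- Only positive rounds matter.
RoundSet : Set
RoundSet = ℕ → Bool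

-- wake i is the (global) activation time of station i.
Instance : ℕ → Set
Instance k = Fin k → ℕ

-- Station i draws the set X i; its local round r is the global round wake i + r.
module Execution {k : ℕ} (wake : Instance k) (X : Fin k → RoundSet) where

  -- Off t i: station i has transmitted successfully before global round t.
  Off       : ℕ → Fin k → Set
  Transmits : ℕ → Fin k → Set
  Succeeds  : ℕ → Fin k → Set

  Off zero    i = ⊥
  Off (suc t) i = Off t i ⊎ Succeeds t i

  Transmits t i = ¬ Off t i × wake i ℕ.< t × X i (t ℕ.∸ wake i) ≡ true

  Succeeds t i = Transmits t i × (∀ j → Transmits t j → j ≡ i)

  SucceedsWithin : ℕ → Fin k → Set
  SucceedsWithin d i = ∃[ r ] Succeeds (wake i ℕ.+ suc (toℕ {d} r)) i

  AllSucceedWithin : ℕ → Set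
  AllSucceedWithin d = ∀ i → SucceedsWithin d i

  off?       : ∀ t i → Dec (Off t i)
  transmits? : ∀ t i → Dec (Transmits t i)
  succeeds?  : ∀ t i → Dec (Succeeds t i)

  off? zero    i = no λ ()
  off? (suc t) i = off? t i ⊎-dec succeeds? t i

  transmits? t i =
    ¬? (off? t i) ×-dec (wake i ℕ.<? t) ×-dec (X i (t ℕ.∸ wake i) Bool.≟ true)

  succeeds? t i =
    transmits? t i ×-dec Fin.all? (λ j → transmits? t j →-dec (j Fin.≟ i))

  allSucceedWithin? : ∀ d → Dec (AllSucceedWithin d)
  allSucceedWithin? d = Fin.all? λ i → Fin.any? λ r → succeeds? _ i

------------------------------------------------------------------------
-- Random sets of local rounds

-- A Borel probability measure on the sets of positive integers, given by its
-- values on cylinders: mass w is the probability that, for every r from 1 to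
-- the length of w, round r is in the set exactly when the r-th entry of w is
-- true.  Such values extend uniquely to a probability measure.
record Distribution : Set₁ where
  field
    mass     : ∀ {T} → Vec Bool T → ℝ
    nonneg   : ∀ {T} (w : Vec Bool T) → 0ℝ ≤ mass w
    total    : mass [] ≈ 1ℝ
    additive : ∀ {T} (w : Vec Bool T) → mass w ≈ mass (w ∷ʳ false) + mass (w ∷ʳ true)

-- The code of a non-adaptive algorithm that does not know k.
Algorithm : Set₁
Algorithm = Distribution

vectors : {A : Set} → List A → ∀ n → List (Vec A n)
vectors xs zero    = [] ∷ []
vectors xs (suc n) = List.cartesianProductWith _∷_ xs (vectors xs n)

profiles : ∀ k T → List (Vec (Vec Bool T) k)
profiles k T = vectors (vectors (false ∷ true ∷ []) T) k

-- The subset of {1,…,T} encoded by w.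
roundSet : ∀ {T} → Vec Bool T → RoundSet
roundSet []      r             = false
roundSet (b ∷ w) zero          = false
roundSet (b ∷ w) (suc zero)    = b
roundSet (b ∷ w) (suc (suc r)) = roundSet w (suc r)

-- The probability of an event about k independent sets drawn from 𝒜, provided
-- the event depends only on the elements of these sets in {1,…,T}.
Pr : Algorithm → ∀ k T {E : (Fin k → RoundSet) → Set} → (∀ X → Dec (E X)) → ℝ
Pr 𝒜 k T E? = sumℝ (List.map weight (List.filter (λ ws → E? (sets ws)) (profiles k T)))
  where
  sets : Vec (Vec Bool T) k → Fin k → RoundSet
  sets ws i = roundSet (lookup ws i)

  weight : Vec (Vec Bool T) k → ℝ
  weight ws = productℝ (List.map (Distribution.mass 𝒜) (Vec.toList ws))

-- No global round after max wake + d matters for success within d rounds, and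
-- local rounds never exceed global ones.
horizon : ∀ {k} → Instance k → ℕ → ℕ
horizon wake d = Vector.foldr ℕ._⊔_ 0 wake ℕ.+ d

PrAllSucceedWithin : Algorithm → ∀ {k} → Instance k → ℕ → ℝ
PrAllSucceedWithin 𝒜 {k} wake d =
  Pr 𝒜 k (horizon wake d) (λ X → Execution.allSucceedWithin? wake X d)

AchievesLatencyWHP : Algorithm → (f : ℕ → ℕ) (η : ℝ) → Set
AchievesLatencyWHP 𝒜 f η =
  ∀ k .{{_ : NonZero k}} (wake : Instance k) →
  1ℝ - (1/ k ^ η) ≤ PrAllSucceedWithin 𝒜 wake (f k)

{-# OPTIONS --safe #-}
module Submission where

-- A fresh station can jam any round with constant probability: aimed with its
-- first transmission, it cannot have switched off before.  Suppose the
-- latency f is o(k log k / (log log k)²).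
--
-- With k stations one can jam, almost surely, all rounds up to k / polylog k
-- together with any j residue classes modulo some Q = polylog k.  A station
-- with at most j transmissions between k / polylog k and f(k) fails for one of
-- the Q^j choices of classes, so high probability forces most stations to
-- transmit more than j ≈ log k / log log k times in that window.  Applied to
-- about log K / log log K disjoint windows below K, this gives an expected
-- number of transmissions S of order (log K / log log K)² by time K / polylog K.
--
-- Finally K stations are woken up at well spread times before f(K), while the
-- early rounds are jammed.  As long as nobody has succeeded, the expected number
-- of transmitters in each later round is about K S / f(K), a large multiple of
-- log K.  So with probability at least 1/2 every round before f(K) has at least
-- two transmitters, and nobody in the crowd ever succeeds.
--
-- The probabilities involved are turned into integer weights by approximating
-- the measure from above on the finitely many words of length H; a station that wakes up
-- very late makes H the horizon of every instance considered.

-- Switching off couples the stations, so actual transmissions are not independent. All estimates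
-- are therefore made for the drawn sets: `Sends` and `First` ignore the history of the execution,
-- and `Blocking` shows by induction on rounds that drawn transmissions of the target and of the
-- crowd really take place as long as each is accompanied by another real one. What has to be likely
-- is then a conjunction of guards, each asking that some station of one kind draws one given round,
-- and a union bound over independent draws suffices. The two factors log K / log log K arise
-- differently. A window must span a polylogarithmic factor, since jamming takes that many times
-- more stations than rounds and f(k) may exceed k by about log k; so about log K / log log K
-- windows fit below K. Within a window the failure probability k^(-η) leaves about η log k bits,
-- and naming one of the Q classes costs about log log K of them. To keep log k of order log K, only
-- the upper half of the scales is used.

module Sums where

  open import Data.Bool.Base using (Bool; true; false; not)
  open import Data.List.Base using (List; []; _∷_; _++_; map; length; replicate; upTo; applyUpTo)
  open import Data.List.Membership.Propositional using (_∈_)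
  open import Data.List.Relation.Unary.Any using (here; there)
  open import Data.Nat.Base
  open import Data.Nat.Properties
  open import Data.Nat.Tactic.RingSolver using (solve-∀)
  open import Data.Product.Base using (∃-syntax; _×_; _,_)
  open import Data.Vec.Base as Vec using (Vec; []; _∷_)
  open import Function.Base using (_∘_)
  open import Relation.Binary.PropositionalEquality hiding ([_]; J)
  open import Relation.Nullary using (yes; no)
  open import Defs using (vectors; ^-distribʳ-*)

  private variable
    A B : Set

  [_] : Bool → ℕ
  [ true  ] = 1
  [ false ] = 0

  []-compl : ∀ b → [ b ] + [ not b ] ≡ 1
  []-compl true  = refl
  []-compl false = refl

  -- Finite sums and products of natural numbers.

  ∑ ∏ : List A → (A → ℕ) → ℕ
  ∑ []       f = 0
  ∑ (x ∷ xs) f = f x + ∑ xs f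
  ∏ []       f = 1
  ∏ (x ∷ xs) f = f x * ∏ xs f

  ∑-cong : ∀ (xs : List A) {f g} → (∀ x → f x ≡ g x) → ∑ xs f ≡ ∑ xs g
  ∑-cong []       f≗g = refl
  ∑-cong (x ∷ xs) f≗g = cong₂ _+_ (f≗g x) (∑-cong xs f≗g)

  ∑-mono : ∀ (xs : List A) {f g} → (∀ x → f x ≤ g x) → ∑ xs f ≤ ∑ xs g
  ∑-mono []       f≤g = z≤n
  ∑-mono (x ∷ xs) f≤g = +-mono-≤ (f≤g x) (∑-mono xs f≤g)

  ∑-mono-∈ : ∀ (xs : List A) {f g} → (∀ {x} → x ∈ xs → f x ≤ g x) → ∑ xs f ≤ ∑ xs g
  ∑-mono-∈ []       f≤g = z≤n
  ∑-mono-∈ (x ∷ xs) f≤g = +-mono-≤ (f≤g (here refl)) (∑-mono-∈ xs (λ x∈ → f≤g (there x∈)))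

  ∑-zero : ∀ (xs : List A) → ∑ xs (λ _ → 0) ≡ 0
  ∑-zero []       = refl
  ∑-zero (x ∷ xs) = ∑-zero xs

  ∑-const : ∀ (xs : List A) c → ∑ xs (λ _ → c) ≡ length xs * c
  ∑-const []       c = refl
  ∑-const (x ∷ xs) c = cong (c +_) (∑-const xs c)

  ∑-distrib-+ : ∀ (xs : List A) f g → ∑ xs (λ x → f x + g x) ≡ ∑ xs f + ∑ xs g
  ∑-distrib-+ []       f g = refl
  ∑-distrib-+ (x ∷ xs) f g rewrite ∑-distrib-+ xs f g = lemma (f x) (g x) (∑ xs f) (∑ xs g)
    where
    lemma : ∀ a b c d → a + b + (c + d) ≡ a + c + (b + d)
    lemma = solve-∀

  ∑-*ˡ : ∀ (xs : List A) c f → ∑ xs (λ x → c * f x) ≡ c * ∑ xs f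
  ∑-*ˡ []       c f = sym (*-zeroʳ c)
  ∑-*ˡ (x ∷ xs) c f rewrite ∑-*ˡ xs c f = sym (*-distribˡ-+ c (f x) (∑ xs f))

  ∑-*ʳ : ∀ (xs : List A) c f → ∑ xs (λ x → f x * c) ≡ ∑ xs f * c
  ∑-*ʳ xs c f = trans (∑-cong xs (λ x → *-comm (f x) c)) (trans (∑-*ˡ xs c f) (*-comm c (∑ xs f)))

  ∑-swap : ∀ (xs : List A) (ys : List B) (f : A → B → ℕ) →
           ∑ xs (λ x → ∑ ys (λ y → f x y)) ≡ ∑ ys (λ y → ∑ xs (λ x → f x y))
  ∑-swap []       ys f = sym (∑-zero ys)
  ∑-swap (x ∷ xs) ys f =
    trans (cong (∑ ys (f x) +_) (∑-swap xs ys f)) (sym (∑-distrib-+ ys (f x) (λ y → ∑ xs (λ x′ → f x′ y))))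

  ∑-++ : ∀ (xs ys : List A) f → ∑ (xs ++ ys) f ≡ ∑ xs f + ∑ ys f
  ∑-++ []       ys f = refl
  ∑-++ (x ∷ xs) ys f rewrite ∑-++ xs ys f = sym (+-assoc (f x) (∑ xs f) (∑ ys f))

  ∑-map : ∀ (h : A → B) xs f → ∑ (map h xs) f ≡ ∑ xs (f ∘ h)
  ∑-map h []       f = refl
  ∑-map h (x ∷ xs) f = cong (f (h x) +_) (∑-map h xs f)

  ∑-vectors : ∀ (xs : List A) n f →
              ∑ (vectors xs (suc n)) f ≡ ∑ xs (λ x → ∑ (vectors xs n) (λ v → f (x ∷ v)))
  ∑-vectors xs n f = go xs
    where
    go : ∀ ys → ∑ (Data.List.Base.cartesianProductWith _∷_ ys (vectors xs n)) f
              ≡ ∑ ys (λ x → ∑ (vectors xs n) (λ v → f (x ∷ v)))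
    go []       = refl
    go (y ∷ ys) = trans (∑-++ (map (y ∷_) (vectors xs n)) _ f)
                        (cong₂ _+_ (∑-map (y ∷_) (vectors xs n) f) (go ys))

  ∑-vectors-const : ∀ (xs : List A) n c → ∑ (vectors xs n) (λ _ → c) ≡ length xs ^ n * c
  ∑-vectors-const xs zero    c = refl
  ∑-vectors-const xs (suc n) c = trans (∑-vectors xs n (λ _ → c))
    (trans (∑-cong xs (λ _ → ∑-vectors-const xs n c))
    (trans (∑-const xs _) (sym (*-assoc (length xs) (length xs ^ n) c))))

  ∈⇒≤∑ : ∀ {x : A} {xs} f → x ∈ xs → f x ≤ ∑ xs f
  ∈⇒≤∑ {xs = _ ∷ xs} f (here refl) = m≤m+n _ (∑ xs f)
  ∈⇒≤∑ {xs = y ∷ xs} f (there x∈) = ≤-trans (∈⇒≤∑ f x∈) (m≤n+m (∑ xs f) (f y))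

  ∏-mono : ∀ (xs : List A) {f g} → (∀ x → f x ≤ g x) → ∏ xs f ≤ ∏ xs g
  ∏-mono []       f≤g = ≤-refl
  ∏-mono (x ∷ xs) f≤g = *-mono-≤ (f≤g x) (∏-mono xs f≤g)

  ∏-++ : ∀ (xs ys : List A) f → ∏ (xs ++ ys) f ≡ ∏ xs f * ∏ ys f
  ∏-++ []       ys f = sym (+-identityʳ _)
  ∏-++ (x ∷ xs) ys f rewrite ∏-++ xs ys f = sym (*-assoc (f x) (∏ xs f) (∏ ys f))

  ∏-const : ∀ (xs : List A) c → ∏ xs (λ _ → c) ≡ c ^ length xs
  ∏-const []       c = refl
  ∏-const (x ∷ xs) c = cong (c *_) (∏-const xs c)

  ∏-map : ∀ (h : A → B) xs f → ∏ (map h xs) f ≡ ∏ xs (f ∘ h)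
  ∏-map h []       f = refl
  ∏-map h (x ∷ xs) f = cong (f (h x) *_) (∏-map h xs f)

  ∏-replicate : ∀ n (x : A) f → ∏ (replicate n x) f ≡ f x ^ n
  ∏-replicate zero    x f = refl
  ∏-replicate (suc n) x f = cong (f x *_) (∏-replicate n x f)

  -- The sum of f over lo < r ≤ lo + n.
  window : (lo n : ℕ) → (ℕ → ℕ) → ℕ
  window lo zero    f = 0
  window lo (suc n) f = window lo n f + f (lo + suc n)

  window-cong : ∀ lo n {f g} → (∀ r → f r ≡ g r) → window lo n f ≡ window lo n g
  window-cong lo zero    f≗g = refl
  window-cong lo (suc n) f≗g = cong₂ _+_ (window-cong lo n f≗g) (f≗g (lo + suc n))

  window-*ˡ : ∀ lo n c f → window lo n (λ r → c * f r) ≡ c * window lo n f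
  window-*ˡ lo zero    c f = sym (*-zeroʳ c)
  window-*ˡ lo (suc n) c f = trans (cong (_+ c * f (lo + suc n)) (window-*ˡ lo n c f))
    (sym (*-distribˡ-+ c (window lo n f) (f (lo + suc n))))

  window-split : ∀ a b f → window 0 (a + b) f ≡ window 0 a f + window a b f
  window-split a zero    f rewrite +-identityʳ a = sym (+-identityʳ _)
  window-split a (suc b) f rewrite +-suc a b | window-split a b f =
    +-assoc (window 0 a f) (window a b f) _

  window-mono : ∀ f {a b} → a ≤ b → window 0 a f ≤ window 0 b f
  window-mono f {a} a≤b with m≤n⇒∃[o]m+o≡n a≤b
  ... | (c , refl) rewrite window-split a c f = m≤m+n _ _

  window-∑ : ∀ lo n (xs : List A) (f : A → ℕ → ℕ) →
             window lo n (λ r → ∑ xs (λ x → f x r)) ≡ ∑ xs (λ x → window lo n (f x))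
  window-∑ lo zero    xs f = sym (∑-zero xs)
  window-∑ lo (suc n) xs f =
    trans (cong (_+ ∑ xs (λ x → f x (lo + suc n))) (window-∑ lo n xs f))
          (sym (∑-distrib-+ xs (λ x → window lo n (f x)) (λ x → f x (lo + suc n))))

  ∑-applyUpTo : ∀ (h : ℕ → ℕ) n f → ∑ (applyUpTo h n) f ≡ ∑ (upTo n) (f ∘ h)
  ∑-applyUpTo h zero    f = refl
  ∑-applyUpTo h (suc n) f = cong (f (h 0) +_)
    (trans (∑-applyUpTo (h ∘ suc) n f) (sym (∑-applyUpTo suc n (f ∘ h))))

  ∑-upTo-suc : ∀ n f → ∑ (upTo (suc n)) f ≡ f 0 + ∑ (upTo n) (f ∘ suc)
  ∑-upTo-suc n f = cong (f 0 +_) (∑-applyUpTo suc n f)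

  ∃-below-average : ∀ (x : A) xs f → ∃[ y ] y ∈ x ∷ xs × f y * length (x ∷ xs) ≤ ∑ (x ∷ xs) f
  ∃-below-average x [] f = x , here refl , ≤-reflexive (lemma (f x))
    where
    lemma : ∀ a → a * 1 ≡ a + 0
    lemma = solve-∀
  ∃-below-average x (x′ ∷ xs) f with ∃-below-average x′ xs f
  ... | y , y∈ , h with f x ≤? f y
  ...   | yes fx≤fy = x , here refl ,
          ≤-trans (≤-reflexive (*-suc (f x) _)) (+-monoʳ-≤ (f x) (≤-trans (*-monoˡ-≤ _ fx≤fy) h))
  ...   | no  fx≰fy = y , there y∈ ,
          ≤-trans (≤-reflexive (*-suc (f y) _)) (+-mono-≤ (<⇒≤ (≰⇒> fx≰fy)) h)

  window-max : ∀ n f → ∃[ r ] r ≤ n × window 0 (suc n) f ≤ f (suc r) * suc n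
  window-max zero f = 0 , z≤n , ≤-reflexive (sym (*-identityʳ (f 1)))
  window-max (suc n) f with window-max n f
  ... | r , r≤n , h with f (suc r) ≤? f (suc (suc n))
  ...   | yes le = suc n , ≤-refl ,
          ≤-trans (+-monoˡ-≤ _ (≤-trans h (*-monoˡ-≤ (suc n) le)))
                  (≤-reflexive (lemma (f (suc (suc n))) (suc n)))
    where
    lemma : ∀ a b → a * b + a ≡ a * suc b
    lemma = solve-∀
  ...   | no ¬le = r , m≤n⇒m≤1+n r≤n ,
          ≤-trans (+-mono-≤ h (<⇒≤ (≰⇒> ¬le))) (≤-reflexive (lemma (f (suc r)) (suc n)))
    where
    lemma : ∀ a b → a * b + a ≡ a * suc b
    lemma = solve-∀

  -- Bernoulli's inequality for `1 + b / c`, multiplied out so that `c` may be zero.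
  bernoulli : ∀ c b q → c ^ suc q + suc q * (b * c ^ q) ≤ (c + b) ^ suc q
  bernoulli c b zero = ≤-reflexive (lemma c b)
    where
    lemma : ∀ c b → c * 1 + (b * 1 + 0) ≡ (c + b) * 1
    lemma = solve-∀
  bernoulli c b (suc q) = begin
    c ^ suc (suc q) + suc (suc q) * (b * c ^ suc q)
      -- The added quadratic term completes the product with `c + b`.
      ≤⟨ m≤m+n _ (suc q * (b * (b * c ^ q))) ⟩
    c ^ suc (suc q) + suc (suc q) * (b * c ^ suc q) + suc q * (b * (b * c ^ q))
      ≡⟨ lemma c b (suc q) (c ^ q) ⟩
    (c + b) * (c ^ suc q + suc q * (b * c ^ q))
      ≤⟨ *-monoʳ-≤ (c + b) (bernoulli c b q) ⟩
    (c + b) ^ suc (suc q) ∎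
    where
    open ≤-Reasoning
    lemma : ∀ c b q x → c * (c * x) + (1 + q) * (b * (c * x)) + q * (b * (b * x))
                      ≡ (c + b) * (c * x + q * (b * x))
    lemma = solve-∀

  -- (a - b)^q ≤ a^q / 2, where a is written as c + b to avoid subtraction.
  halving : ∀ c b q .{{_ : NonZero q}} → c + b ≤ q * b → c ^ q * 2 ≤ (c + b) ^ q
  halving c b (suc q) h = ≤-trans (≤-trans (≤-reflexive (lemma₁ (c ^ suc q))) (+-monoʳ-≤ (c ^ suc q) step)) (bernoulli c b q)
    where
    open ≤-Reasoning
    lemma₁ : ∀ x → x * 2 ≡ x + x
    lemma₁ = solve-∀
    lemma₂ : ∀ q b x → q * b * x ≡ q * (b * x)
    lemma₂ = solve-∀
    step : c ^ suc q ≤ suc q * (b * c ^ q)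
    step = begin
      c * c ^ q               ≤⟨ *-monoˡ-≤ (c ^ q) (≤-trans (m≤m+n c b) h) ⟩
      suc q * b * c ^ q       ≡⟨ lemma₂ (suc q) b (c ^ q) ⟩
      suc q * (b * c ^ q)     ∎

  -- If a trial succeeds with probability `b / (c + b)`, at least `1 / q`, then `q * l` independent
  -- trials all fail with probability at most `2 ^ (-l)`. It serves both the jammers and the crowd.
  power-decay : ∀ c b q l .{{_ : NonZero q}} → c + b ≤ q * b →
                c ^ (q * l) * 2 ^ l ≤ (c + b) ^ (q * l)
  power-decay c b q l h = begin
    c ^ (q * l) * 2 ^ l   ≡⟨ cong (_* 2 ^ l) (sym (^-*-assoc c q l)) ⟩
    (c ^ q) ^ l * 2 ^ l   ≡⟨ sym (^-distribʳ-* l (c ^ q) 2) ⟩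
    (c ^ q * 2) ^ l       ≤⟨ ^-monoˡ-≤ l (halving c b q h) ⟩
    ((c + b) ^ q) ^ l     ≡⟨ ^-*-assoc (c + b) q l ⟩
    (c + b) ^ (q * l)     ∎
    where open ≤-Reasoning

-- Stations that block each other and never switch off.

module Executions where

  open import Data.Bool.Base using (true)
  open import Data.Fin.Base using (Fin; toℕ)
  open import Data.Fin.Properties using (toℕ<n)
  open import Data.Nat.Base
  open import Data.Nat.Properties
  open import Data.Product.Base using (∃-syntax; _×_; _,_)
  open import Data.Sum.Base using (_⊎_; inj₁; inj₂)
  open import Relation.Binary.PropositionalEquality hiding ([_]; J)
  open import Relation.Nullary using (¬_)
  open import Defs using (RoundSet; Instance; module Execution)

  module Blocking {k : ℕ} (wake : Instance k) (X : Fin k → RoundSet) where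

    open Execution wake X

    -- What Transmits says about a station that is not off.
    Sends : ℕ → Fin k → Set
    Sends g i = wake i < g × X i (g ∸ wake i) ≡ true

    First : ℕ → Fin k → Set
    First g i = Sends g i × (∀ h → h < g → ¬ Sends h i)

    off⇒sends : ∀ g i → Off g i → ∃[ h ] h < g × Sends h i
    off⇒sends (suc g) i (inj₁ off) with off⇒sends g i off
    ... | h , h<g , s = h , m<n⇒m<1+n h<g , s
    off⇒sends (suc g) i (inj₂ ((_ , s) , _)) = g , ≤-refl , s

    first⇒transmits : ∀ g i → First g i → Transmits g i
    first⇒transmits g i ((w , x) , fst) = (λ off → let (h , h<g , s) = off⇒sends g i off in fst h h<g s) , w , x

    module _ (Main : Fin k → Set) (G : ℕ)
             (blocked : ∀ g i → g ≤ G → Main i → Sends g i →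
                        ∃[ j ] j ≢ i × ((Main j × Sends g j) ⊎ First g j)) where

      -- Induction on the round: while no main station is off, what a main station draws it also
      -- transmits. Its partner is real for the same reason, or because it transmits for the first
      -- time, so neither is alone.
      main-never-off : ∀ g i → g ≤ suc G → Main i → ¬ Off g i
      main-never-off (suc g) i g≤ m (inj₁ off) = main-never-off g i (m≤n⇒m≤1+n (≤-pred g≤)) m off
      main-never-off (suc g) i g≤ m (inj₂ ((_ , s) , unique))
        with blocked g i (≤-pred g≤) m s
      ... | j , j≢i , inj₁ (mj , w , x) =
            j≢i (unique j (main-never-off g j (m≤n⇒m≤1+n (≤-pred g≤)) mj , w , x))
      ... | j , j≢i , inj₂ fst = j≢i (unique j (first⇒transmits g j fst))

      main-fails : ∀ d i → Main i → wake i + d ≤ G → ¬ AllSucceedWithin d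
      main-fails d i m h all with all i
      ... | r , s = main-never-off (suc (wake i + suc (toℕ r))) i
                      (s≤s (≤-trans (+-monoʳ-≤ (wake i) (toℕ<n r)) h)) m (inj₂ s)

-- Attacks on a finite probability space of round sets.

module Spaces where

  open import Data.Bool.Base using (Bool; true; false; not; _∧_; _∨_)
  open import Data.Bool.Properties using (T-≡)
  open import Data.Empty using (⊥)
  open import Data.Unit.Base using (⊤; tt)
  open import Data.Fin.Base using (Fin; zero; suc)
  import Data.Fin.Properties as Fin
  open import Data.List.Base as List using (List; []; _∷_; _++_; length; replicate; map; upTo; applyUpTo)
  open import Data.List.Properties using (length-++; length-replicate; length-map; length-upTo; ++-identityʳ)
  open import Data.List.Membership.Propositional using (_∈_)
  open import Data.List.Membership.Propositional.Properties
    using (∈-lookup; ∈-++⁻; ∈-++⁺ʳ; ∈-++⁺ˡ; ∈-map⁺; ∈-map⁻; ∈-upTo⁺; ∈-upTo⁻; ∈-cartesianProductWith⁺; ∈-cartesianProductWith⁻)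
  open import Data.List.Relation.Unary.Any using (here; there; index)
  open import Data.List.Relation.Unary.Any.Properties using (lookup-index)
  open import Data.Nat.Base
  open import Data.Nat.DivMod using (m≡m%n+[m/n]*n; m%n<n; /-monoˡ-≤; m/n*n≤m)
  open import Data.Nat.Properties
  open import Data.Nat.Tactic.RingSolver using (solve-∀)
  open import Data.Product.Base using (∃-syntax; _×_; _,_; proj₁; proj₂)
  open import Data.Sum.Base using (_⊎_; inj₁; inj₂)
  open import Data.Vec.Base as Vec using (Vec; []; _∷_; lookup)
  import Data.Vec.Functional as Vector
  open import Function.Base using (_∘_)
  open import Function.Bundles using (Equivalence)
  open import Relation.Binary.PropositionalEquality hiding ([_]; J)
  open import Relation.Nullary using (does; yes; no; contradiction)
  open import Relation.Nullary.Decidable using (dec-false)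
  open import Defs using (RoundSet; Instance; module Execution; vectors; horizon; ^-distribʳ-*)
  open Sums
  open Executions using (module Blocking)

  ∧-true : ∀ {a b} → a ∧ b ≡ true → a ≡ true × b ≡ true
  ∧-true {true} {true} refl = refl , refl

  ≡ᵇ-true : ∀ {a b} → (a ≡ᵇ b) ≡ true → a ≡ b
  ≡ᵇ-true {a} {b} e = ≡ᵇ⇒≡ a b (Equivalence.from T-≡ e)

  <ᵇ-true : ∀ {a b} → (a <ᵇ b) ≡ true → a < b
  <ᵇ-true {a} {b} e = <ᵇ⇒< a b (Equivalence.from T-≡ e)

  -- A round in which both groups have a transmitter has at least two, and each
  -- of the two groups is silent with a probability that is a product.
  data Label : Set where
    jammer groupA groupB idle : Label

  Station Guard : Set
  Station = Label × ℕ
  Guard   = Label × ℕ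

  Grouped : Label → Set
  Grouped groupA = ⊤
  Grouped groupB = ⊤
  Grouped _      = ⊥

  max-≤ : ∀ {k} (u : Fin k → ℕ) M → (∀ i → u i ≤ M) → Vector.foldr _⊔_ 0 u ≤ M
  max-≤ {zero}  u M h = z≤n
  max-≤ {suc k} u M h = ⊔-lub (h zero) (max-≤ (λ i → u (suc i)) M (λ i → h (suc i)))

  ≤-max : ∀ {k} (u : Fin k → ℕ) i → u i ≤ Vector.foldr _⊔_ 0 u
  ≤-max u zero    = m≤m⊔n _ _
  ≤-max u (suc i) = ≤-trans (≤-max (λ j → u (suc j)) i) (m≤n⊔m (u zero) _)

  ∈-replicate⁻ : ∀ {A : Set} {x y : A} n → x ∈ replicate n y → x ≡ y
  ∈-replicate⁻ (suc n) (here p)   = p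
  ∈-replicate⁻ (suc n) (there x∈) = ∈-replicate⁻ n x∈

  ≡ᵇ-refl : ∀ n → (n ≡ᵇ n) ≡ true
  ≡ᵇ-refl n = Equivalence.to T-≡ (≡⇒≡ᵇ n n refl)

  member : ∀ {j} → ℕ → Vec ℕ j → Bool
  member x []      = false
  member x (y ∷ c) = (x ≡ᵇ y) ∨ member x c

  -- At time `t` a station with wake-up offset `u` is in local round `t ∸ u`, so reversing the sum
  -- passes from local rounds to offsets. Offsets from `t` on only add to the right-hand side.
  window-reverse : ∀ c t n g → t ≤ n → (∀ u → u < t → c (t ∸ u) ≤ g u) → window 0 t c ≤ ∑ (upTo n) g
  window-reverse c zero    n       g t≤n c≤g = z≤n
  window-reverse c (suc t) (suc n) g t≤n c≤g = begin
    window 0 t c + c (suc t)            ≡⟨ +-comm (window 0 t c) (c (suc t)) ⟩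
    c (suc t) + window 0 t c            ≤⟨ +-mono-≤ (c≤g 0 (s≤s z≤n)) (window-reverse c t n (g ∘ suc) (≤-pred t≤n)
                                             (λ u u<t → c≤g (suc u) (s≤s u<t))) ⟩
    g 0 + ∑ (upTo n) (g ∘ suc)          ≡⟨ sym (∑-upTo-suc n g) ⟩
    ∑ (upTo (suc n)) g                  ∎
    where open ≤-Reasoning

  -- Conditional expectations: each new wake-up offset is chosen not to exceed
  -- the average over 0, …, d.
  greedy : ∀ (silent : ℕ → ℕ → ℕ) (L : List ℕ) d X → (∀ {t} → t ∈ L → ∑ (upTo (suc d)) (silent t) ≤ X) → ∀ M →
    ∃[ us ] length us ≡ M × (∀ {u} → u ∈ us → u ≤ d) ×
            ∑ L (λ t → ∏ us (silent t)) * suc d ^ M ≤ length L * X ^ M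
  greedy silent L d X h zero = [] , refl , (λ ()) , ≤-reflexive (cong (λ z → z * 1) {y = length L} (trans (∑-const L 1) (*-identityʳ (length L))))
  greedy silent L d X h (suc M) with greedy silent L d X h M
  ... | us , len , us≤ , bound
    with ∃-below-average 0 (applyUpTo suc d) (λ u → ∑ L (λ t → silent t u * ∏ us (silent t)))
  ...   | u , u∈ , avg = u ∷ us , cong suc len ,
          (λ { (here refl) → ≤-pred (∈-upTo⁻ {suc d} u∈) ; (there v∈) → us≤ v∈ }) , (begin
    Φ′ * (suc d * suc d ^ M)
      ≡⟨ sym (*-assoc Φ′ (suc d) (suc d ^ M)) ⟩
    Φ′ * suc d * suc d ^ M
      ≡⟨ cong (λ x → Φ′ * x * suc d ^ M) (sym (length-upTo (suc d))) ⟩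
    Φ′ * length (upTo (suc d)) * suc d ^ M
      ≤⟨ *-monoˡ-≤ (suc d ^ M) avg ⟩
    ∑ (upTo (suc d)) (λ u → ∑ L (λ t → silent t u * P t)) * suc d ^ M
      ≡⟨ cong (_* suc d ^ M) (∑-swap (upTo (suc d)) L (λ u t → silent t u * P t)) ⟩
    ∑ L (λ t → ∑ (upTo (suc d)) (λ u → silent t u * P t)) * suc d ^ M
      ≤⟨ *-monoˡ-≤ (suc d ^ M) (∑-mono-∈ L (λ {t} t∈ → ≤-trans
           (≤-reflexive (∑-*ʳ (upTo (suc d)) (P t) (silent t))) (*-monoˡ-≤ (P t) (h t∈)))) ⟩
    ∑ L (λ t → X * P t) * suc d ^ M
      ≡⟨ cong (_* suc d ^ M) (∑-*ˡ L X P) ⟩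
    X * ∑ L P * suc d ^ M
      ≡⟨ *-assoc X (∑ L P) (suc d ^ M) ⟩
    X * (∑ L P * suc d ^ M)
      ≤⟨ *-monoʳ-≤ X bound ⟩
    X * (length L * X ^ M)
      ≡⟨ lemma X (length L) (X ^ M) ⟩
    length L * (X * X ^ M) ∎)
    where
    open ≤-Reasoning
    P : ℕ → ℕ
    P t = ∏ us (silent t)
    Φ′ : ℕ
    Φ′ = ∑ L (λ t → silent t u * P t)
    lemma : ∀ a b c → a * (b * c) ≡ b * (a * c)
    lemma = solve-∀

  -- A finite probability space of round sets: an element w of ws has
  -- probability V w / N.
  module Space {A : Set} (Ws : List A) (V : A → ℕ) (bit : A → RoundSet) where

    N : ℕ
    N = ∑ Ws V

    ∣_∣ : (A → Bool) → ℕ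
    ∣ P ∣ = ∑ Ws (λ w → V w * [ P w ])

    ∣∣+∣not∣ : ∀ P → ∣ P ∣ + ∣ (λ w → not (P w)) ∣ ≡ N
    ∣∣+∣not∣ P = trans (sym (∑-distrib-+ Ws _ _)) (∑-cong Ws λ w →
      trans (sym (*-distribˡ-+ (V w) [ P w ] [ not (P w) ]))
            (trans (cong (V w *_) ([]-compl (P w))) (*-identityʳ (V w))))

    ∣∣≤N : ∀ P → ∣ P ∣ ≤ N
    ∣∣≤N P = subst (∣ P ∣ ≤_) (∣∣+∣not∣ P) (m≤m+n _ _)

    mass : ∀ {n} → Vec A n → ℕ
    mass []       = 1
    mass (w ∷ ws) = V w * mass ws

    ∑-mass : ∀ n → ∑ (vectors Ws n) mass ≡ N ^ n
    ∑-mass zero    = refl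
    ∑-mass (suc n) = trans (∑-vectors Ws n mass)
      (trans (∑-cong Ws λ w → ∑-*ˡ (vectors Ws n) (V w) mass)
      (trans (∑-*ʳ Ws (∑ (vectors Ws n) mass) V) (cong (N *_) (∑-mass n))))

    zipProduct : ∀ {S : Set} (st : List S) → (S → A → ℕ) → Vec A (length st) → ℕ
    zipProduct []       φ []       = 1
    zipProduct (s ∷ st) φ (w ∷ ws) = φ s w * zipProduct st φ ws

    ∑-zipProduct : ∀ {S : Set} (st : List S) φ →
      ∑ (vectors Ws (length st)) (zipProduct st φ) ≡ ∏ st (λ s → ∑ Ws (φ s))
    ∑-zipProduct []       φ = refl
    ∑-zipProduct (s ∷ st) φ = trans (∑-vectors Ws (length st) (zipProduct (s ∷ st) φ))
      (trans (∑-cong Ws λ w → ∑-*ˡ (vectors Ws (length st)) (φ s w) (zipProduct st φ))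
      (trans (∑-*ʳ Ws (∑ (vectors Ws (length st)) (zipProduct st φ)) (φ s))
             (cong (∑ Ws (φ s) *_) (∑-zipProduct st φ))))

    quiet : ℕ → A → Bool
    quiet zero    w = true
    quiet (suc r) w = quiet r w ∧ not (bit w (suc r))

    -- The index counts the silent rounds before the first transmission, which is in local round
    -- `suc r`.
    first : ℕ → A → Bool
    first r w = quiet r w ∧ bit w (suc r)

    quiet⇒silent : ∀ r w → quiet r w ≡ true → ∀ h → 0 < h → h ≤ r → bit w h ≢ true
    quiet⇒silent zero    w q (suc h) 0<h () b
    quiet⇒silent (suc r) w q h 0<h h≤ b with m≤n⇒m<n∨m≡n h≤
    ... | inj₁ h<  = quiet⇒silent r w (proj₁ (∧-true q)) h 0<h (≤-pred h<) b
    ... | inj₂ refl with bit w (suc r) | proj₂ (∧-true {quiet r w} q)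
    quiet⇒silent (suc r) w q h 0<h h≤ refl | inj₂ refl | true | ()

    fails : ∀ {k} → Instance k → ℕ → Vec A k → Bool
    fails wake d v = not (does (Execution.allSucceedWithin? wake (λ i → bit (lookup v i)) d))

    quiet-step : ∀ r → ∣ quiet r ∣ ≡ ∣ quiet (suc r) ∣ + ∣ first r ∣
    quiet-step r = trans (∑-cong Ws (λ w → trans (cong (V w *_) (split (quiet r w) (bit w (suc r))))
      (*-distribˡ-+ (V w) _ _))) (∑-distrib-+ Ws _ _)
      where
      split : ∀ a b → [ a ] ≡ [ a ∧ not b ] + [ a ∧ b ]
      split true  true  = refl
      split true  false = refl
      split false _     = refl

    -- The words are classified by the round of their first transmission, if there is one up to `r`;
    -- `pred` translates a round into the index of `first`.
    quiet-first : ∀ r → N ≡ ∣ quiet r ∣ + window 0 r (λ r′ → ∣ first (pred r′) ∣)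
    quiet-first zero = sym (trans (+-identityʳ _) (∑-cong Ws (λ w → *-identityʳ (V w))))
    quiet-first (suc r) = trans (quiet-first r)
      (trans (cong (_+ window 0 r _) (quiet-step r)) (lemma ∣ quiet (suc r) ∣ ∣ first r ∣ _))
      where
      lemma : ∀ a b c → a + b + c ≡ a + (c + b)
      lemma = solve-∀

    rate : ℕ → ℕ
    rate r = ∣ (λ w → bit w r) ∣

    -- What the integer weights retain of latency f with high probability: each
    -- instance whose horizon is H fails with probability at most 2 / 2^b, where
    -- k^(-1/e) ≤ 2^(-b).
    Reliable : (f : ℕ → ℕ) (H e n : ℕ) → Set
    Reliable f H e n = ∀ k′ b d (wake : Instance (suc k′)) → f (suc k′) ≡ d →
      b ≤ n → suc k′ ≤ 2 ^ n → 2 ^ (e * b) ≤ suc k′ → horizon wake d ≡ H →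
      2 ^ b * ∑ (vectors Ws (suc k′)) (λ v → mass v * [ fails wake d v ]) ≤ 2 * N ^ suc k′

    -- Jammers aim at their first transmission, in local round suc r₀, since a
    -- station cannot be off before it.
    module Play (r₀ base : ℕ) where

      -- Tells whether a station serves a guard. Guards carry rounds of the target, which wakes up
      -- at `base`. A jammer serves only the round it is aimed at; differing labels never match, so
      -- witnesses from groups A and B are different stations.
      ev : Guard → Station → A → Bool
      ev (jammer , t) (jammer , u) w = (u + suc r₀ ≡ᵇ base + t) ∧ first r₀ w
      ev (groupA , t) (groupA , u) w = (u <ᵇ base + t) ∧ bit w (base + t ∸ u)
      ev (groupB , t) (groupB , u) w = (u <ᵇ base + t) ∧ bit w (base + t ∸ u)
      ev _            _            w = false

      miss : Guard → Station → A → ℕ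
      miss γ s w = V w * [ not (ev γ s w) ]

      missMass : Guard → Station → ℕ
      missMass γ s = ∣ (λ w → not (ev γ s w)) ∣

      holds : Guard → (st : List Station) → Vec A (length st) → Bool
      holds γ []       []       = false
      holds γ (s ∷ st) (w ∷ ws) = ev γ s w ∨ holds γ st ws

      allHold : List Guard → (st : List Station) → Vec A (length st) → Bool
      allHold []      st ws = true
      allHold (γ ∷ Γ) st ws = holds γ st ws ∧ allHold Γ st ws

      holds-witness : ∀ γ st ws → holds γ st ws ≡ true →
                      ∃[ i ] ev γ (List.lookup st i) (lookup ws i) ≡ true
      holds-witness γ []       []       ()
      holds-witness γ (s ∷ st) (w ∷ ws) h with ev γ s w in eq
      ... | true  = zero , eq
      ... | false = let (i , e) = holds-witness γ st ws h in suc i , e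

      allHold-∈ : ∀ {γ} Γ st ws → allHold Γ st ws ≡ true → γ ∈ Γ → holds γ st ws ≡ true
      allHold-∈ (γ ∷ Γ) st ws h (here refl) = proj₁ (∧-true h)
      allHold-∈ (γ ∷ Γ) st ws h (there γ∈)  =
        allHold-∈ Γ st ws (proj₂ (∧-true {holds γ st ws} h)) γ∈

      mass-miss : ∀ γ st ws → holds γ st ws ≡ false → mass ws ≡ zipProduct st (miss γ) ws
      mass-miss γ []       []       h = refl
      mass-miss γ (s ∷ st) (w ∷ ws) h with ev γ s w
      ... | false = cong₂ _*_ (sym (*-identityʳ (V w))) (mass-miss γ st ws h)

      -- This is pointwise in the outcome: for an unmet guard no factor of its product is struck
      -- out, so that summand alone equals `mass ws`.
      union-bound : ∀ Γ st ws →
        mass ws ≤ mass ws * [ allHold Γ st ws ] + ∑ Γ (λ γ → zipProduct st (miss γ) ws)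
      union-bound [] st ws =
        ≤-trans (≤-reflexive (sym (*-identityʳ (mass ws)))) (m≤m+n _ 0)
      union-bound (γ ∷ Γ) st ws with holds γ st ws in eq
      ... | true  = ≤-trans (union-bound Γ st ws)
          (+-monoʳ-≤ (mass ws * [ allHold Γ st ws ])
                     (m≤n+m (∑ Γ (λ γ₁ → zipProduct st (miss γ₁) ws)) (zipProduct st (miss γ) ws)))
      ... | false = ≤-trans (≤-reflexive (mass-miss γ st ws eq))
                      (≤-trans (m≤m+n (zipProduct st (miss γ) ws) _)
                               (m≤n+m _ (mass ws * [ false ])))

      -- The target draws independently of the others, and by the union bound these meet all guards
      -- with probability at least 1/2. So failure is at least half as likely as `C`.
      guard-lemma : ∀ (Γ : List Guard) (st : List Station) (C : A → Bool) (fl : Vec A (suc (length st)) → Bool) →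
        (∀ ξ ws → C ξ ≡ true → allHold Γ st ws ≡ true → fl (ξ ∷ ws) ≡ true) →
        2 * ∑ Γ (λ γ → ∏ st (missMass γ)) ≤ N ^ length st →
        ∣ C ∣ * N ^ length st ≤ 2 * ∑ (vectors Ws (suc (length st))) (λ v → mass v * [ fl v ])
      guard-lemma Γ st C fl sound small = conclude bound
        where
        open ≤-Reasoning
        n : ℕ
        n = length st
        Vs : List (Vec A n)
        Vs = vectors Ws n
        Φ : Vec A n → ℕ
        Φ ws = ∑ Γ (λ γ → zipProduct st (miss γ) ws)
        Fail Σ∏ : ℕ
        Fail = ∑ (vectors Ws (suc n)) (λ v → mass v * [ fl v ])
        Σ∏ = ∑ Γ (λ γ → ∏ st (missMass γ))

        pointwise : ∀ ξ ws → V ξ * [ C ξ ] * mass ws ≤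
                    V ξ * mass ws * [ fl (ξ ∷ ws) ] + V ξ * [ C ξ ] * Φ ws
        pointwise ξ ws with C ξ in c | allHold Γ st ws in a
        ... | false | _ = ≤-trans (≤-reflexive (cong (_* mass ws) (*-zeroʳ (V ξ)))) z≤n
        ... | true | true rewrite sound ξ ws c a = ≤-trans (≤-reflexive (lemma (V ξ) (mass ws))) (m≤m+n _ _)
          where
          lemma : ∀ a b → a * 1 * b ≡ a * b * 1
          lemma = solve-∀
        ... | true | false = ≤-trans (*-monoʳ-≤ (V ξ * 1) (subst (λ b → mass ws ≤ mass ws * [ b ] + Φ ws) a (union-bound Γ st ws)))
          (≤-trans (≤-reflexive (cong (λ z → V ξ * 1 * (z + Φ ws)) (*-zeroʳ (mass ws)))) (m≤n+m _ _))

        ∑Φ : ∑ Vs Φ ≡ Σ∏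
        ∑Φ = trans (∑-swap Vs Γ (λ ws γ → zipProduct st (miss γ) ws))
                   (∑-cong Γ λ γ → ∑-zipProduct st (miss γ))

        bound : ∣ C ∣ * N ^ n ≤ Fail + ∣ C ∣ * Σ∏
        bound = begin
          ∣ C ∣ * N ^ n
            ≡⟨ cong (∣ C ∣ *_) (sym (∑-mass n)) ⟩
          ∣ C ∣ * ∑ Vs mass
            ≡⟨ sym (∑-*ʳ Ws (∑ Vs mass) _) ⟩
          ∑ Ws (λ ξ → V ξ * [ C ξ ] * ∑ Vs mass)
            ≡⟨ ∑-cong Ws (λ ξ → sym (∑-*ˡ Vs (V ξ * [ C ξ ]) mass)) ⟩
          ∑ Ws (λ ξ → ∑ Vs (λ ws → V ξ * [ C ξ ] * mass ws))
            ≤⟨ ∑-mono Ws (λ ξ → ∑-mono Vs (pointwise ξ)) ⟩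
          ∑ Ws (λ ξ → ∑ Vs (λ ws → V ξ * mass ws * [ fl (ξ ∷ ws) ] + V ξ * [ C ξ ] * Φ ws))
            ≡⟨ ∑-cong Ws (λ ξ → trans (∑-distrib-+ Vs _ _) (cong₂ _+_ refl (∑-*ˡ Vs (V ξ * [ C ξ ]) Φ))) ⟩
          ∑ Ws (λ ξ → ∑ Vs (λ ws → V ξ * mass ws * [ fl (ξ ∷ ws) ]) + V ξ * [ C ξ ] * ∑ Vs Φ)
            ≡⟨ ∑-distrib-+ Ws _ _ ⟩
          ∑ Ws (λ ξ → ∑ Vs (λ ws → V ξ * mass ws * [ fl (ξ ∷ ws) ])) + ∑ Ws (λ ξ → V ξ * [ C ξ ] * ∑ Vs Φ)
            ≡⟨ cong₂ _+_ (sym (∑-vectors Ws n (λ v → mass v * [ fl v ])))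
                         (trans (∑-*ʳ Ws (∑ Vs Φ) _) (cong (∣ C ∣ *_) ∑Φ)) ⟩
          Fail + ∣ C ∣ * Σ∏ ∎

        conclude : ∣ C ∣ * N ^ n ≤ Fail + ∣ C ∣ * Σ∏ → ∣ C ∣ * N ^ n ≤ 2 * Fail
        conclude h = +-cancelʳ-≤ (∣ C ∣ * N ^ n) _ _ (begin
          ∣ C ∣ * N ^ n + ∣ C ∣ * N ^ n
            ≡⟨ lemma₁ (∣ C ∣ * N ^ n) ⟩
          2 * (∣ C ∣ * N ^ n)
            ≤⟨ *-monoʳ-≤ 2 h ⟩
          2 * (Fail + ∣ C ∣ * Σ∏)
            ≡⟨ lemma₂ Fail ∣ C ∣ Σ∏ ⟩
          2 * Fail + ∣ C ∣ * (2 * Σ∏)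
            ≤⟨ +-monoʳ-≤ (2 * Fail) (*-monoʳ-≤ ∣ C ∣ small) ⟩
          2 * Fail + ∣ C ∣ * N ^ n ∎)
          where
          lemma₁ : ∀ a → a + a ≡ 2 * a
          lemma₁ = solve-∀
          lemma₂ : ∀ a b c → 2 * (a + b * c) ≡ 2 * a + b * (2 * c)
          lemma₂ = solve-∀

      -- From guards to the failure of the target.

      wakes : (st : List Station) → Instance (suc (length st))
      wakes st zero    = base
      wakes st (suc i) = proj₂ (List.lookup st i)

      Guarded : List Guard → ℕ → Set
      Guarded Γ t = (jammer , t) ∈ Γ ⊎ ((groupA , t) ∈ Γ × (groupB , t) ∈ Γ)

      -- Members of the crowd are blocked like the target: they must not wake up earlier, and since
      -- their draws are not restricted by `C`, every round needs a guard. Without groups the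
      -- condition is vacuous.
      Separated : List Guard → List Station → ℕ → Set
      Separated Γ st d = ∀ {ℓ u} → (ℓ , u) ∈ st → Grouped ℓ →
                         base ≤ u × (∀ t → 0 < t → t ≤ d → Guarded Γ t)

      module _ (Γ : List Guard) (st : List Station) (d : ℕ)
               (grouped : Separated Γ st d)
               (ξ : A) (ws : Vec A (length st))
               (target : ∀ t → 0 < t → t ≤ d → bit ξ t ≡ true → Guarded Γ t)
               (hold : allHold Γ st ws ≡ true) where

        private
          X : Fin (suc (length st)) → RoundSet
          X i = bit (lookup (ξ ∷ ws) i)

        open Blocking (wakes st) X

        private
          -- The stations that never get through: the target and both groups. Jammers may succeed,
          -- since each is relied upon only for its first transmission.
          Main : Fin (suc (length st)) → Set
          Main zero    = ⊤
          Main (suc i) = Grouped (proj₁ (List.lookup st i))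

          Aimed : Label → ℕ → Fin (suc (length st)) → Set
          Aimed ℓ t zero    = ⊥
          Aimed ℓ t (suc i) = proj₁ (List.lookup st i) ≡ ℓ ×
                              ev (ℓ , t) (List.lookup st i) (lookup ws i) ≡ true

          ev-label : ∀ ℓ t s w → ev (ℓ , t) s w ≡ true → proj₁ s ≡ ℓ
          ev-label jammer t (jammer , u) w e = refl
          ev-label groupA t (groupA , u) w e = refl
          ev-label groupB t (groupB , u) w e = refl

          aimed : ∀ ℓ t → (ℓ , t) ∈ Γ → ∃[ j ] Aimed ℓ t j
          aimed ℓ t γ∈ with holds-witness (ℓ , t) st ws (allHold-∈ Γ st ws hold γ∈)
          ... | i , e = suc i , ev-label ℓ t (List.lookup st i) (lookup ws i) e , e

          jammer-first : ∀ t j → Aimed jammer t j → First (base + t) j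
          jammer-first t (suc i) (_ , e) with List.lookup st i
          ... | (jammer , u) with ∧-true {u + suc r₀ ≡ᵇ base + t} e
          ...   | e₁ , e₂ with ≡ᵇ-true {u + suc r₀} {base + t} e₁ | ∧-true {quiet r₀ (lookup ws i)} e₂
          ...     | eq | q , b rewrite sym eq =
                    (m<m+n u (s≤s z≤n) ,
                     trans (cong (bit (lookup ws i)) (m+n∸m≡n u (suc r₀))) b) ,
                    λ h h< (u<h , bh) → quiet⇒silent r₀ (lookup ws i) q (h ∸ u)
                      (m<n⇒0<n∸m u<h)
                      (≤-pred (subst (suc (h ∸ u) ≤_) (m+n∸m≡n u (suc r₀))
                        (∸-monoˡ-< h< (<⇒≤ u<h)))) bh

          group-sends : ∀ ℓ t → Grouped ℓ → ∀ j → Aimed ℓ t j → Main j × Sends (base + t) j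
          group-sends groupA t _ (suc i) (l , e) with List.lookup st i
          ... | (groupA , u) = tt , <ᵇ-true {u} (proj₁ (∧-true e)) , proj₂ (∧-true {u <ᵇ base + t} e)
          group-sends groupB t _ (suc i) (l , e) with List.lookup st i
          ... | (groupB , u) = tt , <ᵇ-true {u} (proj₁ (∧-true e)) , proj₂ (∧-true {u <ᵇ base + t} e)

          jammer-not-main : ∀ t i j → Main i → Aimed jammer t j → j ≢ i
          jammer-not-main t i (suc j) m (l , _) refl = subst Grouped l m

          A≢B : ∀ t i j → Aimed groupA t i → Aimed groupB t j → i ≢ j
          A≢B t (suc i) (suc j) (l , _) (l′ , _) refl with trans (sym l) l′
          ... | ()

          main-guarded : ∀ t i → 0 < t → t ≤ d → Main i → Sends (base + t) i → Guarded Γ t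
          main-guarded t zero 0<t t≤d m (_ , b) =
            target t 0<t t≤d (trans (cong (bit ξ) (sym (m+n∸m≡n base t))) b)
          main-guarded t (suc i) 0<t t≤d m _ =
            proj₂ (grouped (∈-lookup {xs = st} i) m) t 0<t t≤d

          main-late : ∀ i → Main i → base ≤ wakes st i
          main-late zero    m = ≤-refl
          main-late (suc i) m = proj₁ (grouped (∈-lookup {xs = st} i) m)

          respond : ∀ t i → Main i → Guarded Γ t →
                    ∃[ j ] j ≢ i × ((Main j × Sends (base + t) j) ⊎ First (base + t) j)
          respond t i m (inj₁ γ∈) with aimed jammer t γ∈
          ... | j , a = j , jammer-not-main t i j m a , inj₂ (jammer-first t j a)
          -- If the witness from group A is `i` itself, the witness from group B is another station.
          respond t i m (inj₂ (α∈ , β∈)) with aimed groupA t α∈ | aimed groupB t β∈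
          ... | p , a | q , b with p Fin.≟ i
          ...   | no  p≢i  = p , p≢i , inj₁ (group-sends groupA t tt p a)
          ...   | yes refl = q , (λ q≡p → A≢B t p q a b (sym q≡p)) , inj₁ (group-sends groupB t tt q b)

          blocked : ∀ g i → g ≤ base + d → Main i → Sends g i →
                    ∃[ j ] j ≢ i × ((Main j × Sends g j) ⊎ First g j)
          blocked g i g≤ m s with m≤n⇒∃[o]m+o≡n (<⇒≤ (≤-<-trans (main-late i m) (proj₁ s)))
          ... | t , refl = respond t i m (main-guarded t i
                  (+-cancelˡ-< base 0 t (subst (_< base + t) (sym (+-identityʳ base))
                    (≤-<-trans (main-late i m) (proj₁ s))))
                  (+-cancelˡ-≤ base t d g≤) m s)

        target-fails : fails (wakes st) d (ξ ∷ ws) ≡ true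
        target-fails = cong not (dec-false (Execution.allSucceedWithin? (wakes st) X d)
          (main-fails Main (base + d) blocked d zero tt ≤-refl))

      module _ (f : ℕ → ℕ) (H e n : ℕ) (reliable : Reliable f H e n) (N>0 : 0 < N) where

        -- Failure has at least half the probability of `C` but by reliability at most `2 / 2 ^ b`,
        -- whence the 4. The two extra places are for the target and at least one idle station.
        attack : ∀ Γ st (C : A → Bool) k b →
          length st + 2 ≤ k → k ≤ 2 ^ n → b ≤ n → 2 ^ (e * b) ≤ k →
          base + f k ≤ H → (∀ {ℓ u} → (ℓ , u) ∈ st → u + f k ≤ H) →
          Separated Γ st (f k) →
          (∀ ξ → C ξ ≡ true → ∀ t → 0 < t → t ≤ f k → bit ξ t ≡ true → Guarded Γ t) →
          2 * ∑ Γ (λ γ → ∏ st (missMass γ)) ≤ N ^ length st →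
          ∣ C ∣ * 2 ^ b ≤ 4 * N
        attack Γ st C k b room k≤ b≤ kb base≤ wakes≤ sep target small =
          *-cancelʳ-≤ (∣ C ∣ * 2 ^ b) (4 * N) (N ^ length st′)
            {{>-nonZero (m^n>0 N {{>-nonZero N>0}} (length st′))}} (begin
            ∣ C ∣ * 2 ^ b * N ^ length st′    ≡⟨ lemma₁ ∣ C ∣ (2 ^ b) (N ^ length st′) ⟩
            2 ^ b * (∣ C ∣ * N ^ length st′)  ≤⟨ *-monoʳ-≤ (2 ^ b) guarded ⟩
            2 ^ b * (2 * Fail)                ≡⟨ lemma₂ (2 ^ b) Fail ⟩
            2 * (2 ^ b * Fail)                ≤⟨ *-monoʳ-≤ 2 failing ⟩
            2 * (2 * (N * N ^ length st′))    ≡⟨ lemma₃ N (N ^ length st′) ⟩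
            4 * N * N ^ length st′            ∎)
          where
          open ≤-Reasoning
          lemma₁ : ∀ a b c → a * b * c ≡ b * (a * c)
          lemma₁ = solve-∀
          lemma₂ : ∀ a b → a * (2 * b) ≡ 2 * (a * b)
          lemma₂ = solve-∀
          lemma₃ : ∀ a b → 2 * (2 * (a * b)) ≡ 4 * a * b
          lemma₃ = solve-∀

          d far pad : ℕ
          d   = f k
          far = H ∸ d
          pad = k ∸ (length st + 2)

          -- The idle stations wake up so late that the horizon becomes H.
          idles st′ : List Station
          idles = replicate (suc pad) (idle , far)
          st′   = st ++ idles

          size : suc (length st′) ≡ k
          size = begin-equality
            suc (length st′)                       ≡⟨ cong suc (length-++ st) ⟩
            suc (length st + length idles)         ≡⟨ cong (λ x → suc (length st + x)) (length-replicate (suc pad)) ⟩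
            suc (length st + suc pad)              ≡⟨ lemma (length st) pad ⟩
            length st + 2 + pad                    ≡⟨ m+[n∸m]≡n room ⟩
            k                                      ∎
            where
            lemma : ∀ a b → suc (a + suc b) ≡ a + 2 + b
            lemma = solve-∀

          d≤H : d ≤ H
          d≤H = ≤-trans (m≤n+m d base) base≤

          wakes-far : ∀ i → wakes st′ i ≤ far
          wakes-far zero    = m+n≤o⇒m≤o∸n base base≤
          wakes-far (suc i) with ∈-++⁻ st (∈-lookup {xs = st′} i)
          ... | inj₁ s∈ = m+n≤o⇒m≤o∸n _ (wakes≤ s∈)
          ... | inj₂ s∈ = ≤-reflexive (cong proj₂ (∈-replicate⁻ (suc pad) s∈))

          idle∈ : (idle , far) ∈ st′
          idle∈ = ∈-++⁺ʳ st (here refl)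

          horizon≡ : horizon (wakes st′) d ≡ H
          horizon≡ = trans (cong (_+ d) (≤-antisym (max-≤ (wakes st′) far wakes-far)
            (≤-trans (≤-reflexive (cong proj₂ (lookup-index idle∈))) (≤-max (wakes st′) (suc (index idle∈))))))
            (m∸n+n≡m d≤H)

          Fail : ℕ
          Fail = ∑ (vectors Ws (suc (length st′))) (λ v → mass v * [ fails (wakes st′) d v ])

          failing : 2 ^ b * Fail ≤ 2 * N ^ suc (length st′)
          failing = reliable (length st′) b d (wakes st′) (cong f size) b≤
            (subst (_≤ 2 ^ n) (sym size) k≤) (subst (2 ^ (e * b) ≤_) (sym size) kb) horizon≡

          sep′ : Separated Γ st′ d
          sep′ s∈ g with ∈-++⁻ st s∈
          ... | inj₁ s∈st = sep s∈st g
          ... | inj₂ s∈idles with ∈-replicate⁻ (suc pad) s∈idles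
          sep′ s∈ () | inj₂ s∈idles | refl

          small′ : 2 * ∑ Γ (λ γ → ∏ st′ (missMass γ)) ≤ N ^ length st′
          small′ = begin
            2 * ∑ Γ (λ γ → ∏ st′ (missMass γ))
              ≤⟨ *-monoʳ-≤ 2 (∑-mono Γ (λ γ → ≤-trans (≤-reflexive (∏-++ st idles (missMass γ)))
                   (*-monoʳ-≤ (∏ st (missMass γ)) (∏-mono idles (λ s → ∣∣≤N _))))) ⟩
            2 * ∑ Γ (λ γ → ∏ st (missMass γ) * ∏ idles (λ _ → N))
              ≡⟨ cong (2 *_) (∑-*ʳ Γ (∏ idles (λ _ → N)) _) ⟩
            2 * (∑ Γ (λ γ → ∏ st (missMass γ)) * ∏ idles (λ _ → N))
              ≡⟨ sym (*-assoc 2 (∑ Γ (λ γ → ∏ st (missMass γ))) (∏ idles (λ _ → N))) ⟩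
            2 * ∑ Γ (λ γ → ∏ st (missMass γ)) * ∏ idles (λ _ → N)
              ≤⟨ *-mono-≤ small (≤-reflexive (∏-const idles N)) ⟩
            N ^ length st * N ^ length idles
              ≡⟨ sym (^-distribˡ-+-* N (length st) (length idles)) ⟩
            N ^ (length st + length idles)
              ≡⟨ cong (N ^_) (sym (length-++ st)) ⟩
            N ^ length st′ ∎

          guarded : ∣ C ∣ * N ^ length st′ ≤ 2 * Fail
          guarded = guard-lemma Γ st′ C (fails (wakes st′) d)
            (λ ξ ws c h → target-fails Γ st′ d sep′ ξ ws (target ξ c) h) small′

      -- Jamming a list of rounds.

      module Jammers (B l : ℕ) (r₀<base : r₀ < base)
                     (B-jam : ∣ (λ w → not (first r₀ w)) ∣ ^ B * 2 ^ l ≤ N ^ B) where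

        -- The subtraction is exact because `r₀<base`; the target wakes up at `base` rather than 0
        -- to leave jammers this time.
        aim : ℕ → ℕ
        aim t = base + t ∸ suc r₀

        jams : List ℕ → List Station
        jams []      = []
        jams (t ∷ J) = replicate B (jammer , aim t) ++ jams J

        length-jams : ∀ J → length (jams J) ≡ length J * B
        length-jams []      = refl
        length-jams (t ∷ J) = trans (length-++ (replicate B (jammer , aim t)))
          (cong₂ _+_ (length-replicate B) (length-jams J))

        ∈-jams : ∀ {ℓ u} J → (ℓ , u) ∈ jams J → ℓ ≡ jammer × ∃[ t ] t ∈ J × u ≡ aim t
        ∈-jams (t ∷ J) s∈ with ∈-++⁻ (replicate B (jammer , aim t)) s∈
        ... | inj₁ s∈₁ with ∈-replicate⁻ B s∈₁
        ...   | refl = refl , t , here refl , refl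
        ∈-jams (t ∷ J) s∈ | inj₂ s∈₂ with ∈-jams J s∈₂
        ... | eq , t′ , t∈ , eq′ = eq , t′ , there t∈ , eq′

        miss-aimed : ∀ t → missMass (jammer , t) (jammer , aim t) ≡ ∣ (λ w → not (first r₀ w)) ∣
        miss-aimed t = ∑-cong Ws (λ w → cong (λ b → V w * [ not (b ∧ first r₀ w) ])
          (trans (cong (_≡ᵇ base + t) (m∸n+n≡m (≤-trans r₀<base (m≤m+n base t)))) (≡ᵇ-refl (base + t))))

        ∏≤ : ∀ γ st → ∏ st (missMass γ) ≤ N ^ length st
        ∏≤ γ st = ≤-trans (∏-mono st (λ s → ∣∣≤N _)) (≤-reflexive (∏-const st N))

        miss-jam : ∀ {t} J → t ∈ J → ∏ (jams J) (missMass (jammer , t)) * 2 ^ l ≤ N ^ length (jams J)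
        miss-jam {t} (t′ ∷ J) t∈ = begin
          ∏ (R ++ jams J) (missMass γ) * 2 ^ l
            ≡⟨ cong (_* 2 ^ l) (∏-++ R (jams J) (missMass γ)) ⟩
          ∏ R (missMass γ) * ∏ (jams J) (missMass γ) * 2 ^ l
            ≤⟨ step t∈ ⟩
          N ^ length R * N ^ length (jams J)
            ≡⟨ sym (^-distribˡ-+-* N (length R) _) ⟩
          N ^ (length R + length (jams J))
            ≡⟨ cong (N ^_) (sym (length-++ R)) ⟩
          N ^ length (R ++ jams J) ∎
          where
          open ≤-Reasoning
          γ : Guard
          γ = jammer , t
          R : List Station
          R = replicate B (jammer , aim t′)
          swap : ∀ a b c → a * b * c ≡ a * c * b
          swap = solve-∀
          step : t ∈ t′ ∷ J →
            ∏ R (missMass γ) * ∏ (jams J) (missMass γ) * 2 ^ l ≤ N ^ length R * N ^ length (jams J)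
          step (here refl) = ≤-trans (≤-reflexive (swap (∏ R (missMass γ)) _ (2 ^ l)))
            (*-mono-≤ (subst₂ (λ x y → x * 2 ^ l ≤ N ^ y)
                (sym (trans (∏-replicate B _ (missMass γ)) (cong (_^ B) (miss-aimed t)))) (sym (length-replicate B)) B-jam)
              (∏≤ γ (jams J)))
          step (there t∈J) = ≤-trans (≤-reflexive (*-assoc (∏ R (missMass γ)) _ (2 ^ l)))
            (*-mono-≤ (∏≤ γ R) (miss-jam J t∈J))

        jam-guards : List ℕ → List Guard
        jam-guards J = map (jammer ,_) J

        misses-jam : ∀ J st → ∑ (jam-guards J) (λ γ → ∏ (jams J ++ st) (missMass γ)) * 2 ^ l
                              ≤ length J * N ^ length (jams J ++ st)
        misses-jam J st = begin
          ∑ (jam-guards J) (λ γ → ∏ S (missMass γ)) * 2 ^ l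
            ≡⟨ cong (_* 2 ^ l) (∑-map (jammer ,_) J (λ γ → ∏ S (missMass γ))) ⟩
          ∑ J (λ t → ∏ S (missMass (jammer , t))) * 2 ^ l
            ≡⟨ sym (∑-*ʳ J (2 ^ l) _) ⟩
          ∑ J (λ t → ∏ S (missMass (jammer , t)) * 2 ^ l)
            ≤⟨ ∑-mono-∈ J each ⟩
          ∑ J (λ _ → N ^ length S)
            ≡⟨ ∑-const J _ ⟩
          length J * N ^ length S ∎
          where
          open ≤-Reasoning
          S : List Station
          S = jams J ++ st
          swap : ∀ a b c → a * b * c ≡ a * c * b
          swap = solve-∀
          each : ∀ {t} → t ∈ J → ∏ S (missMass (jammer , t)) * 2 ^ l ≤ N ^ length S
          each {t} t∈ = begin
            ∏ S (missMass γ) * 2 ^ l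
              ≡⟨ cong (_* 2 ^ l) (∏-++ (jams J) st (missMass γ)) ⟩
            ∏ (jams J) (missMass γ) * ∏ st (missMass γ) * 2 ^ l
              ≡⟨ swap (∏ (jams J) (missMass γ)) _ (2 ^ l) ⟩
            ∏ (jams J) (missMass γ) * 2 ^ l * ∏ st (missMass γ)
              ≤⟨ *-mono-≤ (miss-jam J t∈) (∏≤ γ st) ⟩
            N ^ length (jams J) * N ^ length st
              ≡⟨ sym (^-distribˡ-+-* N (length (jams J)) _) ⟩
            N ^ (length (jams J) + length st)
              ≡⟨ cong (N ^_) (sym (length-++ (jams J))) ⟩
            N ^ length S ∎
            where
            γ : Guard
            γ = jammer , t

        -- Whatever the at most j transmissions of a station in a window are, they
        -- lie in the residue classes listed by one of the Q^j vectors c, so a union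
        -- bound over c suffices.
        module Residues (Q : ℕ) .{{_ : NonZero Q}} where

          covers : ∀ {j} → Vec ℕ j → ℕ → ℕ → A → Bool
          covers c lo zero      w = true
          covers c lo (suc len) w =
            covers c lo len w ∧ (not (bit w (lo + suc len)) ∨ member ((lo + suc len) % Q) c)

          covers-∷ : ∀ {j} (c : Vec ℕ j) x lo len w → covers c lo len w ≡ true → covers (x ∷ c) lo len w ≡ true
          covers-∷ c x lo zero      w h = refl
          covers-∷ c x lo (suc len) w h with ∧-true {covers c lo len w} h
          ... | h₁ , h₂ rewrite covers-∷ c x lo len w h₁ with bit w (lo + suc len)
          ...   | false = refl
          ...   | true rewrite h₂ with (lo + suc len) % Q ≡ᵇ x
          ...     | true  = refl
          ...     | false = refl

          covers-member : ∀ {j} (c : Vec ℕ j) lo len w → covers c lo len w ≡ true →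
                          ∀ t → lo < t → t ≤ lo + len → bit w t ≡ true → member (t % Q) c ≡ true
          covers-member c lo zero w h t lo<t t≤ b = contradiction lo<t (≤⇒≯ (subst (t ≤_) (+-identityʳ lo) t≤))
          covers-member c lo (suc len) w h t lo<t t≤ b
            with ∧-true {covers c lo len w} h | m≤n⇒m<n∨m≡n t≤
          ... | h₁ , h₂ | inj₁ t< = covers-member c lo len w h₁ t lo<t (≤-pred (subst (t <_) (+-suc lo len) t<)) b
          ... | h₁ , h₂ | inj₂ refl with bit w (lo + suc len)
          ...   | true = h₂
          covers-member c lo (suc len) w h t lo<t t≤ () | h₁ , h₂ | inj₂ refl | false

          hits : ℕ → ℕ → A → ℕ
          hits lo len w = window lo len (λ r → [ bit w r ])

          classes : ∀ j → List (Vec ℕ j)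
          classes = vectors (upTo Q)

          cover : ∀ lo len j w → hits lo len w ≤ j → ∃[ c ] c ∈ classes j × covers c lo len w ≡ true
          cover lo zero zero    w h = [] , here refl , refl
          cover lo zero (suc j) w h with cover lo zero j w z≤n
          -- Spare entries are filled with residue 0, so that the vector always has length `j`.
          ... | c , c∈ , _ = 0 ∷ c , ∈-cartesianProductWith⁺ _∷_ (∈-upTo⁺ (>-nonZero⁻¹ Q)) c∈ , refl
          cover lo (suc len) j w h with bit w (lo + suc len) in eq
          ... | false with cover lo len j w (≤-trans (m≤m+n _ 0) h)
          ...   | c , c∈ , cov = c , c∈ , cong₂ _∧_ cov refl
          cover lo (suc len) zero w h | true = contradiction (≤-trans (m≤n+m 1 _) h) λ ()
          cover lo (suc len) (suc j) w h | true
            with cover lo len j w (≤-pred (subst (_≤ suc j) (+-comm (hits lo len w) 1) h))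
          ...   | c , c∈ , cov = (t % Q) ∷ c , ∈-cartesianProductWith⁺ _∷_ (∈-upTo⁺ (m%n<n t Q)) c∈ ,
                  cong₂ _∧_ (covers-∷ c (t % Q) lo len w cov)
                            (cong (_∨ member (t % Q) c) (≡ᵇ-refl (t % Q)))
            where
            t : ℕ
            t = lo + suc len

          -- For residues below `Q` the list may overshoot `d` by less than `Q`, which is harmless
          -- and makes its length the same for all residues.
          rounds : ∀ {j} → ℕ → Vec ℕ j → List ℕ
          rounds d []      = []
          rounds d (x ∷ c) = map (λ s → x + s * Q) (upTo (suc (d / Q))) ++ rounds d c

          length-rounds : ∀ {j} d (c : Vec ℕ j) → length (rounds d c) ≡ j * suc (d / Q)
          length-rounds d []      = refl
          length-rounds d (x ∷ c) = trans (length-++ (map (λ s → x + s * Q) (upTo (suc (d / Q)))))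
            (cong₂ _+_ (trans (length-map (λ s → x + s * Q) (upTo (suc (d / Q)))) (length-upTo (suc (d / Q)))) (length-rounds d c))

          member⇒∈rounds : ∀ {j} d (c : Vec ℕ j) t → t ≤ d → member (t % Q) c ≡ true → t ∈ rounds d c
          member⇒∈rounds d (x ∷ c) t t≤d h with t % Q ≡ᵇ x in eq
          ... | true  = ∈-++⁺ˡ (subst (_∈ map (λ s → x + s * Q) (upTo (suc (d / Q))))
                  (trans (cong (_+ t / Q * Q) (sym (≡ᵇ-true {t % Q} eq))) (sym (m≡m%n+[m/n]*n t Q)))
                  (∈-map⁺ (λ s → x + s * Q) (∈-upTo⁺ (s≤s (/-monoˡ-≤ Q t≤d)))))
          ... | false = ∈-++⁺ʳ (map (λ s → x + s * Q) (upTo (suc (d / Q)))) (member⇒∈rounds d c t t≤d h)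

          rounds-≤ : ∀ {j} d (c : Vec ℕ j) → c ∈ classes j → ∀ {t} → t ∈ rounds d c → t ≤ Q + d
          rounds-≤ {suc j} d (x ∷ c) c∈ t∈ with ∈-cartesianProductWith⁻ _∷_ (upTo Q) (classes j) c∈
          ... | x′ , c′ , x∈ , c′∈ , refl with ∈-++⁻ (map (λ s → x + s * Q) (upTo (suc (d / Q)))) t∈
          ...   | inj₂ t∈c = rounds-≤ d c c′∈ t∈c
          ...   | inj₁ t∈x with ∈-map⁻ (λ s → x + s * Q) {xs = upTo (suc (d / Q))} t∈x
          ...     | s , s∈ , refl = +-mono-≤ (<⇒≤ (∈-upTo⁻ x∈))
                    (≤-trans (*-monoˡ-≤ Q (≤-pred (∈-upTo⁻ {suc (d / Q)} s∈))) (m/n*n≤m d Q))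

          schedule : ∀ {j} → ℕ → ℕ → Vec ℕ j → List ℕ
          schedule lo d c = map suc (upTo lo) ++ rounds d c

          length-schedule : ∀ {j} lo d (c : Vec ℕ j) → length (schedule lo d c) ≡ lo + j * suc (d / Q)
          length-schedule lo d c = trans (length-++ (map suc (upTo lo)))
            (cong₂ _+_ (trans (length-map suc (upTo lo)) (length-upTo lo)) (length-rounds d c))

          ∈-schedule : ∀ {j} lo len d (c : Vec ℕ j) w → covers c lo len w ≡ true → d ≤ lo + len →
                       ∀ t → 0 < t → t ≤ d → bit w t ≡ true → t ∈ schedule lo d c
          ∈-schedule lo len d c w cov d≤ (suc t) 0<t t≤d b with suc t ≤? lo
          ... | yes t<lo = ∈-++⁺ˡ {xs = map suc (upTo lo)} (∈-map⁺ suc {xs = upTo lo} (∈-upTo⁺ t<lo))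
          ... | no  t≮lo = ∈-++⁺ʳ (map suc (upTo lo)) (member⇒∈rounds d c (suc t) t≤d
                  (covers-member c lo len w cov (suc t) (≰⇒> t≮lo) (≤-trans t≤d d≤) b))

          schedule-≤ : ∀ {j} lo d (c : Vec ℕ j) → c ∈ classes j → ∀ {t} → t ∈ schedule lo d c → t ≤ lo + (Q + d)
          schedule-≤ lo d c c∈ t∈ with ∈-++⁻ (map suc (upTo lo)) t∈
          ... | inj₂ t∈c = ≤-trans (rounds-≤ d c c∈ t∈c) (m≤n+m _ lo)
          ... | inj₁ t∈l with ∈-map⁻ suc t∈l
          ...   | s , s∈ , refl = ≤-trans (∈-upTo⁻ s∈) (m≤m+n lo (Q + d))

          module _ (f : ℕ → ℕ) (H e n : ℕ) (reliable : Reliable f H e n) (N>0 : 0 < N) (lo len k b j : ℕ)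
                   (room : (lo + j * suc (f k / Q)) * B + 2 ≤ k)
                   (few-guards : 2 * (lo + j * suc (f k / Q)) ≤ 2 ^ l)
                   (f≤ : f k ≤ lo + len) (k≤ : k ≤ 2 ^ n) (b≤ : b ≤ n) (kb : 2 ^ (e * b) ≤ k)
                   (late : base + (lo + (Q + f k)) + f k ≤ H) where

            open ≤-Reasoning

            -- Jamming the first `lo` rounds and the classes in `c` hits every round in which a
            -- covered target can transmit within its latency.
            unlikely-cover : ∀ c → c ∈ classes j → ∣ covers c lo len ∣ * 2 ^ b ≤ 4 * N
            unlikely-cover c c∈ = attack f H e n reliable N>0 (jam-guards J) (jams J) (covers c lo len) k b
              (subst (λ x → x + 2 ≤ k) (sym size) room) k≤ b≤ kb
              (≤-trans (+-monoˡ-≤ (f k) (m≤m+n base _)) late)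
              wakes-early no-groups
              (λ ξ cov t 0<t t≤ bt → inj₁ (∈-map⁺ (jammer ,_) (∈-schedule lo len (f k) c ξ cov f≤ t 0<t t≤ bt)))
              small
              where
              J : List ℕ
              J = schedule lo (f k) c
              size : length (jams J) ≡ (lo + j * suc (f k / Q)) * B
              size = trans (length-jams J) (cong (_* B) (length-schedule lo (f k) c))
              wakes-early : ∀ {ℓ u} → (ℓ , u) ∈ jams J → u + f k ≤ H
              wakes-early s∈ with ∈-jams J s∈
              ... | _ , t , t∈ , refl = ≤-trans (+-monoˡ-≤ (f k) (≤-trans (m∸n≤m (base + t) (suc r₀))
                    (+-monoʳ-≤ base (schedule-≤ lo (f k) c c∈ t∈)))) late
              no-groups : Separated (jam-guards J) (jams J) (f k)
              no-groups s∈ g with ∈-jams J s∈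
              no-groups s∈ () | refl , _
              small : 2 * ∑ (jam-guards J) (λ γ → ∏ (jams J) (missMass γ)) ≤ N ^ length (jams J)
              small = *-cancelʳ-≤ _ _ (2 ^ l) {{m^n≢0 2 l}} (begin
                2 * Σ₀ * 2 ^ l           ≡⟨ *-assoc 2 Σ₀ (2 ^ l) ⟩
                2 * (Σ₀ * 2 ^ l)         ≤⟨ *-monoʳ-≤ 2 (subst (λ S → ∑ (jam-guards J) (λ γ → ∏ S (missMass γ)) * 2 ^ l ≤ length J * N ^ length S)
                                              (++-identityʳ (jams J)) (misses-jam J [])) ⟩
                2 * (length J * P)       ≡⟨ sym (*-assoc 2 (length J) P) ⟩
                2 * length J * P         ≤⟨ *-monoˡ-≤ P (subst (λ x → 2 * x ≤ 2 ^ l) (sym (length-schedule lo (f k) c)) few-guards) ⟩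
                2 ^ l * P                ≡⟨ *-comm (2 ^ l) P ⟩
                P * 2 ^ l                ∎)
                where
                Σ₀ P : ℕ
                Σ₀ = ∑ (jam-guards J) (λ γ → ∏ (jams J) (missMass γ))
                P  = N ^ length (jams J)

            few : A → Bool
            few w = hits lo len w ≤ᵇ j

            few-cover : ∀ w → [ few w ] ≤ ∑ (classes j) (λ c → [ covers c lo len w ])
            few-cover w with hits lo len w ≤ᵇ j in eq
            ... | false = z≤n
            ... | true with cover lo len j w (≤ᵇ⇒≤ _ _ (Equivalence.from T-≡ eq))
            ...   | c , c∈ , cov = subst (λ x → [ x ] ≤ _) cov (∈⇒≤∑ (λ c → [ covers c lo len w ]) c∈)

            few-unlikely : ∣ few ∣ * 2 ^ b ≤ Q ^ j * (4 * N)
            few-unlikely = begin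
              ∣ few ∣ * 2 ^ b
                ≤⟨ *-monoˡ-≤ (2 ^ b) (∑-mono Ws (λ w → *-monoʳ-≤ (V w) (few-cover w))) ⟩
              ∑ Ws (λ w → V w * ∑ (classes j) (λ c → [ covers c lo len w ])) * 2 ^ b
                ≡⟨ cong (_* 2 ^ b) (trans (∑-cong Ws (λ w → sym (∑-*ˡ (classes j) (V w) _)))
                     (∑-swap Ws (classes j) (λ w c → V w * [ covers c lo len w ]))) ⟩
              ∑ (classes j) (λ c → ∣ covers c lo len ∣) * 2 ^ b
                ≡⟨ sym (∑-*ʳ (classes j) (2 ^ b) _) ⟩
              ∑ (classes j) (λ c → ∣ covers c lo len ∣ * 2 ^ b)
                ≤⟨ ∑-mono-∈ (classes j) (λ {c} → unlikely-cover c) ⟩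
              ∑ (classes j) (λ _ → 4 * N)
                ≡⟨ ∑-vectors-const (upTo Q) j (4 * N) ⟩
              length (upTo Q) ^ j * (4 * N)
                ≡⟨ cong (λ x → x ^ j * (4 * N)) (length-upTo Q) ⟩
              Q ^ j * (4 * N) ∎

            -- At most half of the weight has `j` hits or fewer; the rest contributes at least `j`
            -- each. Adding `j * N` on both sides avoids halving.
            expected-hits : Q ^ j * 8 ≤ 2 ^ b → j * N ≤ 2 * window lo len (λ r → ∣ (λ w → bit w r) ∣)
            expected-hits Qj≤ = +-cancelˡ-≤ (j * N) _ _ (begin
              j * N + j * N
                ≡⟨ lemma₁ j N ⟩
              j * (2 * N)
                ≡⟨ cong (λ x → j * (2 * x)) (sym (∣∣+∣not∣ few)) ⟩
              j * (2 * (∣ few ∣ + ∣ many ∣))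
                ≡⟨ lemma₂ j ∣ few ∣ ∣ many ∣ ⟩
              j * (2 * ∣ few ∣) + 2 * (∣ many ∣ * j)
                ≤⟨ +-mono-≤ (*-monoʳ-≤ j half) (*-monoʳ-≤ 2 markov) ⟩
              j * N + 2 * window lo len (λ r → ∣ (λ w → bit w r) ∣) ∎)
              where
              many : A → Bool
              many w = not (few w)
              lemma₁ : ∀ a b → a * b + a * b ≡ a * (2 * b)
              lemma₁ = solve-∀
              lemma₂ : ∀ a b c → a * (2 * (b + c)) ≡ a * (2 * b) + 2 * (c * a)
              lemma₂ = solve-∀
              half : 2 * ∣ few ∣ ≤ N
              half = *-cancelʳ-≤ _ _ (Q ^ j * 4) {{m*n≢0 (Q ^ j) 4 {{m^n≢0 Q j}}}} (begin
                2 * ∣ few ∣ * (Q ^ j * 4)    ≡⟨ lemma₃ ∣ few ∣ (Q ^ j) ⟩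
                ∣ few ∣ * (Q ^ j * 8)        ≤⟨ *-monoʳ-≤ ∣ few ∣ Qj≤ ⟩
                ∣ few ∣ * 2 ^ b              ≤⟨ few-unlikely ⟩
                Q ^ j * (4 * N)              ≡⟨ lemma₄ (Q ^ j) N ⟩
                N * (Q ^ j * 4)              ∎)
                where
                lemma₃ : ∀ a q → 2 * a * (q * 4) ≡ a * (q * 8)
                lemma₃ = solve-∀
                lemma₄ : ∀ q n → q * (4 * n) ≡ n * (q * 4)
                lemma₄ = solve-∀
              many-hits : ∀ w → [ many w ] * j ≤ hits lo len w
              many-hits w with hits lo len w ≤? j | hits lo len w ≤ᵇ j in eq
              ... | _      | true  = z≤n
              ... | yes h≤ | false = contradiction (trans (sym (Equivalence.to T-≡ (≤⇒≤ᵇ h≤))) eq) λ ()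
              ... | no  h≰ | false = ≤-trans (≤-reflexive (+-identityʳ j)) (<⇒≤ (≰⇒> h≰))
              markov : ∣ many ∣ * j ≤ window lo len (λ r → ∣ (λ w → bit w r) ∣)
              markov = begin
                ∣ many ∣ * j
                  ≡⟨ sym (∑-*ʳ Ws j _) ⟩
                ∑ Ws (λ w → V w * [ many w ] * j)
                  ≤⟨ ∑-mono Ws (λ w → ≤-trans (≤-reflexive (*-assoc (V w) [ many w ] j)) (*-monoʳ-≤ (V w) (many-hits w))) ⟩
                ∑ Ws (λ w → V w * hits lo len w)
                  ≡⟨ ∑-cong Ws (λ w → sym (window-*ˡ lo len (V w) (λ r → [ bit w r ]))) ⟩
                ∑ Ws (λ w → window lo len (λ r → V w * [ bit w r ]))
                  ≡⟨ sym (window-∑ lo len Ws (λ w r → V w * [ bit w r ])) ⟩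
                window lo len (λ r → ∣ (λ w → bit w r) ∣) ∎

        -- Group B yields the same number by computation, so one list of offsets serves both groups.
        silent : ℕ → ℕ → ℕ
        silent t u = missMass (groupA , t) (groupA , base + u)

        loud : ℕ → ℕ → ℕ
        loud t u = ∣ ev (groupA , t) (groupA , base + u) ∣

        loud-rate : ∀ t u → u < t → rate (t ∸ u) ≤ loud t u
        loud-rate t u u<t = ≤-reflexive (∑-cong Ws (λ w → cong (λ b → V w * [ b ])
          (cong₂ _∧_ {true} (sym (Equivalence.to T-≡ (<⇒<ᵇ (+-monoʳ-< base u<t))))
                     (cong (bit w) (sym ([m+n]∸[m+o]≡n∸o base t u))))))

        -- Over all offsets `0,…,d`, stations are in each of the local rounds `1,…,t` exactly once
        -- at round `base + t`; `t ≤ suc d` makes all the offsets needed available.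
        silent-total : ∀ τ t d → τ ≤ t → t ≤ suc d →
                       ∑ (upTo (suc d)) (silent t) + window 0 τ rate ≤ suc d * N
        silent-total τ t d τ≤t t≤d = begin
          ∑ (upTo (suc d)) (silent t) + window 0 τ rate
            ≤⟨ +-monoʳ-≤ (∑ (upTo (suc d)) (silent t)) (≤-trans (window-mono rate τ≤t)
                 (window-reverse rate t (suc d) (loud t) t≤d (loud-rate t))) ⟩
          ∑ (upTo (suc d)) (silent t) + ∑ (upTo (suc d)) (loud t)
            ≡⟨ sym (∑-distrib-+ (upTo (suc d)) (silent t) (loud t)) ⟩
          ∑ (upTo (suc d)) (λ u → silent t u + loud t u)
            ≡⟨ ∑-cong (upTo (suc d)) (λ u → trans (+-comm (silent t u) (loud t u))
                 (∣∣+∣not∣ (ev (groupA , t) (groupA , base + u)))) ⟩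
          ∑ (upTo (suc d)) (λ _ → N)
            ≡⟨ ∑-const (upTo (suc d)) N ⟩
          length (upTo (suc d)) * N
            ≡⟨ cong (_* N) (length-upTo (suc d)) ⟩
          suc d * N ∎
          where open ≤-Reasoning

        -- Overloading the later rounds with a crowd.

        module _ (f : ℕ → ℕ) (H e n : ℕ) (reliable : Reliable f H e n) (N>0 : 0 < N) (k τ q : ℕ) .{{_ : NonZero q}}
                 (room : τ * B + (q * l + q * l) + 2 ≤ k) (few-guards : 2 * (τ + (f k + f k)) ≤ 2 ^ l)
                 (load : suc (f k) * N ≤ q * window 0 τ rate)
                 (k≤ : k ≤ 2 ^ n) (3≤n : 3 ≤ n) (kb : 2 ^ (e * 3) ≤ k)
                 (late : base + (τ + f k) + f k ≤ H) where

          private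
            open ≤-Reasoning
            d M S X : ℕ
            d = f k
            M = q * l
            -- The minimum keeps the subtraction in `X` exact: for `τ` above `suc d` the rates might
            -- add up to more than `suc d * N`.
            S = window 0 τ rate ⊓ (suc d * N)
            X = suc d * N ∸ S

            J L : List ℕ
            J = map suc (upTo τ)
            L = map (λ s → τ + suc s) (upTo (d ∸ τ))

            length-J : length J ≡ τ
            length-J = trans (length-map suc (upTo τ)) (length-upTo τ)

            length-L : length L ≤ d
            length-L = ≤-trans (≤-reflexive (trans (length-map (λ s → τ + suc s) (upTo (d ∸ τ))) (length-upTo (d ∸ τ)))) (m∸n≤m d τ)

            ∈L : ∀ {t} → t ∈ L → τ ≤ t × t ≤ suc d
            ∈L t∈ with ∈-map⁻ (λ s → τ + suc s) {xs = upTo (d ∸ τ)} t∈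
            ... | s , s∈ , refl = m≤m+n τ _ , m≤n⇒m≤1+n (≤-trans (+-monoʳ-≤ τ (∈-upTo⁻ s∈))
                  (≤-reflexive (m+[n∸m]≡n (<⇒≤ (m∸n≢0⇒n<m {d} {τ} (>⇒≢ (≤-<-trans z≤n (∈-upTo⁻ s∈))))))))

            X-bound : ∀ {t} → t ∈ L → ∑ (upTo (suc d)) (silent t) ≤ X
            X-bound {t} t∈ = m+n≤o⇒m≤o∸n _ (≤-trans (+-monoʳ-≤ (∑ (upTo (suc d)) (silent t)) (m⊓n≤m (window 0 τ rate) (suc d * N)))
              (silent-total τ t d (proj₁ (∈L t∈)) (proj₂ (∈L t∈))))

            X+S : X + S ≡ suc d * N
            X+S = m∸n+n≡m (m⊓n≤n (window 0 τ rate) (suc d * N))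

            X-decay : X ^ M * 2 ^ l ≤ (suc d * N) ^ M
            X-decay = subst (λ z → X ^ M * 2 ^ l ≤ z ^ M) X+S (power-decay X S q l (≤-trans (≤-reflexive X+S) (≤-trans
              (⊓-glb load (m≤n*m (suc d * N) q)) (≤-reflexive (sym (*-distribˡ-⊓ q (window 0 τ rate) (suc d * N)))))))

            module Crowd (us : List ℕ) (length-us : length us ≡ M) (us≤ : ∀ {u} → u ∈ us → u ≤ d)
                         (bound : ∑ L (λ t → ∏ us (silent t)) * suc d ^ M ≤ length L * X ^ M) where

              misses : ∑ L (λ t → ∏ us (silent t)) * 2 ^ l ≤ length L * N ^ M
              misses = *-cancelʳ-≤ _ _ (suc d ^ M) {{m^n≢0 (suc d) M}} (begin
                Φ * 2 ^ l * suc d ^ M           ≡⟨ lemma₁ Φ (2 ^ l) (suc d ^ M) ⟩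
                Φ * suc d ^ M * 2 ^ l           ≤⟨ *-monoˡ-≤ (2 ^ l) bound ⟩
                length L * X ^ M * 2 ^ l        ≡⟨ *-assoc (length L) (X ^ M) (2 ^ l) ⟩
                length L * (X ^ M * 2 ^ l)      ≤⟨ *-monoʳ-≤ (length L) X-decay ⟩
                length L * (suc d * N) ^ M      ≡⟨ cong (length L *_) (^-distribʳ-* M (suc d) N) ⟩
                length L * (suc d ^ M * N ^ M)  ≡⟨ lemma₂ (length L) (suc d ^ M) (N ^ M) ⟩
                length L * N ^ M * suc d ^ M    ∎)
                where
                Φ : ℕ
                Φ = ∑ L (λ t → ∏ us (silent t))
                lemma₁ : ∀ a b c → a * b * c ≡ a * c * b
                lemma₁ = solve-∀
                lemma₂ : ∀ a b c → a * (b * c) ≡ a * c * b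
                lemma₂ = solve-∀

              group : Label → List Station
              group ℓ = map (λ u → ℓ , base + u) us

              length-group : ∀ ℓ → length (group ℓ) ≡ M
              length-group ℓ = trans (length-map _ us) length-us

              groups st : List Station
              groups = group groupA ++ group groupB
              st     = jams J ++ groups

              length-groups : length groups ≡ M + M
              length-groups = trans (length-++ (group groupA)) (cong₂ _+_ (length-group groupA) (length-group groupB))

              length-st : length st ≡ τ * B + (M + M)
              length-st = trans (length-++ (jams J)) (cong₂ _+_
                (trans (length-jams J) (cong (_* B) length-J)) length-groups)

              group-guards : Label → List Guard
              group-guards ℓ = map (ℓ ,_) L

              Γ : List Guard
              Γ = jam-guards J ++ (group-guards groupA ++ group-guards groupB)

              ∏-group : ∀ ℓ t → (∀ u → missMass (ℓ , t) (ℓ , base + u) ≡ silent t u) →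
                        ∏ (group ℓ) (missMass (ℓ , t)) ≡ ∏ us (silent t)
              ∏-group ℓ t eq = trans (∏-map (λ u → ℓ , base + u) us (missMass (ℓ , t)))
                (≤-antisym (∏-mono us (λ u → ≤-reflexive (eq u))) (∏-mono us (λ u → ≤-reflexive (sym (eq u)))))

              group-misses : ∀ ℓ → (∀ t → ∏ st (missMass (ℓ , t)) ≤ ∏ us (silent t) * N ^ (τ * B + M)) →
                             ∑ (group-guards ℓ) (λ γ → ∏ st (missMass γ)) * 2 ^ l ≤ d * N ^ length st
              group-misses ℓ h = begin
                ∑ (group-guards ℓ) (λ γ → ∏ st (missMass γ)) * 2 ^ l
                  ≡⟨ cong (_* 2 ^ l) (∑-map (ℓ ,_) L (λ γ → ∏ st (missMass γ))) ⟩
                ∑ L (λ t → ∏ st (missMass (ℓ , t))) * 2 ^ l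
                  ≤⟨ *-monoˡ-≤ (2 ^ l) (∑-mono L h) ⟩
                ∑ L (λ t → ∏ us (silent t) * R) * 2 ^ l
                  ≡⟨ cong (_* 2 ^ l) (∑-*ʳ L R (λ t → ∏ us (silent t))) ⟩
                ∑ L (λ t → ∏ us (silent t)) * R * 2 ^ l
                  ≡⟨ lemma₁ (∑ L (λ t → ∏ us (silent t))) R (2 ^ l) ⟩
                ∑ L (λ t → ∏ us (silent t)) * 2 ^ l * R
                  ≤⟨ *-monoˡ-≤ R misses ⟩
                length L * N ^ M * R
                  ≤⟨ *-monoˡ-≤ R (*-monoˡ-≤ (N ^ M) length-L) ⟩
                d * N ^ M * R
                  ≡⟨ *-assoc d (N ^ M) R ⟩
                d * (N ^ M * R)
                  ≡⟨ cong (d *_) (trans (sym (^-distribˡ-+-* N M (τ * B + M))) (cong (N ^_) (trans (lemma₂ M (τ * B)) (sym length-st)))) ⟩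
                d * N ^ length st ∎
                where
                R : ℕ
                R = N ^ (τ * B + M)
                lemma₁ : ∀ a b c → a * b * c ≡ a * c * b
                lemma₁ = solve-∀
                lemma₂ : ∀ a b → a + (b + a) ≡ b + (a + a)
                lemma₂ = solve-∀

              ∏-st : ∀ γ → ∏ st (missMass γ) ≤
                     N ^ (τ * B) * (∏ (group groupA) (missMass γ) * ∏ (group groupB) (missMass γ))
              ∏-st γ = begin
                ∏ st (missMass γ)
                  ≡⟨ ∏-++ (jams J) groups (missMass γ) ⟩
                ∏ (jams J) (missMass γ) * ∏ groups (missMass γ)
                  ≤⟨ *-mono-≤ (subst (λ z → ∏ (jams J) (missMass γ) ≤ N ^ z) (trans (length-jams J) (cong (_* B) length-J)) (∏≤ γ (jams J)))
                              (≤-reflexive (∏-++ (group groupA) (group groupB) (missMass γ))) ⟩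
                N ^ (τ * B) * (∏ (group groupA) (missMass γ) * ∏ (group groupB) (missMass γ)) ∎

              ∏-group≤ : ∀ ℓ γ → ∏ (group ℓ) (missMass γ) ≤ N ^ M
              ∏-group≤ ℓ γ = subst (λ z → ∏ (group ℓ) (missMass γ) ≤ N ^ z) (length-group ℓ) (∏≤ γ (group ℓ))

              A-misses : ∀ t → ∏ st (missMass (groupA , t)) ≤ ∏ us (silent t) * N ^ (τ * B + M)
              A-misses t = begin
                ∏ st (missMass (groupA , t))
                  ≤⟨ ∏-st (groupA , t) ⟩
                N ^ (τ * B) * (∏ (group groupA) (missMass (groupA , t)) * ∏ (group groupB) (missMass (groupA , t)))
                  ≤⟨ *-monoʳ-≤ (N ^ (τ * B)) (*-mono-≤ (≤-reflexive (∏-group groupA t (λ u → refl))) (∏-group≤ groupB (groupA , t))) ⟩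
                N ^ (τ * B) * (∏ us (silent t) * N ^ M)
                  ≡⟨ lemma (N ^ (τ * B)) (∏ us (silent t)) (N ^ M) ⟩
                ∏ us (silent t) * (N ^ (τ * B) * N ^ M)
                  ≡⟨ cong (∏ us (silent t) *_) (sym (^-distribˡ-+-* N (τ * B) M)) ⟩
                ∏ us (silent t) * N ^ (τ * B + M) ∎
                where
                lemma : ∀ a b c → a * (b * c) ≡ b * (a * c)
                lemma = solve-∀

              B-misses : ∀ t → ∏ st (missMass (groupB , t)) ≤ ∏ us (silent t) * N ^ (τ * B + M)
              B-misses t = begin
                ∏ st (missMass (groupB , t))
                  ≤⟨ ∏-st (groupB , t) ⟩
                N ^ (τ * B) * (∏ (group groupA) (missMass (groupB , t)) * ∏ (group groupB) (missMass (groupB , t)))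
                  ≤⟨ *-monoʳ-≤ (N ^ (τ * B)) (*-mono-≤ (∏-group≤ groupA (groupB , t)) (≤-reflexive (∏-group groupB t (λ u → refl)))) ⟩
                N ^ (τ * B) * (N ^ M * ∏ us (silent t))
                  ≡⟨ lemma (N ^ (τ * B)) (∏ us (silent t)) (N ^ M) ⟩
                ∏ us (silent t) * (N ^ (τ * B) * N ^ M)
                  ≡⟨ cong (∏ us (silent t) *_) (sym (^-distribˡ-+-* N (τ * B) M)) ⟩
                ∏ us (silent t) * N ^ (τ * B + M) ∎
                where
                lemma : ∀ a b c → a * (c * b) ≡ b * (a * c)
                lemma = solve-∀

              small : 2 * ∑ Γ (λ γ → ∏ st (missMass γ)) ≤ N ^ length st
              small = *-cancelʳ-≤ _ _ (2 ^ l) {{m^n≢0 2 l}} (begin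
                2 * ∑ Γ miss∏ * 2 ^ l
                  ≡⟨ cong (λ z → 2 * z * 2 ^ l) (trans (∑-++ (jam-guards J) _ miss∏)
                       (cong (∑ (jam-guards J) miss∏ +_) (∑-++ (group-guards groupA) (group-guards groupB) miss∏))) ⟩
                2 * (a + (b + c)) * 2 ^ l
                  ≡⟨ lemma₁ a b c (2 ^ l) ⟩
                2 * (a * 2 ^ l + (b * 2 ^ l + c * 2 ^ l))
                  ≤⟨ *-monoʳ-≤ 2 (+-mono-≤ (≤-trans (misses-jam J groups) (≤-reflexive (cong (_* P) length-J)))
                       (+-mono-≤ (group-misses groupA A-misses) (group-misses groupB B-misses))) ⟩
                2 * (τ * P + (d * P + d * P))
                  ≡⟨ lemma₂ τ d P ⟩
                2 * (τ + (d + d)) * P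
                  ≤⟨ *-monoˡ-≤ P few-guards ⟩
                2 ^ l * P
                  ≡⟨ *-comm (2 ^ l) P ⟩
                P * 2 ^ l ∎)
                where
                miss∏ : Guard → ℕ
                miss∏ γ = ∏ st (missMass γ)
                P a b c : ℕ
                P = N ^ length st
                a = ∑ (jam-guards J) miss∏
                b = ∑ (group-guards groupA) miss∏
                c = ∑ (group-guards groupB) miss∏
                lemma₁ : ∀ a b c x → 2 * (a + (b + c)) * x ≡ 2 * (a * x + (b * x + c * x))
                lemma₁ = solve-∀
                lemma₂ : ∀ a b x → 2 * (a * x + (b * x + b * x)) ≡ 2 * (a + (b + b)) * x
                lemma₂ = solve-∀

              all-guarded : ∀ t → 0 < t → t ≤ d → Guarded Γ t
              all-guarded (suc t) 0<t t≤d with suc t ≤? τ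
              ... | yes t<τ = inj₁ (∈-++⁺ˡ (∈-map⁺ (jammer ,_) (∈-map⁺ suc (∈-upTo⁺ t<τ))))
              ... | no  t≮τ = inj₂ (∈-++⁺ʳ (jam-guards J) (∈-++⁺ˡ (∈-map⁺ (groupA ,_) t∈L)) ,
                                    ∈-++⁺ʳ (jam-guards J) (∈-++⁺ʳ (group-guards groupA) (∈-map⁺ (groupB ,_) t∈L)))
                where
                τ≤t : τ ≤ t
                τ≤t = ≤-pred (≰⇒> t≮τ)
                t∈L : suc t ∈ L
                t∈L = subst (_∈ L) (trans (+-suc τ (t ∸ τ)) (cong suc (m+[n∸m]≡n τ≤t)))
                  (∈-map⁺ (λ s → τ + suc s) (∈-upTo⁺ (∸-monoˡ-< t≤d τ≤t)))

              in-group : ∀ {ℓ u} → (ℓ , u) ∈ groups → ∃[ v ] v ∈ us × u ≡ base + v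
              in-group s∈ with ∈-++⁻ (group groupA) s∈
              ... | inj₁ s∈A with ∈-map⁻ _ s∈A
              ...   | v , v∈ , refl = v , v∈ , refl
              in-group s∈ | inj₂ s∈B with ∈-map⁻ _ s∈B
              ...   | v , v∈ , refl = v , v∈ , refl

              separated : Separated Γ st d
              separated s∈ g with ∈-++⁻ (jams J) s∈
              separated s∈ g | inj₁ s∈J with ∈-jams J s∈J
              separated s∈ () | inj₁ s∈J | refl , _
              separated s∈ g | inj₂ s∈G with in-group s∈G
              ... | v , v∈ , refl = m≤m+n base v , all-guarded

              wakes-early : ∀ {ℓ u} → (ℓ , u) ∈ st → u + d ≤ H
              wakes-early s∈ with ∈-++⁻ (jams J) s∈
              wakes-early s∈ | inj₁ s∈J with ∈-jams J s∈J
              ... | _ , t , t∈ , refl with ∈-map⁻ suc t∈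
              ...   | s , s∈τ , refl = ≤-trans (+-monoˡ-≤ d (≤-trans (m∸n≤m (base + suc s) (suc r₀))
                        (+-monoʳ-≤ base (≤-trans (∈-upTo⁻ s∈τ) (m≤m+n τ d))))) late
              wakes-early s∈ | inj₂ s∈G with in-group s∈G
              ... | v , v∈ , refl = ≤-trans (+-monoˡ-≤ d (+-monoʳ-≤ base
                        (≤-trans (us≤ v∈) (m≤n+m d τ)))) late

              -- Every draw of the target is attacked, so `b = 3` gives `N * 8 ≤ 4 * N`.
              collapse : ⊥
              collapse = <⇒≱ (*-monoʳ-< N {{>-nonZero N>0}} (s≤s (s≤s (s≤s (s≤s (s≤s z≤n))))))
                (≤-trans (≤-reflexive (cong (_* 8) (∑-cong Ws (λ w → sym (*-identityʳ (V w))))))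
                (≤-trans (attack f H e n reliable N>0 Γ st (λ _ → true) k 3
                            (subst (λ z → z + 2 ≤ k) (sym length-st) room) k≤ 3≤n kb
                            (≤-trans (+-monoˡ-≤ d (m≤m+n base _)) late) wakes-early separated
                            (λ ξ _ t 0<t t≤d _ → all-guarded t 0<t t≤d) small)
                         (≤-reflexive (*-comm 4 N))))

          overload : ⊥
          overload with greedy silent L d X X-bound M
          ... | us , length-us , us≤ , bound = Crowd.collapse us length-us us≤ bound

    module _ (f : ℕ → ℕ) (H e n : ℕ) (reliable : Reliable f H e n) (N>0 : 0 < N) where

      -- A target silent throughout its latency fails even if all others are idle. With
      -- `2 ^ (e * 3)` stations this has probability at most 4/8, so the likeliest of the remaining
      -- first rounds has probability at least `1 / (2 D)`, where `D` is the latency for that many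
      -- stations.
      popular-first : 2 ^ (e * 3) ≤ 2 ^ n → 3 ≤ n → 2 ≤ 2 ^ (e * 3) → f (2 ^ (e * 3)) ≤ H →
                      ∃[ r ] r < f (2 ^ (e * 3)) × N ≤ 2 * f (2 ^ (e * 3)) * ∣ first r ∣
      popular-first k≤ 3≤n 2≤k D≤H = go (f (2 ^ (e * 3))) mostly-loud
        where
        target : ∀ ξ → quiet (f (2 ^ (e * 3))) ξ ≡ true → ∀ t → 0 < t → t ≤ f (2 ^ (e * 3)) →
                 bit ξ t ≡ true → Play.Guarded 0 0 [] t
        target ξ q t 0<t t≤ b = contradiction b (quiet⇒silent (f (2 ^ (e * 3))) ξ q t 0<t t≤)

        mostly-loud : ∣ quiet (f (2 ^ (e * 3))) ∣ * 2 ≤ N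
        mostly-loud = *-cancelʳ-≤ _ _ 4 (≤-trans (≤-reflexive (lemma ∣ quiet (f (2 ^ (e * 3))) ∣))
          (≤-trans (Play.attack 0 0 f H e n reliable N>0 [] [] (quiet (f (2 ^ (e * 3)))) (2 ^ (e * 3)) 3 2≤k k≤ 3≤n
                      ≤-refl D≤H (λ ()) (λ ()) target z≤n)
                   (≤-reflexive (*-comm 4 N))))
          where
          lemma : ∀ a → a * 2 * 4 ≡ a * 8
          lemma = solve-∀

        go : ∀ D → ∣ quiet D ∣ * 2 ≤ N → ∃[ r ] r < D × N ≤ 2 * D * ∣ first r ∣
        go zero    h = contradiction (≤-trans (≤-reflexive (cong (_* 2) (trans (quiet-first 0) (+-identityʳ _)))) h)
          (<⇒≱ (m<m*n N 2 {{>-nonZero N>0}} (s≤s (s≤s z≤n))))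
        go (suc D) h with window-max D (λ r → ∣ first (pred r) ∣)
        ... | r , r≤D , max = r , s≤s r≤D , +-cancelˡ-≤ N N _ (begin
          N + N                                        ≡⟨ lemma₁ N ⟩
          N * 2                                        ≡⟨ cong (_* 2) (quiet-first (suc D)) ⟩
          (q + W) * 2                                  ≡⟨ *-distribʳ-+ 2 q W ⟩
          q * 2 + W * 2                                ≤⟨ +-mono-≤ h (*-monoˡ-≤ 2 max) ⟩
          N + ∣ first r ∣ * suc D * 2                  ≡⟨ lemma₂ N ∣ first r ∣ (suc D) ⟩
          N + 2 * suc D * ∣ first r ∣                  ∎)
          where
          open ≤-Reasoning
          q W : ℕ
          q = ∣ quiet (suc D) ∣
          W = window 0 (suc D) (λ r → ∣ first (pred r) ∣)
          lemma₁ : ∀ a → a + a ≡ a * 2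
          lemma₁ = solve-∀
          lemma₂ : ∀ a b c → a + b * c * 2 ≡ a + 2 * c * b
          lemma₂ = solve-∀

-- Choice of the parameters and the contradiction.

module Params where

  open import Data.Bool.Base using (Bool; not)
  open import Data.Empty using (⊥)
  open import Data.List.Base as List using (List)
  open import Data.Nat.Base
  open import Data.Nat.DivMod
  open import Data.Nat.Properties
  open import Data.Nat.Tactic.RingSolver using (solve-∀)
  open import Data.Product.Base using (∃-syntax; _×_; proj₁; proj₂)
  open import Relation.Binary.PropositionalEquality hiding ([_]; J)
  open import Defs using (RoundSet; n≤2^n)
  open Sums
  open Spaces using (module Space)

  2^-mono : ∀ {a b} → a ≤ b → 2 ^ a ≤ 2 ^ b
  2^-mono = ^-monoʳ-≤ 2

  2^-+ : ∀ a b → 2 ^ (a + b) ≡ 2 ^ a * 2 ^ b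
  2^-+ = ^-distribˡ-+-* 2

  1+n≤2^n : ∀ n → suc n ≤ 2 ^ n
  1+n≤2^n zero    = ≤-refl
  1+n≤2^n (suc n) = +-mono-≤ (m^n>0 2 n) (≤-trans (1+n≤2^n n) (m≤m+n (2 ^ n) 0))

  -- The constants make K S exceed f(K) by a factor of order log K; 48 is the
  -- one relating 2^m to e m j below.
  bound-factor : ℕ → ℕ
  bound-factor e = 64 * (48 * 48) * e

  bound-factor≢0 : ∀ e .{{_ : NonZero e}} → NonZero (bound-factor e)
  bound-factor≢0 e = m*n≢0 (64 * (48 * 48)) e

  -- The growth hypothesis at powers of two, free of reals: `a` is the logarithm of the contention
  -- size and `l` an integer safely below the logarithm of `a`.
  Slow : (f : ℕ → ℕ) (c A : ℕ) → Set
  Slow f c A = ∀ a l → A ≤ a → 1 ≤ l → 2 ^ l + 2 ≤ a → f (2 ^ a) * (l * l) * c ≤ 2 ^ a * a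

  module Parameters (f : ℕ → ℕ) (e A : ℕ) (e>0 : 0 < e) (slow : Slow f (bound-factor e) A) where

    open ≤-Reasoning

    instance
      e≢0 : NonZero e
      e≢0 = >-nonZero e>0

    -- The crowd consists of 2^n stations; the window of scale i, u ≤ i < 2u, ends
    -- at 2^(g (i + 1)) and comes from an instance with 2^(g i + 2m + 2) stations
    -- in which the rounds up to 2^(g i) are jammed by B stations each.  Jamming a
    -- round fails with probability at most 2^(-l).
    D p m n l W H den j u g B Q : ℕ
    D   = f (2 ^ (e * 3))
    p   = 24 * e + (8 * D + (A + 2))
    m   = p + p
    n   = 2 ^ suc m
    l   = 2 ^ suc (suc m)
    W   = 2 ^ (n + suc m)
    H   = D + 4 * W
    den = 12 * e * suc m

    instance
      den≢0 : NonZero den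
      den≢0 = m*n≢0 (12 * e) (suc m) {{m*n≢0 12 e}}

    j = 2 ^ m / den
    u = 2 * e * j
    g = 3 * m + 3
    B = 2 * D * l
    Q = 2 ^ (4 * m + 3)

    p≤m : p ≤ m
    p≤m = m≤m+n p p

    A≤m : A ≤ m
    A≤m = ≤-trans (≤-trans (m≤m+n A 2) (≤-trans (m≤n+m (A + 2) (8 * D)) (m≤n+m _ (24 * e)))) p≤m

    4≤m : 4 ≤ m
    4≤m = +-mono-≤ 2≤p 2≤p
      where
      2≤p : 2 ≤ p
      2≤p = ≤-trans (m≤n+m 2 A) (≤-trans (m≤n+m (A + 2) (8 * D)) (m≤n+m _ (24 * e)))

    8D≤ : 8 * D ≤ 2 ^ m
    8D≤ = ≤-trans (≤-trans (m≤m+n (8 * D) _) (m≤n+m _ (24 * e))) (≤-trans p≤m (n≤2^n m))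

    24e≤p : 24 * e ≤ p
    24e≤p = m≤m+n (24 * e) _

    -- The reason for `m = p + p`: one factor `2 ^ p` absorbs `24 * e`, the other `suc p`.
    den≤ : den ≤ 2 ^ m
    den≤ = begin
      12 * e * suc (p + p)         ≤⟨ m≤m+n _ (12 * e) ⟩
      12 * e * suc (p + p) + 12 * e ≡⟨ lemma e p ⟩
      24 * e * suc p               ≤⟨ *-mono-≤ (≤-trans 24e≤p (n≤2^n p)) (1+n≤2^n p) ⟩
      2 ^ p * 2 ^ p                ≡⟨ sym (2^-+ p p) ⟩
      2 ^ (p + p)                  ∎
      where
      lemma : ∀ e p → 12 * e * (1 + (p + p)) + 12 * e ≡ 24 * e * (1 + p)
      lemma = solve-∀

    1≤j : 1 ≤ j
    1≤j = m≥n⇒m/n>0 den≤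

    j*den≤ : j * den ≤ 2 ^ m
    j*den≤ = m/n*n≤m (2 ^ m) den

    j≤ : j ≤ 2 ^ m
    j≤ = m/n≤m (2 ^ m) den

    -- The 48 is 12 times 2 for the rounding of the quotient, times 2 for `suc m ≤ m + m`.
    2^m≤ : 2 ^ m ≤ 48 * (e * m * j)
    2^m≤ = begin
      2 ^ m                          ≡⟨ m≡m%n+[m/n]*n (2 ^ m) den ⟩
      2 ^ m % den + j * den          ≤⟨ +-mono-≤ (<⇒≤ (m%n<n (2 ^ m) den)) ≤-refl ⟩
      den + j * den                  ≤⟨ +-monoˡ-≤ (j * den) (m≤n*m den j {{>-nonZero 1≤j}}) ⟩
      j * den + j * den              ≤⟨ +-mono-≤ step step ⟩
      j * (12 * e * (m + m)) + j * (12 * e * (m + m)) ≡⟨ lemma j e m ⟩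
      48 * (e * m * j)               ∎
      where
      step : j * den ≤ j * (12 * e * (m + m))
      step = *-monoʳ-≤ j (*-monoʳ-≤ (12 * e) (≤-trans (≤-reflexive (+-comm 1 m)) (+-monoʳ-≤ m (≤-trans (s≤s z≤n) 4≤m))))
      lemma : ∀ j e m → j * (12 * e * (m + m)) + j * (12 * e * (m + m)) ≡ 48 * (e * m * j)
      lemma = solve-∀

    -- Origin of `den`: `g * (u + u)` equals `j * den`, so all scales fit below the crowd size, with
    -- the jamming overhead `2 ^ (2 * m + 2)` to spare.
    top : g * (u + u) + (2 * m + 2) ≤ n
    top = begin
      g * (u + u) + (2 * m + 2)      ≡⟨ lemma m e j ⟩
      j * den + 2 * (suc m)          ≤⟨ +-mono-≤ j*den≤ (≤-trans (*-monoˡ-≤ (suc m) (≤-trans (s≤s (s≤s z≤n)) (m≤m*n 12 e))) den≤) ⟩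
      2 ^ m + 2 ^ m                  ≡⟨ cong (2 ^ m +_) (sym (+-identityʳ (2 ^ m))) ⟩
      n                              ∎
      where
      lemma : ∀ m e j → (3 * m + 3) * (2 * e * j + 2 * e * j) + (2 * m + 2) ≡ j * (12 * e * (1 + m)) + 2 * (1 + m)
      lemma = solve-∀

    l≡n+n : l ≡ n + n
    l≡n+n = cong (n +_) (+-identityʳ n)

    m≤n : m ≤ n
    m≤n = ≤-trans (n≤1+n m) (n≤2^n (suc m))

    4≤n : 4 ≤ n
    4≤n = ≤-trans 4≤m m≤n

    m+5≤n : m + 5 ≤ n
    m+5≤n = begin
      m + 5                ≤⟨ +-mono-≤ (n≤2^n m) (≤-trans (s≤s 4≤m) (1+n≤2^n m)) ⟩
      2 ^ m + 2 ^ m        ≡⟨ cong (2 ^ m +_) (sym (+-identityʳ (2 ^ m))) ⟩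
      n                    ∎

    B≤ : B ≤ 2 ^ (2 * m)
    B≤ = begin
      2 * D * (2 * (2 * 2 ^ m))   ≡⟨ lemma D (2 ^ m) ⟩
      8 * D * 2 ^ m               ≤⟨ *-monoˡ-≤ (2 ^ m) 8D≤ ⟩
      2 ^ m * 2 ^ m               ≡⟨ sym (2^-+ m m) ⟩
      2 ^ (m + m)                 ≡⟨ cong (λ z → 2 ^ (m + z)) (sym (+-identityʳ m)) ⟩
      2 ^ (2 * m)                 ∎
      where
      lemma : ∀ d x → 2 * d * (2 * (2 * x)) ≡ 8 * d * x
      lemma = solve-∀

    -- `Slow` with `l = 1` leaves the crude bound `2 ^ a * a`.
    f≤ : ∀ a → m ≤ a → a ≤ n → f (2 ^ a) ≤ 2 ^ (a + suc m)
    f≤ a m≤a a≤n = begin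
      f (2 ^ a)                             ≡⟨ lemma (f (2 ^ a)) ⟩
      f (2 ^ a) * (1 * 1)                   ≤⟨ m≤m*n _ (bound-factor e) {{bound-factor≢0 e}} ⟩
      f (2 ^ a) * (1 * 1) * bound-factor e  ≤⟨ slow a 1 (≤-trans A≤m m≤a) ≤-refl (≤-trans 4≤m m≤a) ⟩
      2 ^ a * a                             ≤⟨ *-monoʳ-≤ (2 ^ a) a≤n ⟩
      2 ^ a * 2 ^ suc m                     ≡⟨ sym (2^-+ a (suc m)) ⟩
      2 ^ (a + suc m)                       ∎
      where
      lemma : ∀ x → x ≡ x * (1 * 1)
      lemma = solve-∀

    e*3≤m : e * 3 ≤ m
    e*3≤m = ≤-trans (≤-trans (≤-reflexive (*-comm e 3)) (*-monoˡ-≤ e {3} {24} (s≤s (s≤s (s≤s z≤n))))) (≤-trans 24e≤p p≤m)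

    2≤u : 2 ≤ u
    2≤u = *-mono-≤ {2} {2 * e} {1} {j} (*-mono-≤ {2} {2} {1} {e} ≤-refl e>0) 1≤j

    module Scale (i : ℕ) (u≤i : u ≤ i) (i<2u : i < u + u) where

      G a b : ℕ
      G = g * i
      a = G + (2 * m + 2)
      b = (4 * m + 3) * j + 3

      a≤n : a ≤ n
      a≤n = ≤-trans (+-monoˡ-≤ (2 * m + 2) (*-monoʳ-≤ g (<⇒≤ i<2u))) top

      6m+6≤G : 6 * m + 6 ≤ G
      6m+6≤G = ≤-trans (≤-reflexive (lemma m)) (*-monoʳ-≤ g (≤-trans 2≤u u≤i))
        where
        lemma : ∀ m → 6 * m + 6 ≡ (3 * m + 3) * 2
        lemma = solve-∀

      4m+3≤G : 4 * m + 3 ≤ G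
      4m+3≤G = ≤-trans (+-mono-≤ (*-monoˡ-≤ m {4} {6} (s≤s (s≤s (s≤s (s≤s z≤n))))) (s≤s (s≤s (s≤s z≤n)))) 6m+6≤G

      m≤G : m ≤ G
      m≤G = ≤-trans (m≤n*m m 6) (≤-trans (m≤m+n (6 * m) 6) 6m+6≤G)

      m≤a : m ≤ a
      m≤a = ≤-trans m≤G (m≤m+n G _)

      fk≤ : f (2 ^ a) ≤ 2 ^ (a + suc m)
      fk≤ = f≤ a m≤a a≤n

      -- Origin of `g`: `2 * m + 2` bits for the jammers and `suc m` for the latency bound, so a
      -- window ends exactly where the next scale begins.
      next : a + suc m ≡ g * suc i
      next = lemma m i
        where
        lemma : ∀ m i → (3 * m + 3) * i + (2 * m + 2) + (1 + m) ≡ (3 * m + 3) * (1 + i)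
        lemma = solve-∀

      -- Origin of `u`: `2 ^ b` is `8 * Q ^ j`, the price of the union bound over residue vectors,
      -- and only scales from `u` on have enough stations to pay it.
      eb≤a : e * b ≤ a
      eb≤a = begin
        e * ((4 * m + 3) * j + 3)                       ≤⟨ *-monoʳ-≤ e (+-monoʳ-≤ ((4 * m + 3) * j) 3≤) ⟩
        e * ((4 * m + 3) * j + (2 * m + 3) * j)         ≡⟨ lemma e m j ⟩
        g * u                                           ≤⟨ *-monoʳ-≤ g u≤i ⟩
        G                                               ≤⟨ m≤m+n G _ ⟩
        a                                               ∎
        where
        3≤ : 3 ≤ (2 * m + 3) * j
        3≤ = *-mono-≤ {3} {2 * m + 3} {1} {j} (m≤n+m 3 (2 * m)) 1≤j
        lemma : ∀ e m j → e * ((4 * m + 3) * j + (2 * m + 3) * j) ≡ (3 * m + 3) * (2 * e * j)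
        lemma = solve-∀

      b≤n : b ≤ n
      b≤n = ≤-trans (m≤n*m b e) (≤-trans eb≤a a≤n)

      instance
        Q≢0 : NonZero Q
        Q≢0 = m^n≢0 2 (4 * m + 3)

      -- `Q` is chosen such that `j ≤ 2 ^ m` classes contain about as many rounds as the initial
      -- segment of length `2 ^ G`.
      quotient : f (2 ^ a) / Q ≤ 2 ^ (G ∸ m)
      quotient = begin
        f (2 ^ a) / Q                        ≤⟨ /-monoˡ-≤ Q fk≤ ⟩
        2 ^ (a + suc m) / Q                  ≡⟨ cong (λ z → 2 ^ z / Q) exponent ⟩
        2 ^ (G ∸ m + (4 * m + 3)) / Q        ≡⟨ cong (_/ Q) (2^-+ (G ∸ m) (4 * m + 3)) ⟩
        2 ^ (G ∸ m) * Q / Q                  ≡⟨ m*n/n≡m (2 ^ (G ∸ m)) Q ⟩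
        2 ^ (G ∸ m)                          ∎
        where
        lemma : ∀ x m → x + m + (2 * m + 2) + (1 + m) ≡ x + (4 * m + 3)
        lemma = solve-∀
        exponent : a + suc m ≡ G ∸ m + (4 * m + 3)
        exponent = trans (cong (λ z → z + (2 * m + 2) + suc m) (sym (m∸n+n≡m m≤G))) (lemma (G ∸ m) m)

      jammed : ℕ
      jammed = 2 ^ G + j * suc (f (2 ^ a) / Q)

      -- At most `3 * 2 ^ G` rounds are jammed by at most `2 ^ (2 * m)` stations each. The fourth
      -- quarter of `2 ^ a` takes the other two stations.
      room : jammed * B + 2 ≤ 2 ^ a
      room = begin
        jammed * B + 2
          ≤⟨ +-monoˡ-≤ 2 (*-mono-≤ (+-monoʳ-≤ (2 ^ G) (*-mono-≤ j≤ (s≤s quotient))) B≤) ⟩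
        (2 ^ G + 2 ^ m * suc (2 ^ (G ∸ m))) * 2 ^ (2 * m) + 2
          ≡⟨ cong (λ z → z * 2 ^ (2 * m) + 2) (trans (cong (2 ^ G +_) (*-suc (2 ^ m) _))
               (cong (λ z → 2 ^ G + (2 ^ m + z)) (trans (sym (2^-+ m (G ∸ m))) (cong (2 ^_) (m+[n∸m]≡n m≤G))))) ⟩
        (2 ^ G + (2 ^ m + 2 ^ G)) * Y + 2
          ≤⟨ +-mono-≤ (*-monoˡ-≤ Y (+-monoʳ-≤ (2 ^ G) (+-monoˡ-≤ (2 ^ G) (2^-mono m≤G)))) 2≤Y ⟩
        (2 ^ G + (2 ^ G + 2 ^ G)) * Y + 2 ^ G * Y
          ≡⟨ lemma (2 ^ G) Y ⟩
        2 ^ G * (Y * 4)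
          ≡⟨ trans (cong (2 ^ G *_) (sym (2^-+ (2 * m) 2))) (sym (2^-+ G (2 * m + 2))) ⟩
        2 ^ a ∎
        where
        Y : ℕ
        Y = 2 ^ (2 * m)
        lemma : ∀ x y → (x + (x + x)) * y + x * y ≡ x * (y * 4)
        lemma = solve-∀
        2≤Y : 2 ≤ 2 ^ G * Y
        2≤Y = ≤-trans (2^-mono {1} (≤-trans (≤-trans (s≤s z≤n) 4≤m) m≤G)) (m≤m*n (2 ^ G) Y {{m^n≢0 2 (2 * m)}})

      few-guards : 0 < D → 2 * jammed ≤ 2 ^ l
      few-guards D>0 = begin
        2 * jammed       ≤⟨ *-monoʳ-≤ 2 (≤-trans (m≤m*n jammed B {{>-nonZero B>0}}) (≤-trans (m≤m+n _ 2) room)) ⟩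
        2 * 2 ^ a        ≤⟨ *-monoʳ-≤ 2 (2^-mono a≤n) ⟩
        2 ^ suc n        ≤⟨ 2^-mono (≤-trans (+-monoˡ-≤ n (≤-trans (s≤s z≤n) 4≤n)) (≤-reflexive (sym l≡n+n))) ⟩
        2 ^ l            ∎
        where
        B>0 : 0 < B
        B>0 = *-mono-< {0} {2 * D} {0} {l} (*-mono-< {0} {2} {0} {D} (s≤s z≤n) D>0) (m^n>0 2 (suc (suc m)))

      late : D + (2 ^ G + (Q + f (2 ^ a))) + f (2 ^ a) ≤ H
      late = begin
        D + (2 ^ G + (Q + f (2 ^ a))) + f (2 ^ a)   ≤⟨ +-mono-≤ (+-monoʳ-≤ D (+-mono-≤ (2^-mono G≤) (+-mono-≤ (2^-mono (≤-trans 4m+3≤G G≤)) f≤W))) f≤W ⟩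
        D + (W + (W + W)) + W                       ≡⟨ lemma D W ⟩
        H                                           ∎
        where
        lemma : ∀ d w → d + (w + (w + w)) + w ≡ d + 4 * w
        lemma = solve-∀
        G≤ : G ≤ n + suc m
        G≤ = ≤-trans (≤-trans (m≤m+n G _) a≤n) (m≤m+n n _)
        f≤W : f (2 ^ a) ≤ W
        f≤W = ≤-trans fk≤ (2^-mono (+-monoˡ-≤ (suc m) a≤n))

    τe : ℕ
    τe = n ∸ (2 * m + 2)

    τe+ : τe + (2 * m + 2) ≡ n
    τe+ = m∸n+n≡m (≤-trans (m≤n+m (2 * m + 2) (g * (u + u))) top)

    module _ {S : Set} (Ws : List S) (V : S → ℕ) (bit : S → RoundSet) where

      private
        N : ℕ
        N = Space.N Ws V bit

        rate : ℕ → ℕ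
        rate = Space.rate Ws V bit

        loud quiet : ℕ → ℕ
        loud r  = Space.∣_∣ Ws V bit (Space.first Ws V bit r)
        quiet r = Space.∣_∣ Ws V bit (λ w → not (Space.first Ws V bit r w))

      module _ (reliable : Space.Reliable Ws V bit f H e n) (N>0 : 0 < N) where

        private
          popular : ∃[ r ] r < D × N ≤ 2 * D * loud r
          popular = Space.popular-first Ws V bit f H e n reliable N>0
            (2^-mono (≤-trans e*3≤m m≤n)) (≤-trans (s≤s (s≤s (s≤s z≤n))) 4≤n)
            (2^-mono {1} (*-mono-≤ {1} {e} {1} {3} e>0 (s≤s z≤n))) (m≤m+n D (4 * W))

          r₀ : ℕ
          r₀ = proj₁ popular

          r₀<D : r₀ < D
          r₀<D = proj₁ (proj₂ popular)

          D>0 : 0 < D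
          D>0 = ≤-<-trans z≤n r₀<D

          -- A jammer hits with probability at least `1 / (2 D)`, so `l` halvings take `2 * D * l`
          -- jammers.
          B-jam : quiet r₀ ^ B * 2 ^ l ≤ N ^ B
          B-jam = subst (λ z → quiet r₀ ^ B * 2 ^ l ≤ z ^ B) c+b
            (power-decay (quiet r₀) (loud r₀) (2 * D) l {{m*n≢0 2 D {{_}} {{>-nonZero D>0}}}}
              (subst (_≤ 2 * D * loud r₀) (sym c+b) (proj₂ (proj₂ popular))))
            where
            c+b : quiet r₀ + loud r₀ ≡ N
            c+b = trans (+-comm (quiet r₀) (loud r₀)) (Space.∣∣+∣not∣ Ws V bit (Space.first Ws V bit r₀))

        scale-step : ∀ i → u ≤ i → i < u + u →
          2 * window 0 (2 ^ (g * i)) rate + j * N ≤ 2 * window 0 (2 ^ (g * suc i)) rate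
        scale-step i u≤i i<2u = begin
          2 * window 0 lo rate + j * N
            ≤⟨ +-monoʳ-≤ (2 * window 0 lo rate) (Space.Play.Jammers.Residues.expected-hits Ws V bit r₀ D B l r₀<D B-jam Q f H e n reliable N>0 lo len (2 ^ a) b j
                 room (few-guards D>0) (≤-trans fk≤ (≤-reflexive hi)) (2^-mono a≤n) b≤n (2^-mono eb≤a) late Qj≤) ⟩
          2 * window 0 lo rate + 2 * window lo len rate
            ≡⟨ sym (*-distribˡ-+ 2 (window 0 lo rate) (window lo len rate)) ⟩
          2 * (window 0 lo rate + window lo len rate)
            ≡⟨ cong (2 *_) (sym (window-split lo len rate)) ⟩
          2 * window 0 (lo + len) rate
            ≡⟨ cong (λ z → 2 * window 0 z rate) (trans (sym hi) (cong (2 ^_) next)) ⟩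
          2 * window 0 (2 ^ (g * suc i)) rate ∎
          where
          open Scale i u≤i i<2u
          lo len : ℕ
          lo  = 2 ^ G
          len = 2 ^ (a + suc m) ∸ lo
          hi : 2 ^ (a + suc m) ≡ lo + len
          hi = sym (m+[n∸m]≡n (2^-mono (≤-trans (m≤m+n G _) (m≤m+n a _))))
          Qj≤ : Q ^ j * 8 ≤ 2 ^ b
          Qj≤ = ≤-reflexive (trans (cong (_* 8) (^-*-assoc 2 (4 * m + 3) j)) (sym (2^-+ ((4 * m + 3) * j) 3)))

        scales : ∀ v → v ≤ u → v * (j * N) ≤ 2 * window 0 (2 ^ (g * (u + v))) rate
        scales zero    v≤u = z≤n
        scales (suc v) v<u = begin
          j * N + v * (j * N)                                ≤⟨ +-monoʳ-≤ (j * N) (scales v (<⇒≤ v<u)) ⟩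
          j * N + 2 * window 0 (2 ^ (g * (u + v))) rate      ≡⟨ +-comm (j * N) _ ⟩
          2 * window 0 (2 ^ (g * (u + v))) rate + j * N      ≤⟨ scale-step (u + v) (m≤m+n u v) (+-monoʳ-< u v<u) ⟩
          2 * window 0 (2 ^ (g * suc (u + v))) rate          ≡⟨ cong (λ z → 2 * window 0 (2 ^ (g * z)) rate) (sym (+-suc u v)) ⟩
          2 * window 0 (2 ^ (g * (u + suc v))) rate          ∎

        -- There are `u` windows with at least `j / 2` expected transmissions each, and `u * j / 2`
        -- is `e * (j * j)`.
        total-rate : e * (j * j) * N ≤ window 0 (2 ^ τe) rate
        total-rate = *-cancelˡ-≤ 2 (begin
          2 * (e * (j * j) * N)                    ≡⟨ lemma e j N ⟩
          u * (j * N)                              ≤⟨ scales u ≤-refl ⟩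
          2 * window 0 (2 ^ (g * (u + u))) rate    ≤⟨ *-monoʳ-≤ 2 (window-mono rate {2 ^ (g * (u + u))} {2 ^ τe}
                                                    (2^-mono (m+n≤o⇒m≤o∸n (g * (u + u)) {2 * m + 2} {n} top))) ⟩
          2 * window 0 (2 ^ τe) rate               ∎)
          where
          lemma : ∀ e j n → 2 * (e * (j * j) * n) ≡ 2 * e * j * (j * n)
          lemma = solve-∀

        F q τ : ℕ
        F = f (2 ^ n)
        q = 2 ^ (n ∸ (m + 4))
        τ = 2 ^ τe

        instance
          q≢0 : NonZero q
          q≢0 = m^n≢0 2 (n ∸ (m + 4))

        F≤W : F ≤ W
        F≤W = f≤ n m≤n ≤-refl

        -- Each group is a quarter of the stations. Jammers take at most another quarter, and the
        -- last one leaves room for the target and an idle station.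
        q*l : q * l * 4 ≡ 2 ^ n
        q*l = trans (cong (_* 4) (sym (2^-+ (n ∸ (m + 4)) (2 + m)))) (trans (sym (2^-+ (n ∸ (m + 4) + (2 + m)) 2))
          (cong (2 ^_) (trans (lemma (n ∸ (m + 4)) m) (m∸n+n≡m (≤-trans (+-monoʳ-≤ m (n≤1+n 4)) m+5≤n)))))
          where
          lemma : ∀ x m → x + (2 + m) + 2 ≡ x + (m + 4)
          lemma = solve-∀

        τB : τ * B * 4 ≤ 2 ^ n
        τB = begin
          τ * B * 4                    ≤⟨ *-monoˡ-≤ 4 (*-monoʳ-≤ τ B≤) ⟩
          2 ^ τe * 2 ^ (2 * m) * 4     ≡⟨ *-assoc (2 ^ τe) (2 ^ (2 * m)) 4 ⟩
          2 ^ τe * (2 ^ (2 * m) * 4)   ≡⟨ cong (2 ^ τe *_) (sym (2^-+ (2 * m) 2)) ⟩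
          2 ^ τe * 2 ^ (2 * m + 2)     ≡⟨ sym (2^-+ τe (2 * m + 2)) ⟩
          2 ^ (τe + (2 * m + 2))       ≡⟨ cong (2 ^_) τe+ ⟩
          2 ^ n                        ∎

        room : τ * B + (q * l + q * l) + 2 ≤ 2 ^ n
        room = *-cancelʳ-≤ _ _ 4 (begin
          (τ * B + (q * l + q * l) + 2) * 4                 ≡⟨ lemma₁ (τ * B) (q * l) ⟩
          τ * B * 4 + (q * l * 4 + q * l * 4) + 8           ≤⟨ +-mono-≤ (+-mono-≤ τB (+-mono-≤ (≤-reflexive q*l) (≤-reflexive q*l))) (2^-mono {3} (≤-trans (n≤1+n 3) 4≤n)) ⟩
          2 ^ n + (2 ^ n + 2 ^ n) + 2 ^ n                   ≡⟨ lemma₂ (2 ^ n) ⟩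
          2 ^ n * 4                                         ∎)
          where
          lemma₁ : ∀ a b → (a + (b + b) + 2) * 4 ≡ a * 4 + (b * 4 + b * 4) + 8
          lemma₁ = solve-∀
          lemma₂ : ∀ a → a + (a + a) + a ≡ a * 4
          lemma₂ = solve-∀

        τ≤W : τ ≤ W
        τ≤W = 2^-mono {τe} (≤-trans (m∸n≤m n (2 * m + 2)) (m≤m+n n (suc m)))

        -- Origin of `l`: twice the number of guards stays below `8 * W`, hence below `2 ^ (n + n)`.
        few-guards : 2 * (τ + (F + F)) ≤ 2 ^ l
        few-guards = begin
          2 * (τ + (F + F))       ≤⟨ *-monoʳ-≤ 2 (+-mono-≤ τ≤W (+-mono-≤ F≤W F≤W)) ⟩
          2 * (W + (W + W))       ≤⟨ m≤m+n _ (2 * W) ⟩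
          2 * (W + (W + W)) + 2 * W ≡⟨ lemma₁ W ⟩
          W * 8                   ≡⟨ sym (2^-+ (n + suc m) 3) ⟩
          2 ^ (n + suc m + 3)     ≤⟨ 2^-mono (≤-trans (≤-reflexive (lemma₂ n m)) (≤-trans (+-monoʳ-≤ n (≤-trans (+-monoʳ-≤ m (n≤1+n 4)) m+5≤n)) (≤-reflexive (sym l≡n+n)))) ⟩
          2 ^ l                   ∎
          where
          lemma₁ : ∀ w → 2 * (w + (w + w)) + 2 * w ≡ w * 8
          lemma₁ = solve-∀
          lemma₂ : ∀ n m → n + (1 + m) + 3 ≡ n + (m + 4)
          lemma₂ = solve-∀

        -- Here `Slow` is used in full, with `l = m` just below the logarithm `suc m` of `n`.
        F-bound : F * (m * m) * bound-factor e ≤ q * 2 ^ (m + 5 + m)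
        F-bound = begin
          F * (m * m) * bound-factor e         ≤⟨ slow n m (≤-trans A≤m m≤n) (≤-trans (s≤s z≤n) 4≤m) 2^m+2≤n ⟩
          2 ^ n * n                            ≡⟨ sym (2^-+ n (suc m)) ⟩
          2 ^ (n + suc m)                      ≡⟨ cong (λ z → 2 ^ (z + suc m)) (sym (m∸n+n≡m (≤-trans (+-monoʳ-≤ m (n≤1+n 4)) m+5≤n))) ⟩
          2 ^ (n ∸ (m + 4) + (m + 4) + suc m)  ≡⟨ cong (2 ^_) (lemma (n ∸ (m + 4)) m) ⟩
          2 ^ (n ∸ (m + 4) + (m + 5 + m))      ≡⟨ 2^-+ (n ∸ (m + 4)) (m + 5 + m) ⟩
          q * 2 ^ (m + 5 + m)                  ∎
          where
          lemma : ∀ x m → x + (m + 4) + (1 + m) ≡ x + (m + 5 + m)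
          lemma = solve-∀
          2^m+2≤n : 2 ^ m + 2 ≤ n
          2^m+2≤n = +-monoʳ-≤ (2 ^ m) (≤-trans (2^-mono {1} (≤-trans (s≤s z≤n) 4≤m)) (m≤m+n (2 ^ m) 0))

        -- Here `bound-factor` is spent: 48 enters twice through `2^m≤`, and 64 is `2 * 32`.
        -- Doubling `F` pays for the successor in `1+F≤`.
        2F≤ : 2 * F ≤ q * (e * (j * j))
        2F≤ = *-cancelʳ-≤ _ _ (m * m * bound-factor e) {{m*n≢0 (m * m) (bound-factor e) {{m*n≢0 m m {{m≢0}} {{m≢0}}}} {{bound-factor≢0 e}}}} (begin
          2 * F * (m * m * bound-factor e)              ≡⟨ lemma₁ F (m * m) (bound-factor e) ⟩
          2 * (F * (m * m) * bound-factor e)            ≤⟨ *-monoʳ-≤ 2 F-bound ⟩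
          2 * (q * 2 ^ (m + 5 + m))                     ≡⟨ cong (λ z → 2 * (q * z)) (trans (2^-+ (m + 5) m) (cong (_* 2 ^ m) (2^-+ m 5))) ⟩
          2 * (q * (2 ^ m * 32 * 2 ^ m))                ≡⟨ lemma₂ q (2 ^ m) ⟩
          q * 64 * (2 ^ m * 2 ^ m)                      ≤⟨ *-monoʳ-≤ (q * 64) (*-mono-≤ 2^m≤ 2^m≤) ⟩
          q * 64 * (48 * (e * m * j) * (48 * (e * m * j))) ≡⟨ lemma₃ 64 48 q e m j ⟩
          q * (e * (j * j)) * (m * m * bound-factor e)  ∎)
          where
          m≢0 : NonZero m
          m≢0 = >-nonZero (≤-trans (s≤s z≤n) 4≤m)
          lemma₁ : ∀ f m b → 2 * f * (m * b) ≡ 2 * (f * m * b)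
          lemma₁ = solve-∀
          lemma₂ : ∀ q x → 2 * (q * (x * 32 * x)) ≡ q * 64 * (x * x)
          lemma₂ = solve-∀
          lemma₃ : ∀ s c q e m j → q * s * (c * (e * m * j) * (c * (e * m * j)))
                                 ≡ q * (e * (j * j)) * (m * m * (s * (c * c) * e))
          lemma₃ = solve-∀

        1+F≤ : suc F ≤ q * (e * (j * j))
        1+F≤ = go F 2F≤
          where
          go : ∀ x → 2 * x ≤ q * (e * (j * j)) → suc x ≤ q * (e * (j * j))
          go zero    _ = *-mono-≤ {1} {q} {1} {e * (j * j)} (>-nonZero⁻¹ q) (*-mono-≤ {1} {e} {1} {j * j} e>0 (*-mono-≤ {1} {j} {1} {j} 1≤j 1≤j))
          go (suc x) h = ≤-trans (≤-trans (≤-reflexive (+-comm 1 (suc x))) (+-monoʳ-≤ (suc x) (s≤s z≤n))) h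

        contradictory : ⊥
        contradictory = Space.Play.Jammers.overload Ws V bit r₀ D B l r₀<D B-jam f H e n reliable N>0 (2 ^ n) τ q room few-guards
          (≤-trans (*-monoˡ-≤ N 1+F≤) (≤-trans (≤-reflexive (*-assoc q (e * (j * j)) N)) (*-monoʳ-≤ q total-rate)))
          ≤-refl (≤-trans (n≤1+n 3) 4≤n) (2^-mono (≤-trans e*3≤m m≤n))
          (begin
            D + (τ + F) + F      ≤⟨ +-mono-≤ (+-monoʳ-≤ D (+-mono-≤ τ≤W F≤W)) F≤W ⟩
            D + (W + W) + W      ≤⟨ m≤m+n _ W ⟩
            D + (W + W) + W + W  ≡⟨ lemma D W ⟩
            H                    ∎)
          where
          lemma : ∀ d w → d + (w + w) + w + w ≡ d + 4 * w
          lemma = solve-∀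

open import Defs
open import Data.Bool.Base using (Bool; true; false; not)
open import Data.Fin.Base using (Fin)
open import Data.Integer.Base as ℤ using (ℤ; +_; -[1+_]; +[1+_])
import Data.Integer.Properties as ℤ
open import Data.List.Base as List using (List; []; _∷_; filter)
open import Data.Nat.Base as ℕ using (ℕ; zero; suc; pred; NonZero; _^_)
import Data.Nat.Properties as ℕ
open import Data.Nat.Tactic.RingSolver using (solve-∀)
import Data.Integer.Tactic.RingSolver as ℤRing
open import Data.Product.Base using (∃-syntax; Σ-syntax; _×_; _,_; proj₁; proj₂)
open import Data.Rational.Base as ℚ using (ℚ; 0ℚ; 1ℚ; _/_; mkℚ)
import Data.Rational.Properties as ℚ
open import Data.Rational.Unnormalised.Base as ℚᵘ using (mkℚᵘ; *≡*)
import Data.Rational.Unnormalised.Properties as ℚᵘ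
open import Data.Vec.Base as Vec using (Vec; []; _∷_; _∷ʳ_; lookup)
open import Relation.Binary.PropositionalEquality hiding ([_]; J)
open import Relation.Nullary using (¬_; Dec; yes; no; does; contradiction)
open import Relation.Nullary.Decidable.Core using (¬¬-excluded-middle)
open Sums using (∑; [_]; ∑-cong; ∑-vectors; ∑-vectors-const)
open Spaces using (module Space)
open Params using (Slow; bound-factor)

-- Fractions and rational upper bounds of reals.

frac-< : ∀ a b c d .{{_ : NonZero b}} .{{_ : NonZero d}} → a ℕ.* d ℕ.< c ℕ.* b → + a / b ℚ.< + c / d
frac-< a (suc b) c (suc d) h = ℚ.≰⇒> λ le → ℕ.<⇒≱ h (frac-≤⁻¹ c d a b le)

frac-<⁻¹ : ∀ a b c d .{{_ : NonZero b}} .{{_ : NonZero d}} → + a / b ℚ.< + c / d → a ℕ.* d ℕ.< c ℕ.* b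
frac-<⁻¹ a (suc b) c (suc d) h = ℕ.≰⇒> λ le → ℚ.<-irrefl refl (ℚ.<-≤-trans h (frac-≤ c d a b le))

0≤frac : ∀ a b .{{_ : NonZero b}} → 0ℚ ℚ.≤ + a / b
0≤frac a (suc b) = frac-≤ 0 0 a b ℕ.z≤n

frac-+ : ∀ i j b .{{_ : NonZero b}} → i / b ℚ.+ j / b ≡ (i ℤ.+ j) / b
frac-+ i j b@(suc b-1) = ℚ.toℚᵘ-injective (begin
  ℚ.toℚᵘ (i / b ℚ.+ j / b)              ≈⟨ ℚ.toℚᵘ-homo-+ (i / b) (j / b) ⟩
  ℚ.toℚᵘ (i / b) ℚᵘ.+ ℚ.toℚᵘ (j / b)    ≈⟨ ℚᵘ.+-cong (ℚ.toℚᵘ-fromℚᵘ (mkℚᵘ i b-1)) (ℚ.toℚᵘ-fromℚᵘ (mkℚᵘ j b-1)) ⟩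
  mkℚᵘ i b-1 ℚᵘ.+ mkℚᵘ j b-1            ≈⟨ *≡* eq ⟩
  mkℚᵘ (i ℤ.+ j) b-1                    ≈⟨ ℚᵘ.≃-sym (ℚ.toℚᵘ-fromℚᵘ (mkℚᵘ (i ℤ.+ j) b-1)) ⟩
  ℚ.toℚᵘ ((i ℤ.+ j) / b)                ∎)
  where
  open ℚᵘ.≃-Reasoning
  eq : (i ℤ.* + b ℤ.+ j ℤ.* + b) ℤ.* + b ≡ (i ℤ.+ j) ℤ.* + (b ℕ.* b)
  eq = trans (cong (ℤ._* + b) (sym (ℤ.*-distribʳ-+ (+ b) i j)))
    (trans (ℤ.*-assoc (i ℤ.+ j) (+ b) (+ b)) (cong ((i ℤ.+ j) ℤ.*_) (sym (ℤ.pos-* b b))))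

frac-* : ∀ a b c d .{{_ : NonZero b}} .{{_ : NonZero d}} .{{_ : NonZero (b ℕ.* d)}} →
         + a / b ℚ.* (+ c / d) ≡ + (a ℕ.* c) / (b ℕ.* d)
frac-* a b@(suc b-1) c d@(suc d-1) = ℚ.toℚᵘ-injective (begin
  ℚ.toℚᵘ (+ a / b ℚ.* (+ c / d))              ≈⟨ ℚ.toℚᵘ-homo-* (+ a / b) (+ c / d) ⟩
  ℚ.toℚᵘ (+ a / b) ℚᵘ.* ℚ.toℚᵘ (+ c / d)      ≈⟨ ℚᵘ.*-cong (ℚ.toℚᵘ-fromℚᵘ (mkℚᵘ (+ a) b-1)) (ℚ.toℚᵘ-fromℚᵘ (mkℚᵘ (+ c) d-1)) ⟩
  mkℚᵘ (+ a) b-1 ℚᵘ.* mkℚᵘ (+ c) d-1          ≈⟨ *≡* (cong (ℤ._* + (b ℕ.* d)) (sym (ℤ.pos-* a c))) ⟩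
  mkℚᵘ (+ (a ℕ.* c)) (d-1 ℕ.+ b-1 ℕ.* d)      ≈⟨ ℚᵘ.≃-sym (ℚ.toℚᵘ-fromℚᵘ (mkℚᵘ (+ (a ℕ.* c)) (d-1 ℕ.+ b-1 ℕ.* d))) ⟩
  ℚ.toℚᵘ (+ (a ℕ.* c) / (b ℕ.* d))            ∎)
  where open ℚᵘ.≃-Reasoning

infix 4 _≼_

-- Equivalent to `¬ q ∈ x`, but in a positive form that passes directly through sums and products.
_≼_ : ℝ → ℚ → Set
x ≼ q = ∀ p → p ∈ x → p ℚ.< q

≤-∈ : ∀ x {p q} → p ℚ.≤ q → q ∈ x → p ∈ x
≤-∈ x {p} {q} p≤q q∈x with p ℚ.<? q
... | yes p<q = ℝ.lower x p<q q∈x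
... | no  p≮q = subst (_∈ x) (ℚ.≤-antisym (ℚ.≮⇒≥ p≮q) p≤q) q∈x

∉⇒≼ : ∀ x {q} → ¬ q ∈ x → x ≼ q
∉⇒≼ x q∉x p p∈x = ℚ.≰⇒> λ q≤p → q∉x (≤-∈ x q≤p p∈x)

fromℚ-≼ : ∀ q → fromℚ q ≼ q
fromℚ-≼ q p (_ , refl , p<q) = p<q

≼-trans : ∀ {x p q} → x ≼ p → p ℚ.≤ q → x ≼ q
≼-trans x≼p p≤q r r∈x = ℚ.<-≤-trans (x≼p r r∈x) p≤q

+-≼ : ∀ {x y p q} → x ≼ p → y ≼ q → x + y ≼ p ℚ.+ q
+-≼ x≼p y≼q _ (_ , (r , s , r∈x , s∈y , refl) , <r+s) =
  ℚ.<-trans <r+s (ℚ.+-mono-< (x≼p r r∈x) (y≼q s s∈y))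

*-≼ : ∀ {x y p q} → 0ℚ ℚ.≤ p → 0ℚ ℚ.≤ q → x ≼ p → y ≼ q → x * y ≼ p ℚ.* q
*-≼ {x} {y} {p} {q} 0≤p 0≤q x≼p y≼q _ (_ , (r , s , r∈x , s∈y , refl) , <rs) =
  ℚ.<-≤-trans <rs (ℚ.≤-trans
    (ℚ.*-monoˡ-≤-nonNeg (0ℚ ℚ.⊔ r) {{ℚ.nonNegative (ℚ.p≤p⊔q 0ℚ r)}} (ℚ.⊔-lub 0≤q (ℚ.<⇒≤ (y≼q s s∈y))))
    (ℚ.*-monoʳ-≤-nonNeg q {{ℚ.nonNegative 0≤q}} (ℚ.⊔-lub 0≤p (ℚ.<⇒≤ (x≼p r r∈x)))))

∈-* : ∀ {x y p q r} → 0ℚ ℚ.≤ p → 0ℚ ℚ.≤ q → p ∈ x → q ∈ y → r ℚ.< p ℚ.* q → r ∈ x * y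
∈-* {p = p} {q} {r} 0≤p 0≤q p∈x q∈y r<pq = _ , (p , q , p∈x , q∈y , refl) ,
  subst₂ (λ a b → r ℚ.< a ℚ.* b) (sym (ℚ.p≤q⇒p⊔q≡q 0≤p)) (sym (ℚ.p≤q⇒p⊔q≡q 0≤q)) r<pq

-- Rounding the measure to integer weights.

module Approximation (M : ℕ) .{{M≢0 : NonZero M}} where

  -- Says that `a / M` exceeds `x` by less than `c / M`. The count `c` accumulates rounding errors;
  -- integers are needed since `a - c` may be negative.
  Above : ℝ → ℕ → ℕ → Set
  Above x a c = (+ a ℤ.- + c) / M ∈ x

  Above-+ : ∀ {x y} a b c d → Above x a c → Above y b d → Above (x + y) (a ℕ.+ b) (c ℕ.+ d)
  Above-+ {x} {y} a b c d ax by =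
    let (r , <r , r∈x) = ℝ.rounded x ax ; (s , <s , s∈y) = ℝ.rounded y by in
    _ , (r , s , r∈x , s∈y , refl) ,
    subst (ℚ._< r ℚ.+ s) (trans (frac-+ (+ a ℤ.- + c) (+ b ℤ.- + d) M) (cong (_/ M) (rearrange (+ a) (+ b) (+ c) (+ d))))
      (ℚ.+-mono-< <r <s)
    where
    rearrange : ∀ i j k l → (i ℤ.- k) ℤ.+ (j ℤ.- l) ≡ (i ℤ.+ j) ℤ.- (k ℤ.+ l)
    rearrange = ℤRing.solve-∀

  Above-1 : ∀ a c → Above 1ℝ a c → a ℕ.≤ M ℕ.+ c
  Above-1 a c (_ , refl , <1) with a ℕ.≤? M ℕ.+ c
  ... | yes a≤ = a≤
  ... | no  a≰ with ℕ.m≤n⇒∃[o]m+o≡n (ℕ.<⇒≤ (ℕ.≰⇒> a≰))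
  ...   | o , refl = contradiction
            (frac-<⁻¹ (M ℕ.+ o) M 1 1 (subst (λ i → i / M ℚ.< + 1 / 1) numerator <1))
            (ℕ.≤⇒≯ (ℕ.≤-trans (ℕ.≤-reflexive (ℕ.*-identityˡ M)) (ℕ.≤-trans (ℕ.m≤m+n M o) (ℕ.≤-reflexive (sym (ℕ.*-identityʳ (M ℕ.+ o)))))))
    where
    numerator : + (M ℕ.+ c ℕ.+ o) ℤ.- + c ≡ + (M ℕ.+ o)
    numerator = trans (cong (λ z → + z ℤ.- + c) (swap M c o)) (trans (ℤ.m-n≡m⊖n (M ℕ.+ o ℕ.+ c) c)
      (trans (ℤ.⊖-≥ (ℕ.m≤n+m c (M ℕ.+ o))) (cong +_ (ℕ.m+n∸n≡m (M ℕ.+ o) c))))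
      where
      swap : ∀ a b c → a ℕ.+ b ℕ.+ c ≡ a ℕ.+ c ℕ.+ b
      swap = solve-∀

  ≼-+ : ∀ {x y} a b → x ≼ + a / M → y ≼ + b / M → x + y ≼ + (a ℕ.+ b) / M
  ≼-+ {x} {y} a b hx hy = subst (x + y ≼_) (trans (frac-+ (+ a) (+ b) M) (cong (_/ M) (sym (ℤ.pos-+ a b))))
    (+-≼ {x} {y} hx hy)

  sum-≼ : ∀ {A : Set} (xs : List A) (ω : A → ℝ) (v : A → ℕ) →
          (∀ x → ω x ≼ + v x / M) → sumℝ (List.map ω xs) ≼ + ∑ xs v / M
  sum-≼ []       ω v h = ≼-trans {0ℝ} (fromℚ-≼ 0ℚ) (0≤frac 0 M)
  sum-≼ (x ∷ xs) ω v h = ≼-+ {ω x} {sumℝ (List.map ω xs)} (v x) (∑ xs v) (h x) (sum-≼ xs ω v h)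

  Approx : ℝ → Set
  Approx x = ∃[ n ] x ≼ + n / M × Above x n 1

  -- Membership in a cut is not decidable, but the final goal is a negation, so double negation
  -- suffices. The search descends from an upper bound and may stop at 0, because `-1 / M` lies
  -- below every nonnegative real.
  approx : ∀ x → 0ℝ ≤ x → ¬ ¬ Approx x
  approx x 0≤x = search (M ℕ.* ceil b) large
    where
    b : ℚ
    b = proj₁ (ℝ.bounded x)

    large : ¬ (+ (M ℕ.* ceil b) / M) ∈ x
    large n∈x = proj₂ (ℝ.bounded x) (≤-∈ x (ℚ.≤-trans (≤-ceil b) (ceil≤ M (ceil b))) n∈x)
      where
      ceil≤ : ∀ M c .{{_ : NonZero M}} → + c / 1 ℚ.≤ + (M ℕ.* c) / M
      ceil≤ (suc M) c = frac-≤ c 0 (suc M ℕ.* c) M (ℕ.≤-reflexive (trans (ℕ.*-comm c (suc M)) (sym (ℕ.*-identityʳ _))))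

    search : ∀ n → ¬ (+ n / M) ∈ x → ¬ ¬ Approx x
    search zero    n∉x ¬app = ¬app (0 , ∉⇒≼ x n∉x , 0≤x _ (0ℚ , refl , negative M))
      where
      negative : ∀ M .{{_ : NonZero M}} → (+ 0 ℤ.- + 1) / M ℚ.< 0ℚ
      negative (suc M) = ℚ.negative⁻¹ ((+ 0 ℤ.- + 1) / suc M)
        {{ℚ.neg-pos {ℚ.normalize 1 (suc M)} (ℚ.normalize-pos 1 (suc M))}}
    search (suc n) n∉x ¬app = ¬¬-excluded-middle λ where
      (yes n∈x) → ¬app (suc n , ∉⇒≼ x n∉x , n∈x)
      (no  n∉x) → search n n∉x ¬app

∑-filter : ∀ {A : Set} {P : A → Set} (P? : ∀ x → Dec (P x)) (xs : List A) v →
           ∑ (filter P? xs) v ℕ.+ ∑ xs (λ x → v x ℕ.* [ not (does (P? x)) ]) ≡ ∑ xs v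
∑-filter P? []       v = refl
∑-filter P? (x ∷ xs) v with does (P? x)
... | true  = trans (lemma (v x) (∑ (filter P? xs) v) _) (cong (v x ℕ.+_) (∑-filter P? xs v))
  where
  lemma : ∀ a b c → a ℕ.+ b ℕ.+ (a ℕ.* 0 ℕ.+ c) ≡ a ℕ.+ (b ℕ.+ c)
  lemma = solve-∀
... | false = trans (lemma (v x) (∑ (filter P? xs) v) _) (cong (v x ℕ.+_) (∑-filter P? xs v))
  where
  lemma : ∀ a b c → b ℕ.+ (a ℕ.* 1 ℕ.+ c) ≡ a ℕ.+ (b ℕ.+ c)
  lemma = solve-∀

bits : List Bool
bits = false ∷ true ∷ []

words : ∀ T → List (Vec Bool T)
words = vectors bits

-- Additivity of the measure splits off the last round, whereas `vectors` builds words from the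
-- front.
∑-snoc : ∀ T (φ : Vec Bool (suc T) → ℕ) →
         ∑ (words (suc T)) φ ≡ ∑ (words T) (λ w → φ (w ∷ʳ false) ℕ.+ φ (w ∷ʳ true))
∑-snoc zero    φ = lemma (φ (false ∷ [])) (φ (true ∷ []))
  where
  lemma : ∀ a b → a ℕ.+ (b ℕ.+ 0) ≡ a ℕ.+ b ℕ.+ 0
  lemma = solve-∀
∑-snoc (suc T) φ = trans (∑-vectors bits (suc T) φ)
  (trans (∑-cong bits (λ b → ∑-snoc T (λ w → φ (b ∷ w))))
         (sym (∑-vectors bits T (λ w → φ (w ∷ʳ false) ℕ.+ φ (w ∷ʳ true)))))

¬¬-choice : ∀ T {P : Vec Bool T → Set} → (∀ w → ¬ ¬ P w) → ¬ ¬ (∀ w → P w)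
¬¬-choice zero    h k = h [] λ p → k λ { [] → p }
¬¬-choice (suc T) h k = ¬¬-choice T (λ w → h (false ∷ w)) λ h₀ →
  ¬¬-choice T (λ w → h (true ∷ w)) λ h₁ → k λ { (false ∷ w) → h₀ w ; (true ∷ w) → h₁ w }

module Weights (𝒜 : Algorithm) (M : ℕ) .{{M≢0 : NonZero M}} where

  open Distribution 𝒜 using (mass; nonneg; total; additive)
  open Approximation M

  -- Words are merged along their last round by additivity, down to the empty word of mass 1;
  -- numerators and error counts just add up.
  above-total : ∀ T (a c : Vec Bool T → ℕ) → (∀ w → Above (mass w) (a w) (c w)) →
                ∑ (words T) a ℕ.≤ M ℕ.+ ∑ (words T) c
  above-total zero a c h = subst₂ (λ x y → x ℕ.≤ M ℕ.+ y) (sym (ℕ.+-identityʳ (a []))) (sym (ℕ.+-identityʳ (c [])))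
    (Above-1 (a []) (c []) (proj₁ total _ (h [])))
  above-total (suc T) a c h = subst₂ (λ x y → x ℕ.≤ M ℕ.+ y) (sym (∑-snoc T a)) (sym (∑-snoc T c))
    (above-total T _ _ λ w → proj₂ (additive w) _
      (Above-+ {mass (w ∷ʳ false)} {mass (w ∷ʳ true)}
        (a (w ∷ʳ false)) (a (w ∷ʳ true)) (c (w ∷ʳ false)) (c (w ∷ʳ true)) (h (w ∷ʳ false)) (h (w ∷ʳ true))))

  below-total : ∀ T (a : Vec Bool T → ℕ) → (∀ w → mass w ≼ + a w / M) → M ℕ.≤ ∑ (words T) a
  below-total zero a h = subst (M ℕ.≤_) (sym (ℕ.+-identityʳ (a []))) (ℕ.≮⇒≥ λ a<M →
    ℚ.<-irrefl refl (h [] (+ a [] / M) (proj₂ total _ (_ , refl ,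
      frac-< (a []) M 1 1 (subst₂ ℕ._<_ (sym (ℕ.*-identityʳ (a []))) (sym (ℕ.*-identityˡ M)) a<M)))))
  below-total (suc T) a h = subst (M ℕ.≤_) (sym (∑-snoc T a)) (below-total T _ λ w p p∈ →
    ≼-+ {mass (w ∷ʳ false)} {mass (w ∷ʳ true)} (a (w ∷ʳ false)) (a (w ∷ʳ true)) (h (w ∷ʳ false)) (h (w ∷ʳ true)) p (proj₁ (additive w) p p∈))

  module _ (H : ℕ) (V : Vec Bool H → ℕ) (V-above : ∀ w → mass w ≼ + V w / M) where

    ∏mass : ∀ {k} → Vec (Vec Bool H) k → ℕ
    ∏mass = Space.mass (words H) V roundSet

    product-≼ : ∀ {k} (ws : Vec (Vec Bool H) k) .{{_ : NonZero (M ^ k)}} →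
                productℝ (List.map mass (Vec.toList ws)) ≼ + ∏mass ws / M ^ k
    product-≼ []       = fromℚ-≼ _
    product-≼ {suc k} (w ∷ ws) = subst (productℝ (List.map mass (Vec.toList (w ∷ ws))) ≼_)
      (frac-* (V w) M (∏mass ws) (M ^ k))
      (*-≼ {mass w} {productℝ (List.map mass (Vec.toList ws))} (0≤frac (V w) M) (0≤frac (∏mass ws) (M ^ k)) (V-above w) (product-≼ ws))
      where
      instance
        Mᵏ≢0 : NonZero (M ^ k)
        Mᵏ≢0 = ℕ.m^n≢0 M k

    module _ (k : ℕ) where

      instance
        Mᵏ≢0 : NonZero (M ^ k)
        Mᵏ≢0 = ℕ.m^n≢0 M k

      Pr-≼ : ∀ {E : (Fin k → RoundSet) → Set} (E? : ∀ X → Dec (E X)) s →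
        ∑ (filter (λ ws → E? (λ i → roundSet (lookup ws i))) (profiles k H)) ∏mass ≡ s → Pr 𝒜 k H E? ≼ + s / M ^ k
      Pr-≼ E? _ refl = Approximation.sum-≼ (M ^ k) (filter (λ ws → E? (λ i → roundSet (lookup ws i))) (profiles k H))
        (λ ws → productℝ (List.map mass (Vec.toList ws))) ∏mass (λ ws → product-≼ ws)

-- An exponent `m / suc n` outside `η` is at least `1 / e`, so `k ^ m` dominates `2 ^ (b * suc n)`,
-- and taking roots gives `c * 2 ^ b ≤ suc d`.
power-gap : ∀ η e k b .{{_ : NonZero e}} .{{_ : NonZero k}} .{{_ : NonZero (2 ^ b)}} → (+ 1 / e) ∈ η → 2 ^ (e ℕ.* b) ℕ.≤ k →
            ¬ (+ 1 / 2 ^ b) ∈ (1/ k ^ η)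
power-gap η e@(suc e-1) k b 1/e∈η ≤k (_ , root m n c d m/n∉η h , <c/d) =
  ℕ.<⇒≱ (frac-<⁻¹ 1 (2 ^ b) c (suc d) <c/d)
    (ℕ.≤-trans (^-cancel-≤ (c ℕ.* 2 ^ b) (suc d) n chain) (ℕ.≤-reflexive (sym (ℕ.*-identityˡ (suc d)))))
  where
  open ℕ.≤-Reasoning
  n≤em : suc n ℕ.≤ e ℕ.* m
  n≤em = subst₂ ℕ._≤_ (ℕ.*-identityˡ (suc n)) (ℕ.*-comm m e)
    (frac-≤⁻¹ 1 e-1 m n (∈-≤ η 1/e∈η m/n∉η))
  swap : ∀ e b m → b ℕ.* (e ℕ.* m) ≡ e ℕ.* b ℕ.* m
  swap = solve-∀
  chain : (c ℕ.* 2 ^ b) ^ suc n ℕ.≤ suc d ^ suc n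
  chain = begin
    (c ℕ.* 2 ^ b) ^ suc n             ≡⟨ ^-distribʳ-* (suc n) c (2 ^ b) ⟩
    c ^ suc n ℕ.* (2 ^ b) ^ suc n     ≡⟨ cong (c ^ suc n ℕ.*_) (ℕ.^-*-assoc 2 b (suc n)) ⟩
    c ^ suc n ℕ.* 2 ^ (b ℕ.* suc n)   ≤⟨ ℕ.*-monoʳ-≤ (c ^ suc n) (ℕ.^-monoʳ-≤ 2 (ℕ.*-monoʳ-≤ b n≤em)) ⟩
    c ^ suc n ℕ.* 2 ^ (b ℕ.* (e ℕ.* m)) ≡⟨ cong (λ z → c ^ suc n ℕ.* 2 ^ z) (swap e b m) ⟩
    c ^ suc n ℕ.* 2 ^ (e ℕ.* b ℕ.* m) ≡⟨ cong (c ^ suc n ℕ.*_) (sym (ℕ.^-*-assoc 2 (e ℕ.* b) m)) ⟩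
    c ^ suc n ℕ.* (2 ^ (e ℕ.* b)) ^ m ≤⟨ ℕ.*-monoʳ-≤ (c ^ suc n) (ℕ.^-monoˡ-≤ m ≤k) ⟩
    c ^ suc n ℕ.* k ^ m               ≤⟨ h ⟩
    suc d ^ suc n                     ∎

-- Were `a / M + 1 / c` less than 1, then `a / M` would lie in `1ℝ - y` and hence in `x`, against
-- its upper bound.
complement-≤ : ∀ {x y a c M} .{{_ : NonZero M}} .{{_ : NonZero c}} →
  1ℝ - y ≤ x → x ≼ + a / M → ¬ (+ 1 / c) ∈ y → c ℕ.* M ℕ.≤ c ℕ.* a ℕ.+ M
complement-≤ {x} {y} {a} {c} {M} 1-y≤x x≼ c∉y = ℕ.≮⇒≥ λ lt →
  let instance
        cM≢0 : NonZero (M ℕ.* c)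
        cM≢0 = ℕ.m*n≢0 M c
      q = + a / M ; s = + 1 / c
      q+s≡ : q ℚ.+ s ≡ + (a ℕ.* c ℕ.+ M) / (M ℕ.* c)
      q+s≡ = sum a M c
      q+s<1 : q ℚ.+ s ℚ.< 1ℚ
      q+s<1 = subst (ℚ._< 1ℚ) (sym q+s≡) (frac-< (a ℕ.* c ℕ.+ M) (M ℕ.* c) 1 1
        (subst₂ ℕ._<_ (left a c M) (right c M) lt))
      (r , <r , r<1) = ℚ.<-dense q+s<1
  in ℚ.<-irrefl refl (x≼ q (1-y≤x q (r ℚ.- s , (r , s , (1ℚ , refl , r<1) , c∉y , refl) ,
       subst (ℚ._< r ℚ.- s) (cancel q s) (ℚ.+-monoˡ-< (ℚ.- s) <r))))
  where
  left : ∀ a c M → c ℕ.* a ℕ.+ M ≡ (a ℕ.* c ℕ.+ M) ℕ.* 1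
  left = solve-∀
  right : ∀ c M → c ℕ.* M ≡ 1 ℕ.* (M ℕ.* c)
  right = solve-∀
  cancel : ∀ q s → q ℚ.+ s ℚ.- s ≡ q
  cancel q s = trans (ℚ.+-assoc q s (ℚ.- s)) (trans (cong (q ℚ.+_) (ℚ.+-inverseʳ s)) (ℚ.+-identityʳ q))
  sum : ∀ a M c .{{_ : NonZero M}} .{{_ : NonZero c}} .{{_ : NonZero (M ℕ.* c)}} →
        + a / M ℚ.+ + 1 / c ≡ + (a ℕ.* c ℕ.+ M) / (M ℕ.* c)
  sum a M@(suc M-1) c@(suc c-1) = ℚ.toℚᵘ-injective (begin
    ℚ.toℚᵘ (+ a / M ℚ.+ + 1 / c)              ≈⟨ ℚ.toℚᵘ-homo-+ (+ a / M) (+ 1 / c) ⟩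
    ℚ.toℚᵘ (+ a / M) ℚᵘ.+ ℚ.toℚᵘ (+ 1 / c)    ≈⟨ ℚᵘ.+-cong (ℚ.toℚᵘ-fromℚᵘ (mkℚᵘ (+ a) M-1)) (ℚ.toℚᵘ-fromℚᵘ (mkℚᵘ (+ 1) c-1)) ⟩
    mkℚᵘ (+ a) M-1 ℚᵘ.+ mkℚᵘ (+ 1) c-1        ≈⟨ *≡* (cong (ℤ._* + (M ℕ.* c)) numerator) ⟩
    mkℚᵘ (+ (a ℕ.* c ℕ.+ M)) (c-1 ℕ.+ M-1 ℕ.* c) ≈⟨ ℚᵘ.≃-sym (ℚ.toℚᵘ-fromℚᵘ (mkℚᵘ (+ (a ℕ.* c ℕ.+ M)) (c-1 ℕ.+ M-1 ℕ.* c))) ⟩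
    ℚ.toℚᵘ (+ (a ℕ.* c ℕ.+ M) / (M ℕ.* c))    ∎)
    where
    open ℚᵘ.≃-Reasoning
    numerator : + a ℤ.* + c ℤ.+ + 1 ℤ.* + M ≡ + (a ℕ.* c ℕ.+ M)
    numerator = trans (cong₂ ℤ._+_ (sym (ℤ.pos-* a c)) (ℤ.*-identityˡ (+ M))) (sym (ℤ.pos-+ (a ℕ.* c) M))

-- A discrete mean value inequality; it bounds what rounding adds to the total mass of `suc k`
-- stations.
power-difference : ∀ N x δ k → N ℕ.≤ x ℕ.+ δ → x ℕ.≤ N → N ^ suc k ℕ.≤ x ^ suc k ℕ.+ suc k ℕ.* δ ℕ.* N ^ k
power-difference N x δ zero N≤ x≤ = subst₂ ℕ._≤_ (sym (ℕ.*-identityʳ N)) (lemma x δ) N≤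
  where
  lemma : ∀ x δ → x ℕ.+ δ ≡ x ℕ.* 1 ℕ.+ 1 ℕ.* δ ℕ.* 1
  lemma = solve-∀
power-difference N x δ (suc k) N≤ x≤ = begin
  N ℕ.* N ^ suc k
    ≤⟨ ℕ.*-monoʳ-≤ N (power-difference N x δ k N≤ x≤) ⟩
  N ℕ.* (x ^ suc k ℕ.+ suc k ℕ.* δ ℕ.* N ^ k)
    ≡⟨ lemma₁ N (x ^ suc k) (suc k ℕ.* δ) (N ^ k) ⟩
  N ℕ.* x ^ suc k ℕ.+ suc k ℕ.* δ ℕ.* N ^ suc k
    ≤⟨ ℕ.+-monoˡ-≤ (suc k ℕ.* δ ℕ.* N ^ suc k) (ℕ.*-monoˡ-≤ (x ^ suc k) N≤) ⟩
  (x ℕ.+ δ) ℕ.* x ^ suc k ℕ.+ suc k ℕ.* δ ℕ.* N ^ suc k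
    ≡⟨ cong (ℕ._+ suc k ℕ.* δ ℕ.* N ^ suc k) (ℕ.*-distribʳ-+ (x ^ suc k) x δ) ⟩
  x ^ suc (suc k) ℕ.+ δ ℕ.* x ^ suc k ℕ.+ suc k ℕ.* δ ℕ.* N ^ suc k
    ≤⟨ ℕ.+-monoˡ-≤ (suc k ℕ.* δ ℕ.* N ^ suc k) (ℕ.+-monoʳ-≤ (x ^ suc (suc k)) (ℕ.*-monoʳ-≤ δ (ℕ.^-monoˡ-≤ (suc k) x≤))) ⟩
  x ^ suc (suc k) ℕ.+ δ ℕ.* N ^ suc k ℕ.+ suc k ℕ.* δ ℕ.* N ^ suc k
    ≡⟨ lemma₂ (x ^ suc (suc k)) δ (N ^ suc k) (suc k) ⟩
  x ^ suc (suc k) ℕ.+ suc (suc k) ℕ.* δ ℕ.* N ^ suc k ∎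
  where
  open ℕ.≤-Reasoning
  lemma₁ : ∀ n x c y → n ℕ.* (x ℕ.+ c ℕ.* y) ≡ n ℕ.* x ℕ.+ c ℕ.* (n ℕ.* y)
  lemma₁ = solve-∀
  lemma₂ : ∀ x δ y k → x ℕ.+ δ ℕ.* y ℕ.+ k ℕ.* δ ℕ.* y ≡ x ℕ.+ (1 ℕ.+ k) ℕ.* δ ℕ.* y
  lemma₂ = solve-∀

module Discretisation (𝒜 : Algorithm) (f : ℕ → ℕ) (η : ℝ) (e : ℕ) .{{e≢0 : NonZero e}}
                      (1/e∈η : (+ 1 / e) ∈ η) (achieves : AchievesLatencyWHP 𝒜 f η) (H n : ℕ)
                      (M : ℕ) .{{M≢0 : NonZero M}} (fine : 2 ^ n ℕ.* (2 ^ n ℕ.* 2 ^ H) ℕ.≤ M) where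

  open Weights 𝒜 M
  open Approximation M using (Above; Approx; approx)
  open Distribution 𝒜 using (mass; nonneg)

  approximable : ¬ ¬ (∀ (w : Vec Bool H) → Approx (mass w))
  approximable = ¬¬-choice H (λ w → approx (mass w) (nonneg w))

  module _ (approximation : ∀ (w : Vec Bool H) → Approx (mass w)) where

    V : Vec Bool H → ℕ
    V w = proj₁ (approximation w)

    N : ℕ
    N = Space.N (words H) V roundSet

    V-above : ∀ w → mass w ≼ + V w / M
    V-above w = proj₁ (proj₂ (approximation w))

    M≤N : M ℕ.≤ N
    M≤N = below-total H V V-above

    N≤M+ : N ℕ.≤ M ℕ.+ 2 ^ H
    N≤M+ = subst (λ z → N ℕ.≤ M ℕ.+ z) (trans (∑-vectors-const bits H 1) (ℕ.*-identityʳ (2 ^ H)))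
      (above-total H V (λ _ → 1) (λ w → proj₂ (proj₂ (approximation w))))

    -- One `N ^ k` comes from the failure probability allowed by the latency guarantee. The other is
    -- the rounding error, which `fine` keeps small.
    reliable : Space.Reliable (words H) V roundSet f H e n
    reliable k′ b d wake refl b≤n k≤ kb h≡H = begin
      2 ^ b ℕ.* Fail                        ≤⟨ ℕ.+-cancelˡ-≤ (2 ^ b ℕ.* Succ) _ _ main ⟩
      2 ℕ.* N ^ k ∎
      where
      open ℕ.≤-Reasoning
      k : ℕ
      k = suc k′

      instance
        Mᵏ : NonZero (M ^ k)
        Mᵏ = ℕ.m^n≢0 M k
        2ᵇ : NonZero (2 ^ b)
        2ᵇ = ℕ.m^n≢0 2 b

      E? : ∀ X → Dec (Execution.AllSucceedWithin wake X d)
      E? X = Execution.allSucceedWithin? wake X d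

      Succ Fail : ℕ
      Succ = ∑ (filter (λ ws → E? (λ i → roundSet (lookup ws i))) (profiles k H)) (∏mass H V V-above)
      Fail = ∑ (vectors (words H) k) (λ v → ∏mass H V V-above v ℕ.* [ Space.fails (words H) V roundSet wake d v ])

      Succ+Fail : Succ ℕ.+ Fail ≡ N ^ k
      Succ+Fail = trans (∑-filter (λ ws → E? (λ i → roundSet (lookup ws i))) (profiles k H) (∏mass H V V-above)) (Space.∑-mass (words H) V roundSet k)

      at-H : 1ℝ - (1/ k ^ η) ≤ Pr 𝒜 k H E?
      at-H = subst (λ T → 1ℝ - (1/ k ^ η) ≤ Pr 𝒜 k T E?) h≡H (achieves k wake)

      Pr-above : Pr 𝒜 k H E? ≼ + Succ / M ^ k
      Pr-above = Pr-≼ H V V-above k E? Succ refl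

      gap : ¬ (+ 1 / 2 ^ b) ∈ (1/ k ^ η)
      gap = power-gap η e k b 1/e∈η kb

      mostly-successful : 2 ^ b ℕ.* M ^ k ℕ.≤ 2 ^ b ℕ.* Succ ℕ.+ M ^ k
      mostly-successful = complement-≤ {Pr 𝒜 k H E?} {1/ k ^ η} {Succ} {2 ^ b} {M ^ k} at-H Pr-above gap

      slack : 2 ^ b ℕ.* (k ℕ.* 2 ^ H) ℕ.≤ N
      slack = ℕ.≤-trans (ℕ.*-mono-≤ (ℕ.^-monoʳ-≤ 2 b≤n) (ℕ.*-monoˡ-≤ (2 ^ H) k≤)) (ℕ.≤-trans fine M≤N)

      main : 2 ^ b ℕ.* Succ ℕ.+ 2 ^ b ℕ.* Fail ℕ.≤ 2 ^ b ℕ.* Succ ℕ.+ 2 ℕ.* N ^ k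
      main = begin
        2 ^ b ℕ.* Succ ℕ.+ 2 ^ b ℕ.* Fail
          ≡⟨ sym (ℕ.*-distribˡ-+ (2 ^ b) Succ Fail) ⟩
        2 ^ b ℕ.* (Succ ℕ.+ Fail)
          ≡⟨ cong (2 ^ b ℕ.*_) Succ+Fail ⟩
        2 ^ b ℕ.* N ^ k
          ≤⟨ ℕ.*-monoʳ-≤ (2 ^ b) (power-difference N M (2 ^ H) k′ N≤M+ M≤N) ⟩
        2 ^ b ℕ.* (M ^ k ℕ.+ k ℕ.* 2 ^ H ℕ.* N ^ k′)
          ≡⟨ lemma₁ (2 ^ b) (M ^ k) (k ℕ.* 2 ^ H) (N ^ k′) ⟩
        2 ^ b ℕ.* M ^ k ℕ.+ 2 ^ b ℕ.* (k ℕ.* 2 ^ H) ℕ.* N ^ k′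
          ≤⟨ ℕ.+-mono-≤ mostly-successful (ℕ.*-monoˡ-≤ (N ^ k′) slack) ⟩
        2 ^ b ℕ.* Succ ℕ.+ M ^ k ℕ.+ N ^ k
          ≤⟨ ℕ.+-monoˡ-≤ (N ^ k) (ℕ.+-monoʳ-≤ (2 ^ b ℕ.* Succ) (ℕ.^-monoˡ-≤ k M≤N)) ⟩
        2 ^ b ℕ.* Succ ℕ.+ N ^ k ℕ.+ N ^ k
          ≡⟨ lemma₂ (2 ^ b ℕ.* Succ) (N ^ k) ⟩
        2 ^ b ℕ.* Succ ℕ.+ 2 ℕ.* N ^ k ∎
        where
        lemma₁ : ∀ a x c y → a ℕ.* (x ℕ.+ c ℕ.* y) ≡ a ℕ.* x ℕ.+ a ℕ.* c ℕ.* y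
        lemma₁ = solve-∀
        lemma₂ : ∀ x y → x ℕ.+ y ℕ.+ y ≡ x ℕ.+ 2 ℕ.* y
        lemma₂ = solve-∀

-- The growth hypothesis at powers of two.

∈-fromℕ : ∀ a b c .{{_ : NonZero b}} → a ℕ.< c ℕ.* b → (+ a / b) ∈ fromℕ c
∈-fromℕ a b c h = _ , refl , frac-< a b c 1 (subst (ℕ._< c ℕ.* b) (sym (ℕ.*-identityʳ a)) h)

∈-log₂ : ∀ x l {q} → (+ (2 ^ l) / 1) ∈ x → q ℚ.< + l / 1 → q ∈ log₂ x
∈-log₂ x l 2^l∈x q<l = _ , root l 0 (2 ^ l) 0 2^l∈x (ℕ.≤-reflexive refl) , q<l

log₂-≼ : ∀ a → log₂ (fromℕ (2 ^ a)) ≼ + a / 1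
log₂-≼ a q (_ , zero , q<0) = ℚ.<-≤-trans q<0 (0≤frac a 1)
log₂-≼ a q (_ , root m n c d (_ , refl , c/d<) h , q<m/n) =
  ℚ.<-≤-trans q<m/n (frac-≤ m n a 0 (ℕ.≤-trans (ℕ.≤-reflexive (ℕ.*-identityʳ m))
    (2^-cancel-≤ m (a ℕ.* suc n) (ℕ.*-cancelʳ-≤ (2 ^ m) (2 ^ (a ℕ.* suc n)) (suc d ^ suc n) {{ℕ.m^n≢0 (suc d) (suc n)}} chain))))
  where
  open ℕ.≤-Reasoning
  c≤ : c ℕ.≤ 2 ^ a ℕ.* suc d
  c≤ = ℕ.≤-trans (ℕ.≤-reflexive (sym (ℕ.*-identityʳ c))) (ℕ.<⇒≤ (frac-<⁻¹ c (suc d) (2 ^ a) 1 c/d<))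
  chain : 2 ^ m ℕ.* suc d ^ suc n ℕ.≤ 2 ^ (a ℕ.* suc n) ℕ.* suc d ^ suc n
  chain = begin
    2 ^ m ℕ.* suc d ^ suc n               ≤⟨ h ⟩
    c ^ suc n                             ≤⟨ ℕ.^-monoˡ-≤ (suc n) c≤ ⟩
    (2 ^ a ℕ.* suc d) ^ suc n             ≡⟨ ^-distribʳ-* (suc n) (2 ^ a) (suc d) ⟩
    (2 ^ a) ^ suc n ℕ.* suc d ^ suc n     ≡⟨ cong (ℕ._* suc d ^ suc n) (ℕ.^-*-assoc 2 a (suc n)) ⟩
    2 ^ (a ℕ.* suc n) ℕ.* suc d ^ suc n   ∎

-- Cuts are open, so each lower bound has to be undercut: `F / 2` for `F`, an eighth instead of a
-- quarter of `l * l`, and a final halving. This makes 32.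
clear-denominators : ∀ (L LL : ℝ) F k a l E .{{_ : NonZero E}} → 0 ℕ.< l →
  (+ l / 2) ∈ LL → L ≼ + a / 1 → fromℕ F * (LL * LL) ≤ fromℚ (+ 1 / E) * (fromℕ k * L) →
  F ℕ.* (l ℕ.* l) ℕ.* E ℕ.≤ k ℕ.* a ℕ.* 32
clear-denominators L LL zero        k a l E l>0 l/2∈LL L≼a h = ℕ.z≤n
clear-denominators L LL F@(suc F-1) k a l E l>0 l/2∈LL L≼a h = ℕ.<⇒≤ (subst₂ ℕ._<_
  (cong (F ℕ.* (l ℕ.* l) ℕ.*_) (ℕ.*-identityʳ E)) (cong (ℕ._* 32) (ℕ.*-identityˡ (k ℕ.* a)))
  (frac-<⁻¹ (F ℕ.* (l ℕ.* l)) 32 (1 ℕ.* (k ℕ.* a)) (E ℕ.* 1)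
    (subst (+ (F ℕ.* (l ℕ.* l)) / 32 ℚ.<_) product≡ (upper (+ (F ℕ.* (l ℕ.* l)) / 32) (h _ lower)))))
  where
  instance
    E*1≢0 : NonZero (E ℕ.* 1)
    E*1≢0 = ℕ.m*n≢0 E 1

  doubled : ∀ x c → 0 ℕ.< x → 0 ℕ.< c → x ℕ.* c ℕ.< x ℕ.* (c ℕ.+ c)
  doubled x c x>0 c>0 = ℕ.*-monoʳ-< x {{ℕ.>-nonZero x>0}} (ℕ.m<m+n c c>0)

  l²>0 : 0 ℕ.< l ℕ.* l
  l²>0 = ℕ.*-mono-≤ {1} {l} {1} {l} l>0 l>0

  LL² : (+ (l ℕ.* l) / 8) ∈ LL * LL
  LL² = ∈-* {LL} {LL} (0≤frac l 2) (0≤frac l 2) l/2∈LL l/2∈LL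
    (subst (+ (l ℕ.* l) / 8 ℚ.<_) (sym (frac-* l 2 l 2))
      (frac-< (l ℕ.* l) 8 (l ℕ.* l) 4 (doubled (l ℕ.* l) 4 l²>0 (ℕ.s≤s ℕ.z≤n))))

  lower : (+ (F ℕ.* (l ℕ.* l)) / 32) ∈ fromℕ F * (LL * LL)
  lower = ∈-* {fromℕ F} {LL * LL} (0≤frac F 2) (0≤frac (l ℕ.* l) 8)
    (∈-fromℕ F 2 F (ℕ.m<m*n F 2 (ℕ.s≤s (ℕ.s≤s ℕ.z≤n)))) LL²
    (subst (+ (F ℕ.* (l ℕ.* l)) / 32 ℚ.<_) (sym (frac-* F 2 (l ℕ.* l) 8))
      (frac-< (F ℕ.* (l ℕ.* l)) 32 (F ℕ.* (l ℕ.* l)) 16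
        (doubled (F ℕ.* (l ℕ.* l)) 16 (ℕ.*-mono-≤ {1} {F} {1} {l ℕ.* l} (ℕ.s≤s ℕ.z≤n) l²>0) (ℕ.s≤s ℕ.z≤n))))

  upper : fromℚ (+ 1 / E) * (fromℕ k * L) ≼ + 1 / E ℚ.* (+ k / 1 ℚ.* (+ a / 1))
  upper = *-≼ {fromℚ (+ 1 / E)} {fromℕ k * L} (0≤frac 1 E)
    (subst (0ℚ ℚ.≤_) (sym (frac-* k 1 a 1)) (0≤frac (k ℕ.* a) 1)) (fromℚ-≼ (+ 1 / E))
    (*-≼ {fromℕ k} {L} (0≤frac k 1) (0≤frac a 1) (fromℚ-≼ (+ k / 1)) L≼a)

  product≡ : + 1 / E ℚ.* (+ k / 1 ℚ.* (+ a / 1)) ≡ + (1 ℕ.* (k ℕ.* a)) / (E ℕ.* 1)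
  product≡ = trans (cong (+ 1 / E ℚ.*_) (frac-* k 1 a 1)) (frac-* 1 E (k ℕ.* a) 1)

-- Strictness accounts for the slack 2: openness of the cut leaves only `pred a` as exponent, and
-- `2 ^ l` must be below that.
half∈log₂log₂ : ∀ a l → 0 ℕ.< l → 2 ^ l ℕ.+ 2 ℕ.≤ a → (+ l / 2) ∈ log₂ (log₂ (fromℕ (2 ^ a)))
half∈log₂log₂ a l l>0 room = ∈-log₂ (log₂ (fromℕ (2 ^ a))) l 2^l∈
  (frac-< l 2 l 1 (ℕ.*-monoʳ-< l {{ℕ.>-nonZero l>0}} (ℕ.s≤s (ℕ.s≤s ℕ.z≤n))))
  where
  a-1<a : pred a ℕ.< a
  a-1<a = ℕ.≤-reflexive (ℕ.suc-pred a {{ℕ.>-nonZero (ℕ.≤-trans (ℕ.s≤s ℕ.z≤n) (ℕ.≤-trans (ℕ.m≤n+m 2 (2 ^ l)) room))}})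

  2^l<a-1 : 2 ^ l ℕ.< pred a
  2^l<a-1 = ℕ.≤-pred (ℕ.≤-trans (subst (ℕ._≤ a) (ℕ.+-comm (2 ^ l) 2) room) (ℕ.≤-reflexive (sym (ℕ.suc-pred a {{ℕ.>-nonZero (ℕ.≤-<-trans ℕ.z≤n a-1<a)}}))))

  2^l∈ : (+ (2 ^ l) / 1) ∈ log₂ (fromℕ (2 ^ a))
  2^l∈ = ∈-log₂ (fromℕ (2 ^ a)) (pred a)
    (∈-fromℕ (2 ^ pred a) 1 (2 ^ a) (subst (2 ^ pred a ℕ.<_) (sym (ℕ.*-identityʳ (2 ^ a)))
      (ℕ.^-monoʳ-< 2 (ℕ.s≤s (ℕ.s≤s ℕ.z≤n)) a-1<a)))
    (frac-< (2 ^ l) 1 (pred a) 1 (ℕ.*-monoˡ-< 1 2^l<a-1))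

-- Choosing `ε = 1 / (32 c)` absorbs the 32, and the threshold for `k` also serves for `a` because
-- `a ≤ 2 ^ a`.
slow : ∀ (f : ℕ → ℕ) c .{{_ : NonZero c}} →
       f ≪ (λ k → fromℕ k * log₂ (fromℕ k)) / (λ k → log₂ (log₂ (fromℕ k)) * log₂ (log₂ (fromℕ k))) →
       ∃[ A ] Slow f c A
slow f c f≪ = A , bound
  where
  instance
    32c≢0 : NonZero (c ℕ.* 32)
    32c≢0 = ℕ.m*n≢0 c 32

  ε>0 : 0ℝ < fromℚ (+ 1 / (c ℕ.* 32))
  ε>0 = 0ℚ , (_ , refl , frac-< 0 1 1 (c ℕ.* 32) (ℕ.s≤s ℕ.z≤n)) , λ { (_ , refl , 0<0) → ℚ.<-irrefl refl 0<0 }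

  A : ℕ
  A = proj₁ (f≪ (fromℚ (+ 1 / (c ℕ.* 32))) ε>0)

  bound : Slow f c A
  bound a l A≤a l>0 room = ℕ.*-cancelʳ-≤ (f (2 ^ a) ℕ.* (l ℕ.* l) ℕ.* c) (2 ^ a ℕ.* a) 32
    (ℕ.≤-trans (ℕ.≤-reflexive (ℕ.*-assoc (f (2 ^ a) ℕ.* (l ℕ.* l)) c 32))
      (clear-denominators (log₂ (fromℕ (2 ^ a))) (log₂ (log₂ (fromℕ (2 ^ a)))) (f (2 ^ a)) (2 ^ a) a l (c ℕ.* 32)
        l>0 (half∈log₂log₂ a l l>0 room) (log₂-≼ a)
        (proj₂ (f≪ (fromℚ (+ 1 / (c ℕ.* 32))) ε>0) (2 ^ a) (ℕ.≤-trans A≤a (n≤2^n a)))))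

unit-fraction : ∀ η → 0ℝ < η → ∃[ e ] (+ 1 / suc e) ∈ η
unit-fraction η (q , q∈η , q∉0) with ℝ.rounded η q∈η
... | p , q<p , p∈η = fraction p (ℚ.≤-<-trans (ℚ.≮⇒≥ λ q<0 → q∉0 (_ , refl , q<0)) q<p) p∈η
  where
  fraction : ∀ p → 0ℚ ℚ.< p → p ∈ η → ∃[ e ] (+ 1 / suc e) ∈ η
  fraction p@(mkℚ +[1+ n ] d _) 0<p p∈η = d , ≤-∈ η
    (subst (+ 1 / suc d ℚ.≤_) (ℚ.fromℚᵘ-toℚᵘ p) (frac-≤ 1 d (suc n) d (ℕ.*-monoˡ-≤ (suc d) {1} {suc n} (ℕ.s≤s ℕ.z≤n)))) p∈η
  fraction (mkℚ (+ 0) d _)    (ℚ.*<* (ℤ.+<+ ())) p∈η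
  fraction (mkℚ -[1+ n ] d _) (ℚ.*<* ()) p∈η

-- The values `n` and `H` depend only on `f`, `e` and `A`, so the precision of the weights can be
-- fixed before the measure is rounded.
refute : ∀ 𝒜 f η e A .{{_ : NonZero e}} → 0 ℕ.< e → (+ 1 / e) ∈ η → Slow f (bound-factor e) A → ¬ AchievesLatencyWHP 𝒜 f η
refute 𝒜 f η e A e>0 1/e∈η slow-f achieves = approximable λ approximation →
  Params.Parameters.contradictory f e A e>0 slow-f (words H) (V approximation) roundSet (reliable approximation)
    (ℕ.≤-trans (ℕ.s≤s ℕ.z≤n) (M≤N approximation))
  where
  H n : ℕ
  n = Params.Parameters.n f e A e>0 slow-f
  H = Params.Parameters.H f e A e>0 slow-f
  open Discretisation 𝒜 f η e 1/e∈η achieves H n (suc (2 ^ n ℕ.* (2 ^ n ℕ.* 2 ^ H))) (ℕ.n≤1+n _)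

theorem4p1 : (η : ℝ) → 0ℝ < η →
    ¬ (Σ[ 𝒜 ∈ Algorithm ] Σ[ f ∈ (ℕ → ℕ) ]
    (f ≪ (λ k → fromℕ k * log₂ (fromℕ k))
    / (λ k → log₂ (log₂ (fromℕ k)) * log₂ (log₂ (fromℕ k))))
    × AchievesLatencyWHP 𝒜 f η)
theorem4p1 η 0<η (𝒜 , f , f≪ , achieves) =
  let (e , 1/e∈η) = unit-fraction η 0<η
      (A , slow-f) = slow f (bound-factor (suc e)) {{Params.bound-factor≢0 (suc e)}} f≪
  in refute 𝒜 f η (suc e) A (ℕ.s≤s ℕ.z≤n) 1/e∈η slow-f achieves
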